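{- Let $P$ be a closed $\mathsf{HO}$ process with $\widetilde u=\mathtt{fn}(P)$ and $\widetilde v=\mathtt{rn}(P)$, and let $\sigma=\{\mathsf{init}(\widetilde u)/\widetilde u\}$. If $\Gamma;\emptyset;\Delta,\Delta_\mu\vdash P\triangleright\diamond$, where $\Delta_\mu$ only involves recursive session types, then $\mathcal G(\Gamma\sigma);\emptyset;\mathcal G(\Delta\sigma),\mathcal G(\Delta_\mu\sigma)\vdash\mathcal D(P)\triangleright\diamond$ (typability with minimal recursive session types).
   Context: **Processes.** Names $n$ are shared names $a,b,c,\dots$ or session names $s,\overline s$ (disjoint sets); duality satisfies $\overline{\overline s}=s$, $\overline a=a$. Let $u,w$ range over names and variables. Values: $V::=x\mid\lambda\widetilde x.P$. Processes considered: $P,Q::=u!\langle V\rangle.P\mid u?(x).P\mid V\,\widetilde u\mid P\mid Q\mid(\nu n)P\mid\mathbf 0$. $(\nu s)P$ binds $s$ and $\overline s$. $\mathtt{fv},\mathtt{fn}$ are free variables and names; $P$ is closed if $\mathtt{fv}(P)=\emptyset$. Processes are up to $\alpha$-conversion. The target language is polyadic: tuples may be used in session communications, abstractions and applications (not in communications on shared names). Trailing $\mathbf 0$ may be omitted. $\epsilon$ is the empty tuple. **Types.** $U::=\widetilde C\rightarrow\diamond\mid\widetilde C\multimap\diamond$ (shared / linear abstractions); $C::=S\mid\langle U\rangle$ ($\langle U\rangle$: shared channel); $S::=\mathsf{end}\mid\ !\langle U\rangle;S\mid\ ?(U);S\mid\mu\mathsf t.S\mid\mathsf t$. $\diamond$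 is the process type. Recursive types are equi-recursive, simple and contractive: in $\mu\mathsf t.S$ the body $S\neq\mathsf t$ contains no recursive types; recursive types are assumed tail-recursive (the body is a sequence of input/output prefixes ending in $\mathsf t$) unless otherwise stated. $\mathsf{tr}(S)$ says that $S$ is a (possibly unfolded) tail-recursive session type. Duality ($S_1\ \mathsf{dual}\ S_2$) exchanges $!$ and $?$ (coinductively). Bound names and variables carry type annotations: $(\nu s:C)P$, and $\lambda\widetilde x:\widetilde C^{\leadsto}.P$ with $\leadsto\in\{\multimap,\rightarrow\}$ when the abstraction has type $\widetilde C\leadsto\diamond$. *Minimal recursive session types*: session types $M::=\gamma\mid\ !\langle\widetilde U\rangle;\gamma\mid\ ?(\widetilde U);\gamma\mid\mu\mathsf t.M$ with $\gamma::=\mathsf{end}\mid\mathsf t$, where $U::=\widetilde C\rightarrow\diamond\mid\widetilde C\multimap\diamond$ and $C::=M\mid\langle U\rangle$. **Typing.** Environments: $\Gamma$ maps variables to $\widetilde C\rightarrow\diamond$ and names (or name variables) to $\langle U\rangle$; $\Lambda$ maps variables to $\widetilde C\multimap\diamond$; $\Delta$ maps names (or name variables) to session types. $\Gamma$ admits weakening, contraction, exchange; $\Lambda,\Delta$ only exchange; domains are pairwise disjoint. Rules (shown monadically; the polyadic ones are the evident tuple versions; tuples are typed componentwise, splitting $\Lambda,\Delta$): - Sess: $\Gamma;\emptyset;u:S\vdash u\triangleright S$. Sh: $\Gamma,u:\langle U\rangle;\emptyset;\emptyset\vdash u\triangleright\langle U\rangle$. LVar: $\Gamma;x:C\multimap\diamond;\emptyset\vdash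 x\triangleright C\multimap\diamond$. Nil: $\Gamma;\emptyset;\emptyset\vdash\mathbf 0\triangleright\diamond$. - Prom: from $\Gamma;\emptyset;\emptyset\vdash V\triangleright C\multimap\diamond$ infer $\Gamma;\emptyset;\emptyset\vdash V\triangleright C\rightarrow\diamond$. EProm: from $\Gamma;\Lambda,x:C\multimap\diamond;\Delta\vdash P\triangleright\diamond$ infer $\Gamma,x:C\rightarrow\diamond;\Lambda;\Delta\vdash P\triangleright\diamond$ (likewise for values). - Abs: from $\Gamma;\Lambda;\Delta_1\vdash P\triangleright\diamond$ and $\Gamma;\emptyset;\Delta_2\vdash x\triangleright C$ infer $\Gamma\setminus x;\Lambda;\Delta_1\setminus\Delta_2\vdash\lambda x.P\triangleright C\multimap\diamond$. App: from $\Gamma;\Lambda;\Delta_1\vdash V\triangleright C\leadsto\diamond$ and $\Gamma;\emptyset;\Delta_2\vdash u\triangleright C$ infer $\Gamma;\Lambda;\Delta_1,\Delta_2\vdash V\,u\triangleright\diamond$. - Send: from $u:S\in\Delta_1,\Delta_2$, $\Gamma;\Lambda_1;\Delta_1\vdash P\triangleright\diamond$, $\Gamma;\Lambda_2;\Delta_2\vdash V\triangleright U$ infer $\Gamma;\Lambda_1,\Lambda_2;((\Delta_1,\Delta_2)\setminus u:S),u:!\langle U\rangle;S\vdash u!\langle V\rangle.P\triangleright\diamond$. - Rcv: from $\Gamma;\Lambda_1;\Delta,u:S\vdash P\triangleright\diamond$ and $\Gamma;\Lambda_2;\emptyset\vdash x\triangleright U$ infer $\Gamma\setminus x;\Lambda_1\setminus\Lambda_2;\Delta,u:?(U);S\vdash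 u?(x).P\triangleright\diamond$. - Req: from $\Gamma;\emptyset;\emptyset\vdash u\triangleright\langle U\rangle$, $\Gamma;\Lambda;\Delta_1\vdash P\triangleright\diamond$, $\Gamma;\emptyset;\Delta_2\vdash V\triangleright U$ infer $\Gamma;\Lambda;\Delta_1,\Delta_2\vdash u!\langle V\rangle.P\triangleright\diamond$. Acc: from $\Gamma;\emptyset;\emptyset\vdash u\triangleright\langle U\rangle$, $\Gamma;\Lambda_1;\Delta\vdash P\triangleright\diamond$, $\Gamma;\Lambda_2;\emptyset\vdash x\triangleright U$ infer $\Gamma\setminus x;\Lambda_1\setminus\Lambda_2;\Delta\vdash u?(x).P\triangleright\diamond$. - Par: from $\Gamma;\Lambda_i;\Delta_i\vdash P_i\triangleright\diamond$ ($i=1,2$) infer $\Gamma;\Lambda_1,\Lambda_2;\Delta_1,\Delta_2\vdash P_1\mid P_2\triangleright\diamond$. End: from $\Gamma;\Lambda;\Delta\vdash P\triangleright\diamond$, $u\notin\mathrm{dom}(\Gamma,\Lambda,\Delta)$ infer $\Gamma;\Lambda;\Delta,u:\mathsf{end}\vdash P\triangleright\diamond$. Res: from $\Gamma,a:\langle U\rangle;\Lambda;\Delta\vdash P\triangleright\diamond$ infer $\Gamma;\Lambda;\Delta\vdash(\nu a)P\triangleright\diamond$. ResS: from $\Gamma;\Lambda;\Delta,s:S_1,\overline s:S_2\vdash P\triangleright\diamond$ with $S_1\ \mathsf{dual}\ S_2$ infer $\Gamma;\Lambda;\Delta\vdash(\nu s)P\triangleright\diamond$. The minimal type system is the same (polyadic)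 system with all types restricted to minimal ones. **Type decomposition $\mathcal G$** (session types go to lists of minimal session types): $\mathcal G(!\langle U\rangle;S)$ is $!\langle\mathcal G(U)\rangle;\mathsf{end}$ if $S=\mathsf{end}$ and $!\langle\mathcal G(U)\rangle;\mathsf{end},\ \mathcal G(S)$ otherwise; $\mathcal G(?(U);S)$ is $?(\mathcal G(U));\mathsf{end}$ if $S=\mathsf{end}$ and $?(\mathcal G(U));\mathsf{end},\ \mathcal G(S)$ otherwise; $\mathcal G(\mathsf{end})=\mathsf{end}$; $\mathcal G(\mathsf t)=\mathsf t$; $\mathcal G(\mu\mathsf t.S)=\mathcal R(S)$ if $\mu\mathsf t.S$ is tail-recursive and $\mu\mathsf t.\mathcal G(S)$ otherwise; $\mathcal G(C\multimap\diamond)=\mathcal G(C)\multimap\diamond$; $\mathcal G(C\rightarrow\diamond)=\mathcal G(C)\rightarrow\diamond$; $\mathcal G(\langle U\rangle)=\langle\mathcal G(U)\rangle$; on tuples $\mathcal G$ is applied componentwise and the lists are concatenated. Here $\mathcal R(\mathsf t)=\epsilon$, $\mathcal R(!\langle U\rangle;S)=\mu\mathsf t.!\langle\mathcal G(U)\rangle;\mathsf t,\ \mathcal R(S)$, $\mathcal R(?(U);S)=\mu\mathsf t.?(\mathcal G(U));\mathsf t,\ \mathcal R(S)$. Also $\mathcal R^\star(?(U);S)=\mathcal R^\star(S)$, $\mathcal R^\star(!\langle U\rangle;S)=\mathcal R^\star(S)$, $\mathcal R^\star(\mu\mathsf t.S)=\mathcal R(S)$. $|\cdot|$ of a list is its length.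 On environments: $\mathcal G(\emptyset)=\emptyset$; $\mathcal G(\Delta,u_i:S)=\mathcal G(\Delta),(u_i,\dots,u_{i+|\mathcal G(S)|-1}):\mathcal G(S)$; $\mathcal G(\Gamma,u_i:\langle U\rangle)=\mathcal G(\Gamma),u_i:\mathcal G(\langle U\rangle)$; $\mathcal G(\Gamma,x:U)=\mathcal G(\Gamma),x:\mathcal G(U)$; $\mathcal G(\Lambda,x:U)=\mathcal G(\Lambda),x:\mathcal G(U)$. **Index function.** For an (unfolded) recursive session type $S$: $f(S)=f'_0(S'\{S/\mathsf t\})$ if $S=\mu\mathsf t.S'$, and $f(S)=f'_0(S)$ otherwise, where $f'_l(\mu\mathsf t.S)=|\mathcal R(S)|-l+1$, $f'_l(!\langle U\rangle;S)=f'_{l+1}(S)$, $f'_l(?(U);S)=f'_{l+1}(S)$. **Indexed names.** $\mathsf{init}(a,b,s,s',\dots)=(a_1,b_1,s_1,s'_1,\dots)$. A process is initialized if all its names carry an index. $\mathtt{rn}(P)$ is the set of free names of $P$ whose types are recursive. **Degree.** $|u_i!\langle V\rangle.Q|=|V|+|Q|+1$; $|u_i?(y).Q|=|Q|+1$; $|V\,\widetilde u|=|V|+1$; $|(\nu s:C)P'|=|P'|$; $|Q\mid R|=|Q|+|R|+1$; $|\mathbf 0|=1$; for values $|\lambda\widetilde x:\widetilde C^{\multimap}.P|=|P|$, $|\lambda\widetilde x:\widetilde C^{\rightarrow}.P|=0$, $|y|=0$. **Breakdown.** Propagators $c_k,c_{k+1},\dots$ are reserved session names; in addition, for each name (or name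 variable) $r$ of recursive type there is a reserved shared name $c^r$. When $\widetilde x=\epsilon$, the prefix $c_k?()$ means $c_k?(x)$ and $\overline{c_k}!\langle\rangle$ means $\overline{c_k}!\langle\lambda x.\mathbf 0\rangle$, with types $?(\mathsf{end}\rightarrow\diamond);\mathsf{end}$ and $!\langle\mathsf{end}\rightarrow\diamond\rangle;\mathsf{end}$. For $k>0$ and a tuple of variables $\widetilde x$ (the context; higher-order variables only, name variables being treated as indexed names), using type information: *Non-recursive cases:* - $\mathcal B_k^{\tilde x}(u_i!\langle V\rangle.Q)=c_k?(\widetilde x).u_i!\langle\mathcal V_{k+1}^{\tilde y}(V\sigma)\rangle.\overline{c_{k+l+1}}!\langle\widetilde z\rangle\mid\mathcal B_{k+l+1}^{\tilde z}(Q\sigma)$, with $\widetilde y=\mathtt{fv}(V)$, $\widetilde z=\mathtt{fv}(Q)$, $l=|V|$, and $\sigma=\{u_{i+1}/u_i\}$ if $u_i$ has a session type, $\sigma=\{\}$ otherwise. - $\mathcal B_k^{\tilde x}(u_i?(y).Q)=c_k?(\widetilde x).u_i?(y).\overline{c_{k+1}}!\langle\widetilde x'\rangle\mid\mathcal B_{k+1}^{\tilde x'}(Q\sigma)$, with $\widetilde x'=\mathtt{fv}(Q)$, $\sigma$ as before. - $\mathcal B_k^{\tilde x}(V\,u_i)=c_k?(\widetilde x).(\mathcal V_{k+1}^{\tilde x}(V)\,\widetilde m)$, with $u_i:C$, $\widetilde x=\mathtt{fv}(V)$, $\widetilde m=(u_i,\dots,u_{i+|\mathcal G(C)|-1})$.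 - $\mathcal B_k^{\tilde x}((\nu s:C)P')=(\nu\widetilde s:\mathcal G(C))\mathcal B_k^{\tilde x}(P'\sigma)$, with $\widetilde x=\mathtt{fv}(P')$, $\widetilde s=(s_1,\dots,s_{|\mathcal G(C)|})$, $\sigma=\{s_1\overline{s_1}/s\overline s\}$ if $C$ is a session type, $\sigma=\{s_1/s\}$ if $C=\langle U\rangle$. - $\mathcal B_k^{\tilde x}(Q\mid R)=c_k?(\widetilde x).\overline{c_{k+1}}!\langle\widetilde y\rangle.\overline{c_{k+l+1}}!\langle\widetilde z\rangle\mid\mathcal B_{k+1}^{\tilde y}(Q)\mid\mathcal B_{k+l+1}^{\tilde z}(R)$, with $\widetilde y=\mathtt{fv}(Q)$, $\widetilde z=\mathtt{fv}(R)$, $l=|Q|$. - $\mathcal B_k^{\tilde x}(\mathbf 0)=c_k?().\mathbf 0$; $\mathcal V_k^{\tilde x}(y)=y$. - $\mathcal V_k^{\tilde x}(\lambda y:C^{\leadsto}.P)=\lambda\widetilde y:\mathcal G(C)^{\leadsto}.(\nu\widetilde c)(\overline{c_k}!\langle\widetilde x\rangle\mid\mathcal B_k^{\tilde x}(P\{y_1/y\}))$, with $\widetilde x$ the free variables of the abstraction, $\widetilde y=(y_1,\dots,y_{|\mathcal G(C)|})$, $\widetilde c=\epsilon$ if $\leadsto=\multimap$ and $\widetilde c=(c_k,\dots,c_{k+|P|-1})$ if $\leadsto=\rightarrow$. *Cases with names of tail-recursive type:* - If $r:S$, $\mathsf{tr}(S)$: $\mathcal B_k^{\tilde x}(r!\langle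 V\rangle.Q)=c_k?(\widetilde x).c^r!\langle N_V\rangle\mid\mathcal B_{k+l+1}^{\tilde w}(Q)$ with $N_V=\lambda\widetilde z.\,z_{f(S)}!\langle\mathcal V_{k+1}^{\tilde y}(V)\rangle.\overline{c_{k+l+1}}!\langle\widetilde w\rangle.c^r?(b).(b\,\widetilde z)$, $\widetilde y=\mathtt{fv}(V)$, $\widetilde w=\mathtt{fv}(Q)$, $l=|V|$, $\widetilde z=(z_1,\dots,z_{|\mathcal R^\star(S)|})$. - If $r:S$, $\mathsf{tr}(S)$: $\mathcal B_k^{\tilde x}(r?(y).Q)=c_k?(\widetilde x).c^r!\langle N_y\rangle\mid\mathcal B_{k+1}^{\tilde x'}(Q)$ with $N_y=\lambda\widetilde z.\,z_{f(S)}?(y).\overline{c_{k+1}}!\langle\widetilde x'\rangle.c^r?(b).(b\,\widetilde z)$, $\widetilde x'=\mathtt{fv}(Q)$, $\widetilde z$ as before. - For $\widetilde r=(r_1,\dots,r_n)$ with $r_i:S_i$, $\mathsf{tr}(S_i)$, and $u_i:C$ of non-recursive type (other orders and several non-recursive names are analogous): $\mathcal B_k^{\tilde x}(V\,(\widetilde r,u_i))=c_k?(\widetilde x).c^{r_1}!\langle\lambda\widetilde z_1.c^{r_2}!\langle\lambda\widetilde z_2.\cdots c^{r_n}!\langle\lambda\widetilde z_n.\,\mathcal V_{k+1}^{\tilde x}(V)\,(\widetilde z_1,\dots,\widetilde z_n,\widetilde m)\rangle\cdots\rangle\rangle$, with $\widetilde z_i=(z^i_1,\dots,z^i_{|\mathcal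 R^\star(S_i)|})$, $\widetilde m=(u_i,\dots,u_{i+|\mathcal G(C)|-1})$. - If $\mathsf{tr}(\mu\mathsf t.S)$: $\mathcal B_k^{\tilde x}((\nu s:\mu\mathsf t.S)P')=(\nu\widetilde s:\mathcal R(S))(\nu c^s)(\nu c^{\overline s})\big(c^s?(b).(b\,\widetilde s)\mid c^{\overline s}?(b).(b\,\widetilde{\overline s})\mid\mathcal B_k^{\tilde x}(P')\big)$ with $\widetilde s=(s_1,\dots,s_{|\mathcal R(S)|})$, $\widetilde{\overline s}=(\overline{s_1},\dots,\overline{s_{|\mathcal R(S)|}})$. - For $\widetilde y=(y_1,\dots,y_n)$ with $y_i:S_i$, $\mathsf{tr}(S_i)$, and $z:C$ of non-recursive type (other orders and several such variables analogous): $\mathcal V_k^{\tilde x}(\lambda(\widetilde y,z):(\widetilde S,C)^{\leadsto}.P)=\lambda(\widetilde{y^1},\dots,\widetilde{y^n},\widetilde z):(\mathcal G(S_1),\dots,\mathcal G(S_n),\mathcal G(C))^{\leadsto}.N$, with $N=(\nu c^{y_1})\cdots(\nu c^{y_n})(\nu\widetilde c)\big(\prod_{i}c^{y_i}?(b).(b\,\widetilde{y^i})\mid\overline{c_k}!\langle\widetilde x\rangle\mid\mathcal B_k^{\tilde x}(P\{z_1/z\})\big)$, $\widetilde{y^i}=(y^i_1,\dots,y^i_{|\mathcal G(S_i)|})$, $\widetilde z=(z_1,\dots,z_{|\mathcal G(C)|})$, and $\widetilde c=\epsilon$ if $\leadsto=\multimap$, $\widetilde c=(c_k,\dots,c_{k+|P|-1})$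 if $\leadsto=\rightarrow$. ($\prod$ is parallel composition.) **Decomposition.** For closed $P$ with $\widetilde u=\mathtt{fn}(P)$, $\widetilde v=\mathtt{rn}(P)$: $\mathcal D(P)=(\nu\widetilde c)(\nu\widetilde{c_r})\big(\prod_{r\in\tilde v}c^r?(b).(b\,\widetilde r)\mid\overline{c_k}!\langle\rangle.\mathbf 0\mid\mathcal B_k^\epsilon(P\sigma)\big)$ with $k>0$, $\widetilde c=(c_k,\dots,c_{k+|P|-1})$, $\widetilde{c_r}=\bigcup_{r\in\tilde v}c^r$, $\widetilde r=(r_1,\dots,r_{|\mathcal G(S)|})$ for $r:S$, $\sigma=\{\mathsf{init}(\widetilde u)/\widetilde u\}$.
   Formalization: Added: an endpoint is not mentioned after its protocol ends (else u_2 is free in D(P) but untyped). Session types are finite or (unfolded) tail-recursive, with no other prefix before a recursion; type equality is generated by unfolding, and G of an unfolded recursive type is R*. -}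

module Defs where

open import Data.Bool using (Bool; true; false; if_then_else_)
open import Data.List using (List; []; _∷_; [_]; _++_; map; foldr; length; upTo; filter; deduplicate; concatMap)
open import Data.List.Membership.Propositional using (_∈_; _∉_)
open import Data.List.Relation.Binary.Pointwise using (Pointwise)
open import Data.List.Relation.Unary.All using (All)
open import Data.List.Relation.Unary.Unique.Propositional using (Unique)
open import Data.Maybe using (Maybe; just; nothing; _>>=_; _<∣>_)
open import Data.Maybe.Relation.Binary.Pointwise using () renaming (Pointwise to MaybeRel)
open import Data.Nat using (ℕ; zero; suc; _+_; _∸_; _≟_)
open import Data.Product using (∃-syntax; _×_; _,_; proj₁; proj₂; uncurry)
open import Data.Sum using (_⊎_)
open import Data.Unit using (⊤; tt)
open import Relation.Binary using (DecidableEquality)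
open import Relation.Binary.PropositionalEquality using (_≡_; _≢_; refl; cong; cong₂)
open import Relation.Nullary using (yes; no)
open import Relation.Nullary.Decidable using (does; map′; ¬?; _×-dec_)
import Data.List.Membership.DecPropositional as DecMembership

data Mode : Set where
  lin shr : Mode

-- Recursive types are tail-recursive, so the bodies S of μt.S have a grammar of
-- their own, and it is the only place where the type variable 𝐭 may occur.
-- Payloads are tuples; `WF` below restricts the source language to 1-tuples.

mutual
  data HType : Set where
    arr : Mode → List CType → HType

  data CType : Set where
    ses : SType → CType
    ⟨_⟩ : HType → CType

  data SType : Set where
    end     : SType
    !⟨_⟩⨾_ : List HType → SType → SType
    ?⟨_⟩⨾_ : List HType → SType → SType
    μ_      : Body → SType

  data Body : Set where
    𝐭       : Body
    !⟨_⟩⨾_ : List HType → Body → Body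
    ?⟨_⟩⨾_ : List HType → Body → Body

infixr 6 !⟨_⟩⨾_ ?⟨_⟩⨾_
infixr 6 μ_

pattern _⊸⋄ Cs = arr lin Cs
pattern _→⋄ Cs = arr shr Cs

_[_/𝐭] : Body → SType → SType
𝐭 [ T /𝐭]              = T
(!⟨ Us ⟩⨾ B) [ T /𝐭] = !⟨ Us ⟩⨾ (B [ T /𝐭])
(?⟨ Us ⟩⨾ B) [ T /𝐭] = ?⟨ Us ⟩⨾ (B [ T /𝐭])

dualᴮ : Body → Body
dualᴮ 𝐭              = 𝐭
dualᴮ (!⟨ Us ⟩⨾ B) = ?⟨ Us ⟩⨾ dualᴮ B
dualᴮ (?⟨ Us ⟩⨾ B) = !⟨ Us ⟩⨾ dualᴮ B

dual : SType → SType
dual end             = end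
dual (!⟨ Us ⟩⨾ S) = ?⟨ Us ⟩⨾ dual S
dual (?⟨ Us ⟩⨾ S) = !⟨ Us ⟩⨾ dual S
dual (μ B)           = μ dualᴮ B

-- Equi-recursion: the congruence generated by μt.S ≈ S{μt.S/t}.  It is not the
-- equality of infinite unfoldings: that one would also identify μt.!U;?W;t with
-- !U;μt.?W;!U;t, and μt.!U;t with μt.!U;!U;t, on which 𝒢 and the index function
-- differ.

mutual
  data _≈_ : SType → SType → Set where
    unfold  : ∀ {B} → (μ B) ≈ (B [ μ B /𝐭])
    ≈-refl  : ∀ {S} → S ≈ S
    ≈-sym   : ∀ {S T} → S ≈ T → T ≈ S
    ≈-trans : ∀ {S T R} → S ≈ T → T ≈ R → S ≈ R
    !-cong  : ∀ {Us Ws S T} → Pointwise _≈ᵁ_ Us Ws → S ≈ T → (!⟨ Us ⟩⨾ S) ≈ (!⟨ Ws ⟩⨾ T)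
    ?-cong  : ∀ {Us Ws S T} → Pointwise _≈ᵁ_ Us Ws → S ≈ T → (?⟨ Us ⟩⨾ S) ≈ (?⟨ Ws ⟩⨾ T)
    μ-cong  : ∀ {A B} → A ≈ᴮ B → (μ A) ≈ (μ B)

  data _≈ᴮ_ : Body → Body → Set where
    𝐭-cong : 𝐭 ≈ᴮ 𝐭
    !-cong : ∀ {Us Ws A B} → Pointwise _≈ᵁ_ Us Ws → A ≈ᴮ B → (!⟨ Us ⟩⨾ A) ≈ᴮ (!⟨ Ws ⟩⨾ B)
    ?-cong : ∀ {Us Ws A B} → Pointwise _≈ᵁ_ Us Ws → A ≈ᴮ B → (?⟨ Us ⟩⨾ A) ≈ᴮ (?⟨ Ws ⟩⨾ B)

  data _≈ᵁ_ : HType → HType → Set where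
    arr-cong : ∀ {m Cs Ds} → Pointwise _≈ᶜ_ Cs Ds → arr m Cs ≈ᵁ arr m Ds

  data _≈ᶜ_ : CType → CType → Set where
    ses-cong : ∀ {S T} → S ≈ T → ses S ≈ᶜ ses T
    ⟨⟩-cong  : ∀ {U W} → U ≈ᵁ W → ⟨ U ⟩ ≈ᶜ ⟨ W ⟩

infix 4 _≈_ _≈ᴮ_ _≈ᵁ_ _≈ᶜ_

_Dual_ : SType → SType → Set
S₁ Dual S₂ = dual S₁ ≈ S₂

mutual
  data NoRec : SType → Set where
    end : NoRec end
    !⨾  : ∀ {Us S} → All NoRecᵁ Us → NoRec S → NoRec (!⟨ Us ⟩⨾ S)
    ?⨾  : ∀ {Us S} → All NoRecᵁ Us → NoRec S → NoRec (?⟨ Us ⟩⨾ S)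

  data NoRecᶜ : CType → Set where
    ses : ∀ {S} → NoRec S → NoRecᶜ (ses S)
    ⟨_⟩ : ∀ {U} → NoRecᵁ U → NoRecᶜ ⟨ U ⟩

  data NoRecᵁ : HType → Set where
    arr : ∀ {m Cs} → All NoRecᶜ Cs → NoRecᵁ (arr m Cs)

data Suffix : SType → SType → Set where
  here : ∀ {S} → Suffix S S
  !⨾   : ∀ {Us S T} → Suffix S T → Suffix S (!⟨ Us ⟩⨾ T)
  ?⨾   : ∀ {Us S T} → Suffix S T → Suffix S (?⟨ Us ⟩⨾ T)

-- Source types: a session type is either free of recursion along its
-- continuations (`Finite`) or an at most once unfolded, contractive, simple and
-- tail-recursive type (`Tr`, the predicate tr of the decomposition).  This
-- excludes a proper non-recursive prefix in front of a recursive type.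

mutual
  data WF : SType → Set where
    finite : ∀ {S} → Finite S → WF S
    tr     : ∀ {S} → Tr S → WF S

  data Finite : SType → Set where
    end : Finite end
    !⨾  : ∀ {U S} → WFᵁ U → Finite S → Finite (!⟨ [ U ] ⟩⨾ S)
    ?⨾  : ∀ {U S} → WFᵁ U → Finite S → Finite (?⟨ [ U ] ⟩⨾ S)

  data Tr : SType → Set where
    mk : ∀ {B S} → B ≢ 𝐭 → WFᴮ B → Suffix S (B [ μ B /𝐭]) → Tr S

  data WFᴮ : Body → Set where
    𝐭  : WFᴮ 𝐭
    !⨾ : ∀ {U B} → WFᵁ U → NoRecᵁ U → WFᴮ B → WFᴮ (!⟨ [ U ] ⟩⨾ B)
    ?⨾ : ∀ {U B} → WFᵁ U → NoRecᵁ U → WFᴮ B → WFᴮ (?⟨ [ U ] ⟩⨾ B)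

  data WFᶜ : CType → Set where
    ses : ∀ {S} → WF S → WFᶜ (ses S)
    ⟨_⟩ : ∀ {U} → WFᵁ U → WFᶜ ⟨ U ⟩

  data WFᵁ : HType → Set where
    arr : ∀ {m Cs} → All WFᶜ Cs → WFᵁ (arr m Cs)

mutual
  data Minimal : SType → Set where
    end : Minimal end
    !⨾  : ∀ {Us} → All Minimalᵁ Us → Minimal (!⟨ Us ⟩⨾ end)
    ?⨾  : ∀ {Us} → All Minimalᵁ Us → Minimal (?⟨ Us ⟩⨾ end)
    μ!  : ∀ {Us} → All Minimalᵁ Us → All NoRecᵁ Us → Minimal (μ !⟨ Us ⟩⨾ 𝐭)
    μ?  : ∀ {Us} → All Minimalᵁ Us → All NoRecᵁ Us → Minimal (μ ?⟨ Us ⟩⨾ 𝐭)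

  data Minimalᶜ : CType → Set where
    ses : ∀ {S} → Minimal S → Minimalᶜ (ses S)
    ⟨_⟩ : ∀ {U} → Minimalᵁ U → Minimalᶜ ⟨ U ⟩

  data Minimalᵁ : HType → Set where
    arr : ∀ {m Cs} → All Minimalᶜ Cs → Minimalᵁ (arr m Cs)

-- `source` is HO; `target` is its polyadic variant with indexed and reserved
-- names.

data Lang : Set where
  source target : Lang

data Pol : Set where
  pos neg : Pol

-- sh a is a shared name, se s pos and se s neg are the dual endpoints s and s̄,
-- and nv x is a variable standing for a name.

data Name (A : Set) : Set where
  sh : A → Name A
  se : A → Pol → Name A
  nv : A → Name A

-- n at i is nᵢ; prop k is the propagator c_k; rec r is the r of the reserved
-- shared name c^r; zed i j is the bound name variable zⁱⱼ.

data TAtom : Set where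
  _at_ : ℕ → ℕ → TAtom
  prop : ℕ → TAtom
  rec  : Name ℕ → TAtom
  zed  : ℕ → ℕ → TAtom

data TVar : Set where
  src         : ℕ → TVar
  bvar unused : TVar

Atom : Lang → Set
Atom source = ℕ
Atom target = TAtom

Nm : Lang → Set
Nm L = Name (Atom L)

Var : Lang → Set
Var source = ℕ
Var target = TVar

Arity : Lang → ℕ → Set
Arity source n = n ≡ 1
Arity target n = ⊤

-- Restricted session names are annotated, except that a decomposition leaves
-- out the types of its propagators.

Ann : Lang → Set
Ann source = SType
Ann target = Maybe SType

annotates : ∀ L → Ann L → SType → Set
annotates source S        T = S ≡ T
annotates target (just S) T = S ≡ T
annotates target nothing  T = ⊤

infixr 7 _·_
infixr 5 _∣_

mutual
  data Val (L : Lang) : Set where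
    var : Var L → Val L
    ƛ   : Mode → List (Atom L × CType) → Proc L → Val L

  data Proc (L : Lang) : Set where
    send : Nm L → (Vs : List (Val L)) → Arity L (length Vs) → Proc L → Proc L
    recv : Nm L → (xs : List (Var L)) → Arity L (length xs) → Proc L → Proc L
    _·_  : Val L → List (Nm L) → Proc L
    _∣_  : Proc L → Proc L → Proc L
    νₛ   : Atom L → Ann L → Proc L → Proc L
    νₐ   : Atom L → HType → Proc L → Proc L
    𝟎    : Proc L

PMap : Set → Set → Set
PMap K V = K → Maybe V

∅ : ∀ {K V} → PMap K V
∅ _ = nothing

_∪_ : ∀ {K V} → PMap K V → PMap K V → PMap K V
(m₁ ∪ m₂) k = m₁ k <∣> m₂ k

module _ {K V : Set} where

  Disjoint : PMap K V → PMap K V → Set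
  Disjoint m₁ m₂ = ∀ k → m₁ k ≡ nothing ⊎ m₂ k ≡ nothing

  Empty : PMap K V → Set
  Empty m = ∀ k → m k ≡ nothing

  _≐⟦_↦_⟧ : PMap K V → K → V → Set
  m ≐⟦ k ↦ v ⟧ = m k ≡ just v × (∀ k′ → k′ ≢ k → m k′ ≡ nothing)

  -- m is the union of m₁ and m₂, whose domains are disjoint.
  _≐_⊎ᵐ_ : PMap K V → PMap K V → PMap K V → Set
  m ≐ m₁ ⊎ᵐ m₂ = ∀ k → (m k ≡ m₁ k × m₂ k ≡ nothing) ⊎ (m₁ k ≡ nothing × m k ≡ m₂ k)

  _≐_,_↦_ : PMap K V → PMap K V → K → V → Set
  m′ ≐ m , k ↦ v = m k ≡ nothing × m′ k ≡ just v × (∀ k′ → k′ ≢ k → m′ k′ ≡ m k′)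

  -- m′ is m with the value at k, which must be v, replaced by v′.
  _≐_[_∶_⇒_] : PMap K V → PMap K V → K → V → V → Set
  m′ ≐ m [ k ∶ v ⇒ v′ ] = m k ≡ just v × m′ k ≡ just v′ × (∀ k′ → k′ ≢ k → m′ k′ ≡ m k′)

-- Γ: vars maps x to C̃ when x : C̃ → ⋄, and names maps u to U when u : ⟨ U ⟩.
-- Axioms only look up Γ, so weakening, contraction and exchange are built in.
-- They also require an assumption in Λ or Δ to be absent from Γ, which keeps the
-- domains disjoint in every derivable judgement.

record SharedEnv (L : Lang) : Set where
  field
    vars  : PMap (Var L) (List CType)
    names : PMap (Nm L) HType

open SharedEnv public

LinearEnv : Lang → Set
LinearEnv L = PMap (Var L) (List CType)

SessionEnv : Lang → Set
SessionEnv L = PMap (Nm L) SType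

SameOff : ∀ {L} → List (Var L) → List (Nm L) → SharedEnv L → SharedEnv L → Set
SameOff xs us Γ Γ′ =
  (∀ x → x ∉ xs → vars Γ′ x ≡ vars Γ x) × (∀ u → u ∉ us → names Γ′ u ≡ names Γ u)

Ok : Lang → SType → Set
Ok source S = WF S
Ok target S = ∃[ M ] S ≈ M × Minimal M

Okᵁ : Lang → HType → Set
Okᵁ source U = WFᵁ U
Okᵁ target U = ∃[ M ] U ≈ᵁ M × Minimalᵁ M

Okᶜ : Lang → CType → Set
Okᶜ L (ses S) = Ok L S
Okᶜ L ⟨ U ⟩  = Okᵁ L U

-- λx̃:C̃^⇝.P is an abstraction of type C̃ ⇝ ⋄.
Agrees : ∀ {L} → Val L → HType → Set
Agrees (var x)    U          = ⊤
Agrees (ƛ m xs P) (arr m′ _) = m ≡ m′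

private variable
  L : Lang

infix 3 _⨾_⊢ⁿ_▷_ _⨾_⊢ⁿˢ_▷_ _⨾_⨾_⊢ᵛ_▷_ _⨾_⨾_⊢ᵛˢ_▷_ _⨾_⨾_⊢_

-- Γ ⨾ Δ ⊢ⁿ u ▷ C is Γ;∅;Δ ⊢ u ▷ C.

data _⨾_⊢ⁿ_▷_ {L} (Γ : SharedEnv L) (Δ : SessionEnv L) (u : Nm L) : CType → Set where
  Sess : ∀ {S} → names Γ u ≡ nothing → Δ ≐⟦ u ↦ S ⟧ → Ok L S →
         Γ ⨾ Δ ⊢ⁿ u ▷ ses S
  Sh   : ∀ {U} → names Γ u ≡ just U → Empty Δ → Okᵁ L U →
         Γ ⨾ Δ ⊢ⁿ u ▷ ⟨ U ⟩
  Conv : ∀ {C D} → Γ ⨾ Δ ⊢ⁿ u ▷ C → C ≈ᶜ D → Okᶜ L D →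
         Γ ⨾ Δ ⊢ⁿ u ▷ D

data _⨾_⊢ⁿˢ_▷_ {L} (Γ : SharedEnv L) : SessionEnv L → List (Nm L) → List CType → Set where
  []   : ∀ {Δ} → Empty Δ → Γ ⨾ Δ ⊢ⁿˢ [] ▷ []
  cons : ∀ {Δ Δ₁ Δ₂ u us C Cs} →
         Δ ≐ Δ₁ ⊎ᵐ Δ₂ → Γ ⨾ Δ₁ ⊢ⁿ u ▷ C → Γ ⨾ Δ₂ ⊢ⁿˢ us ▷ Cs →
         Γ ⨾ Δ ⊢ⁿˢ u ∷ us ▷ C ∷ Cs

-- In the binding rules the premise is typed under a Γ′ that agrees with Γ except
-- at the bound variables or names, at which Γ is arbitrary: this is Γ′ ∖ x̃
-- followed by a weakening, up to renaming of the bound x̃.  The difference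
-- Λ₁ ∖ Λ₂ is taken for Λ₂ contained in Λ₁; likewise for Δ₁ ∖ Δ₂.  A received
-- variable is typed by the judgement for values, so Rcv and Acc can also put a
-- variable of type C̃ ⊸ ⋄ into Γ′, through EProm.

mutual
  data _⨾_⨾_⊢ᵛ_▷_ {L} (Γ : SharedEnv L) (Λ : LinearEnv L) (Δ : SessionEnv L)
                  : Val L → HType → Set where
    LVar  : ∀ {x Cs} → vars Γ x ≡ nothing → Λ ≐⟦ x ↦ Cs ⟧ → Empty Δ → Okᵁ L (Cs ⊸⋄) →
            Γ ⨾ Λ ⨾ Δ ⊢ᵛ var x ▷ Cs ⊸⋄
    Prom  : ∀ {V Cs} → Empty Λ → Empty Δ →
            Γ ⨾ Λ ⨾ Δ ⊢ᵛ V ▷ Cs ⊸⋄ →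
            Γ ⨾ Λ ⨾ Δ ⊢ᵛ V ▷ Cs →⋄
    EProm : ∀ {Γ′ Λ′ x Cs V U} →
            SameOff [ x ] [] Γ Γ′ → vars Γ′ x ≡ nothing → vars Γ x ≡ just Cs →
            Λ′ ≐ Λ , x ↦ Cs →
            Γ′ ⨾ Λ′ ⨾ Δ ⊢ᵛ V ▷ U →
            Γ ⨾ Λ ⨾ Δ ⊢ᵛ V ▷ U
    Abs   : ∀ {Γ′ Δ₁ Δ₂ m xCs P} →
            let x̃ = map nv (map proj₁ xCs); C̃ = map proj₂ xCs in
            Unique x̃ → SameOff [] x̃ Γ Γ′ →
            Γ′ ⨾ Λ ⨾ Δ₁ ⊢ P →
            Γ′ ⨾ Δ₂ ⊢ⁿˢ x̃ ▷ C̃ →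
            Δ₁ ≐ Δ ⊎ᵐ Δ₂ →
            Γ ⨾ Λ ⨾ Δ ⊢ᵛ ƛ m xCs P ▷ C̃ ⊸⋄
    Conv  : ∀ {V U W} → Γ ⨾ Λ ⨾ Δ ⊢ᵛ V ▷ U → U ≈ᵁ W → Okᵁ L W →
            Γ ⨾ Λ ⨾ Δ ⊢ᵛ V ▷ W

  data _⨾_⨾_⊢ᵛˢ_▷_ {L} (Γ : SharedEnv L) : LinearEnv L → SessionEnv L →
                     List (Val L) → List HType → Set where
    []   : ∀ {Λ Δ} → Empty Λ → Empty Δ → Γ ⨾ Λ ⨾ Δ ⊢ᵛˢ [] ▷ []
    cons : ∀ {Λ Λ₁ Λ₂ Δ Δ₁ Δ₂ V Vs U Us} →
           Λ ≐ Λ₁ ⊎ᵐ Λ₂ → Δ ≐ Δ₁ ⊎ᵐ Δ₂ →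
           Agrees V U → Γ ⨾ Λ₁ ⨾ Δ₁ ⊢ᵛ V ▷ U → Γ ⨾ Λ₂ ⨾ Δ₂ ⊢ᵛˢ Vs ▷ Us →
           Γ ⨾ Λ ⨾ Δ ⊢ᵛˢ V ∷ Vs ▷ U ∷ Us

  data _⨾_⨾_⊢_ {L} (Γ : SharedEnv L) (Λ : LinearEnv L) (Δ : SessionEnv L)
               : Proc L → Set where
    Nil   : Empty Λ → Empty Δ →
            Γ ⨾ Λ ⨾ Δ ⊢ 𝟎
    EProm : ∀ {Γ′ Λ′ x Cs P} →
            SameOff [ x ] [] Γ Γ′ → vars Γ′ x ≡ nothing → vars Γ x ≡ just Cs →
            Λ′ ≐ Λ , x ↦ Cs →
            Γ′ ⨾ Λ′ ⨾ Δ ⊢ P →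
            Γ ⨾ Λ ⨾ Δ ⊢ P
    End   : ∀ {Δ′ u P} →
            names Γ u ≡ nothing → Δ ≐ Δ′ , u ↦ end →
            Γ ⨾ Λ ⨾ Δ′ ⊢ P →
            Γ ⨾ Λ ⨾ Δ ⊢ P
    Conv  : ∀ {Δ′ P} →
            (∀ u → MaybeRel _≈_ (Δ′ u) (Δ u)) → (∀ u S → Δ u ≡ just S → Ok L S) →
            Γ ⨾ Λ ⨾ Δ′ ⊢ P →
            Γ ⨾ Λ ⨾ Δ ⊢ P
    App   : ∀ {Δ₁ Δ₂ V us m Cs} →
            Δ ≐ Δ₁ ⊎ᵐ Δ₂ →
            Agrees V (arr m Cs) → Γ ⨾ Λ ⨾ Δ₁ ⊢ᵛ V ▷ arr m Cs →
            Γ ⨾ Δ₂ ⊢ⁿˢ us ▷ Cs →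
            Γ ⨾ Λ ⨾ Δ ⊢ V · us
    Send  : ∀ {Λ₁ Λ₂ Δ₀ Δ₁ Δ₂ u Vs n P Us S} →
            Λ ≐ Λ₁ ⊎ᵐ Λ₂ → Δ₀ ≐ Δ₁ ⊎ᵐ Δ₂ →
            Γ ⨾ Λ₁ ⨾ Δ₁ ⊢ P →
            Γ ⨾ Λ₂ ⨾ Δ₂ ⊢ᵛˢ Vs ▷ Us →
            Δ ≐ Δ₀ [ u ∶ S ⇒ !⟨ Us ⟩⨾ S ] → Ok L (!⟨ Us ⟩⨾ S) →
            Γ ⨾ Λ ⨾ Δ ⊢ send u Vs n P
    Rcv   : ∀ {Γ′ Λ₁ Λ₂ Δ₁ u xs n P Us S} →
            Unique xs → SameOff xs [] Γ Γ′ →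
            Γ′ ⨾ Λ₁ ⨾ Δ₁ ⊢ P →
            Γ′ ⨾ Λ₂ ⨾ ∅ ⊢ᵛˢ map var xs ▷ Us →
            Λ₁ ≐ Λ ⊎ᵐ Λ₂ →
            Δ ≐ Δ₁ [ u ∶ S ⇒ ?⟨ Us ⟩⨾ S ] → Ok L (?⟨ Us ⟩⨾ S) →
            Γ ⨾ Λ ⨾ Δ ⊢ recv u xs n P
    Req   : ∀ {Δ₁ Δ₂ u V n P U} →
            Δ ≐ Δ₁ ⊎ᵐ Δ₂ →
            Γ ⨾ ∅ ⊢ⁿ u ▷ ⟨ U ⟩ →
            Γ ⨾ Λ ⨾ Δ₁ ⊢ P →
            Agrees V U → Γ ⨾ ∅ ⨾ Δ₂ ⊢ᵛ V ▷ U →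
            Γ ⨾ Λ ⨾ Δ ⊢ send u [ V ] n P
    Acc   : ∀ {Γ′ Λ₁ Λ₂ u x n P U} →
            SameOff [ x ] [] Γ Γ′ →
            Γ ⨾ ∅ ⊢ⁿ u ▷ ⟨ U ⟩ →
            Γ′ ⨾ Λ₁ ⨾ Δ ⊢ P →
            Γ′ ⨾ Λ₂ ⨾ ∅ ⊢ᵛ var x ▷ U →
            Λ₁ ≐ Λ ⊎ᵐ Λ₂ →
            Γ ⨾ Λ ⨾ Δ ⊢ recv u [ x ] n P
    Par   : ∀ {Λ₁ Λ₂ Δ₁ Δ₂ P₁ P₂} →
            Λ ≐ Λ₁ ⊎ᵐ Λ₂ → Δ ≐ Δ₁ ⊎ᵐ Δ₂ →
            Γ ⨾ Λ₁ ⨾ Δ₁ ⊢ P₁ → Γ ⨾ Λ₂ ⨾ Δ₂ ⊢ P₂ →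
            Γ ⨾ Λ ⨾ Δ ⊢ P₁ ∣ P₂
    Res   : ∀ {Γ′ a U P} →
            SameOff [] [ sh a ] Γ Γ′ → names Γ′ (sh a) ≡ just U → Okᵁ L U →
            Γ′ ⨾ Λ ⨾ Δ ⊢ P →
            Γ ⨾ Λ ⨾ Δ ⊢ νₐ a U P
    ResS  : ∀ {Δ₁ Δ₂ s A S₁ S₂ P} →
            annotates L A S₁ → S₁ Dual S₂ → Ok L S₁ → Ok L S₂ →
            Δ₁ ≐ Δ , se s pos ↦ S₁ → Δ₂ ≐ Δ₁ , se s neg ↦ S₂ →
            Γ ⨾ Λ ⨾ Δ₂ ⊢ P →
            Γ ⨾ Λ ⨾ Δ ⊢ νₛ s A P

_≟ᵖ_ : DecidableEquality Pol
pos ≟ᵖ pos = yes refl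
pos ≟ᵖ neg = no λ ()
neg ≟ᵖ pos = no λ ()
neg ≟ᵖ neg = yes refl

_≟ⁿ_ : DecidableEquality (Nm source)
sh a   ≟ⁿ sh b   = map′ (cong sh) (λ { refl → refl }) (a ≟ b)
sh _   ≟ⁿ se _ _ = no λ ()
sh _   ≟ⁿ nv _   = no λ ()
se _ _ ≟ⁿ sh _   = no λ ()
se s p ≟ⁿ se t q = map′ (uncurry (cong₂ se)) (λ { refl → refl , refl }) (s ≟ t ×-dec p ≟ᵖ q)
se _ _ ≟ⁿ nv _   = no λ ()
nv _   ≟ⁿ sh _   = no λ ()
nv _   ≟ⁿ se _ _ = no λ ()
nv x   ≟ⁿ nv y   = map′ (cong nv) (λ { refl → refl }) (x ≟ y)

_∖ⁿ_ : List (Nm source) → List (Nm source) → List (Nm source)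
us ∖ⁿ ws = filter (λ u → ¬? (u ∈? ws)) us
  where open DecMembership _≟ⁿ_ using (_∈?_)

-- fu collects names and name variables, fv the higher-order variables.  fv is
-- duplicate-free, since its value serves as a tuple of bound variables.

mutual
  fuᵛ : Val source → List (Nm source)
  fuᵛ (var x)      = []
  fuᵛ (ƛ m xCs P) = fu P ∖ⁿ map nv (map proj₁ xCs)

  fu : Proc source → List (Nm source)
  fu (send u (V ∷ []) _ P) = u ∷ fuᵛ V ++ fu P
  fu (recv u _ _ P)        = u ∷ fu P
  fu (V · us)              = fuᵛ V ++ us
  fu (P ∣ Q)               = fu P ++ fu Q
  fu (νₛ s _ P)            = fu P ∖ⁿ (se s pos ∷ se s neg ∷ [])
  fu (νₐ a _ P)            = fu P ∖ⁿ [ sh a ]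
  fu 𝟎                     = []

mutual
  occᵛ : Val source → List ℕ
  occᵛ (var x)    = [ x ]
  occᵛ (ƛ m _ P) = occ P

  occ : Proc source → List ℕ
  occ (send _ (V ∷ []) _ P) = occᵛ V ++ occ P
  occ (recv _ (x ∷ []) _ P) = filter (λ y → ¬? (y ≟ x)) (occ P)
  occ (V · _)               = occᵛ V
  occ (P ∣ Q)               = occ P ++ occ Q
  occ (νₛ _ _ P)            = occ P
  occ (νₐ _ _ P)            = occ P
  occ 𝟎                     = []

fvᵛ : Val source → List ℕ
fvᵛ V = deduplicate _≟_ (occᵛ V)

fv : Proc source → List ℕ
fv P = deduplicate _≟_ (occ P)

Closed : Proc source → Set
Closed P = fv P ≡ [] × (∀ x → nv x ∉ fu P)

mutual
  ∣_∣ᵛ : Val source → ℕ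
  ∣ var _ ∣ᵛ       = 0
  ∣ ƛ lin _ P ∣ᵛ = ∣ P ∣ᵖ
  ∣ ƛ shr _ P ∣ᵛ = 0

  ∣_∣ᵖ : Proc source → ℕ
  ∣ send _ (V ∷ []) _ P ∣ᵖ = ∣ V ∣ᵛ + ∣ P ∣ᵖ + 1
  ∣ recv _ _ _ P ∣ᵖ        = ∣ P ∣ᵖ + 1
  ∣ V · _ ∣ᵖ               = ∣ V ∣ᵛ + 1
  ∣ P ∣ Q ∣ᵖ               = ∣ P ∣ᵖ + ∣ Q ∣ᵖ + 1
  ∣ νₛ _ _ P ∣ᵖ            = ∣ P ∣ᵖ
  ∣ νₐ _ _ P ∣ᵖ            = ∣ P ∣ᵖ
  ∣ 𝟎 ∣ᵖ                   = 1

-- On well-formed types this decides Tr.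
recursive : SType → Bool
recursive end             = false
recursive (!⟨ _ ⟩⨾ S) = recursive S
recursive (?⟨ _ ⟩⨾ S) = recursive S
recursive (μ _)           = true

-- A type that is an unfolding of a tail-recursive one is identified with it, so
-- 𝒢 maps it to ℛ⋆ of it; the clauses for prefixes apply to the other types.

mutual
  𝒢ᵁ : HType → HType
  𝒢ᵁ (arr m Cs) = arr m (𝒢ᶜˢ Cs)

  𝒢ᵁˢ : List HType → List HType
  𝒢ᵁˢ []       = []
  𝒢ᵁˢ (U ∷ Us) = 𝒢ᵁ U ∷ 𝒢ᵁˢ Us

  𝒢ᶜ : CType → List CType
  𝒢ᶜ (ses S) = map ses (𝒢 S)
  𝒢ᶜ ⟨ U ⟩   = [ ⟨ 𝒢ᵁ U ⟩ ]

  𝒢ᶜˢ : List CType → List CType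
  𝒢ᶜˢ []       = []
  𝒢ᶜˢ (C ∷ Cs) = 𝒢ᶜ C ++ 𝒢ᶜˢ Cs

  𝒢 : SType → List SType
  𝒢 end               = [ end ]
  𝒢 (!⟨ Us ⟩⨾ end) = [ !⟨ 𝒢ᵁˢ Us ⟩⨾ end ]
  𝒢 (!⟨ Us ⟩⨾ S)   = if recursive S then ℛ⋆ S else (!⟨ 𝒢ᵁˢ Us ⟩⨾ end) ∷ 𝒢 S
  𝒢 (?⟨ Us ⟩⨾ end) = [ ?⟨ 𝒢ᵁˢ Us ⟩⨾ end ]
  𝒢 (?⟨ Us ⟩⨾ S)   = if recursive S then ℛ⋆ S else (?⟨ 𝒢ᵁˢ Us ⟩⨾ end) ∷ 𝒢 S
  𝒢 (μ B)             = ℛ B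

  ℛ : Body → List SType
  ℛ 𝐭              = []
  ℛ (!⟨ Us ⟩⨾ B) = (μ !⟨ 𝒢ᵁˢ Us ⟩⨾ 𝐭) ∷ ℛ B
  ℛ (?⟨ Us ⟩⨾ B) = (μ ?⟨ 𝒢ᵁˢ Us ⟩⨾ 𝐭) ∷ ℛ B

  ℛ⋆ : SType → List SType
  ℛ⋆ end             = []
  ℛ⋆ (!⟨ _ ⟩⨾ S) = ℛ⋆ S
  ℛ⋆ (?⟨ _ ⟩⨾ S) = ℛ⋆ S
  ℛ⋆ (μ B)           = ℛ B

-- f is used on recursive types only; the clause for end is a default.
f′ : ℕ → SType → ℕ
f′ l end             = 0
f′ l (!⟨ _ ⟩⨾ S) = f′ (suc l) S
f′ l (?⟨ _ ⟩⨾ S) = f′ (suc l) S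
f′ l (μ B)           = length (ℛ B) ∸ l + 1

f : SType → ℕ
f (μ B) = f′ 0 (B [ μ B /𝐭])
f S     = f′ 0 S

_at[_] : Nm source → ℕ → Nm target
sh a   at[ i ] = sh (a at i)
se s p at[ i ] = se (s at i) p
nv x   at[ i ] = nv (x at i)

unindex : Nm target → Maybe (Nm source × ℕ)
unindex (sh (a at i))   = just (sh a , i)
unindex (se (s at i) p) = just (se s p , i)
unindex (nv (x at i))   = just (nv x , i)
unindex _               = nothing

_!_ : ∀ {A : Set} → List A → ℕ → Maybe A
(x ∷ xs) ! 1           = just x
(x ∷ xs) ! suc (suc i) = xs ! suc i
_        ! _           = nothing

-- 𝒢(Δσ) and 𝒢(Γσ), where σ gives every name the index 1.

𝒢Δσ : SessionEnv source → SessionEnv target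
𝒢Δσ Δ w = unindex w >>= λ (u , i) → Δ u >>= λ S → 𝒢 S ! i

𝒢Γσ : SharedEnv source → SharedEnv target
vars  (𝒢Γσ Γ) (src x) = vars Γ x >>= λ Cs → just (𝒢ᶜˢ Cs)
vars  (𝒢Γσ Γ) _       = nothing
names (𝒢Γσ Γ) w = unindex w >>= λ (u , i) → names Γ u >>= λ U → [ 𝒢ᵁ U ] ! i

-- The breakdown is computed from the types of the names in scope.  Instead of
-- renaming uᵢ to uᵢ₊₁ in the process, the current index of each name is recorded
-- next to its current type: the breakdown of P under E is that of the initialized
-- P in which u carries the index that E assigns to it.

Env : Set
Env = PMap (Nm source) (CType × ℕ)

_[_↦_]ᴱ : Env → Nm source → CType × ℕ → Env
(E [ u ↦ t ]ᴱ) w = if does (w ≟ⁿ u) then just t else E w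

env : SharedEnv source → SessionEnv source → Env
env Γ Δ u = (Δ u >>= λ S → just (ses S , 1)) <∣> (names Γ u >>= λ U → just (⟨ U ⟩ , 1))

_[_]ᴱ : Env → List (ℕ × CType) → Env
E [ [] ]ᴱ             = E
E [ (x , C) ∷ xCs ]ᴱ = (E [ nv x ↦ C , 1 ]ᴱ) [ xCs ]ᴱ

contᴮ : Body → SType → SType
contᴮ 𝐭             T = T
contᴮ (!⟨ _ ⟩⨾ B) T = B [ T /𝐭]
contᴮ (?⟨ _ ⟩⨾ B) T = B [ T /𝐭]

cont : SType → SType
cont end             = end
cont (!⟨ _ ⟩⨾ S) = S
cont (?⟨ _ ⟩⨾ S) = S
cont (μ B)           = contᴮ B (μ B)

after : Nm source → Env → Env
after u E with E u
... | just (ses S , i) = E [ u ↦ ses (cont S) , (if recursive S then i else suc i) ]ᴱ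
... | _                = E

recType : CType → Maybe SType
recType (ses S) = if recursive S then just S else nothing
recType ⟨ _ ⟩  = nothing

recOf : Env → Nm source → Maybe SType
recOf E u = E u >>= λ (C , _) → recType C

-- An endpoint whose protocol has been run to its end is not mentioned any more.
-- Passing such an endpoint to an abstraction with a parameter of type end would
-- leave in the decomposition a name uᵢ for which 𝒢 provides no type: for
-- u : !⟨U⟩;end, 𝒢 types u₁ only, but u!⟨V⟩.((λx.𝟎) u) is broken down into a
-- process in which u₂ is free.

Ended : Env → Nm source → Set
Ended E u = ∃[ i ] E u ≡ just (ses end , i)

mutual
  NoReuseᵛ : Env → Val source → Set
  NoReuseᵛ E (var _)     = ⊤
  NoReuseᵛ E (ƛ _ xCs P) = NoReuse (E [ xCs ]ᴱ) P

  NoReuse : Env → Proc source → Set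
  NoReuse E (send u (V ∷ []) _ P) =
    (Ended (after u E) u → u ∉ fuᵛ V ++ fu P) × NoReuseᵛ (after u E) V × NoReuse (after u E) P
  NoReuse E (recv u _ _ P) =
    (Ended (after u E) u → u ∉ fu P) × NoReuse (after u E) P
  NoReuse E (V · _)    = NoReuseᵛ E V
  NoReuse E (P ∣ Q)    = NoReuse E P × NoReuse E Q
  NoReuse E (νₛ s S P) = NoReuse ((E [ se s pos ↦ ses S , 1 ]ᴱ) [ se s neg ↦ ses (dual S) , 1 ]ᴱ) P
  NoReuse E (νₐ a U P) = NoReuse (E [ sh a ↦ ⟨ U ⟩ , 1 ]ᴱ) P
  NoReuse E 𝟎          = ⊤

c_ c̄_ : ℕ → Nm target
c k = se (prop k) pos
c̄ k = se (prop k) neg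

c^_ : Nm source → Nm target
c^ r = sh (rec r)

block : Nm source → ℕ → ℕ → List (Nm target)
block u i n = map (λ j → u at[ i + j ]) (upTo n)

-- An empty tuple is communicated as the dummy value λx.𝟎, of type end → ⋄.

cₖ : ℕ → List ℕ → Proc target → Proc target
cₖ k [] P = recv (c k) [ unused ] tt P
cₖ k xs P = recv (c k) (map src xs) tt P

c̄ₖ : ℕ → List ℕ → Proc target → Proc target
c̄ₖ k [] P = send (c̄ k) [ ƛ shr [ (zed 0 0 , ses end) ] 𝟎 ] tt P
c̄ₖ k xs P = send (c̄ k) (map (λ x → var (src x)) xs) tt P

params : (ℕ → TAtom) → ℕ → List CType → List (TAtom × CType)
params a i []       = []
params a i (C ∷ Cs) = (a i , C) ∷ params a (suc i) Cs

zParams : ℕ → SType → List (TAtom × CType)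
zParams j S = params (zed j) 1 (map ses (ℛ⋆ S))

zNames : ℕ → SType → List (Nm target)
zNames j S = map nv (map proj₁ (zParams j S))

-- c^r?(b).(b ũ)
callback : Nm source → List (Nm target) → Proc target
callback r ws = recv (c^ r) [ bvar ] tt (var bvar · ws)

-- c^r!⟨λz̃ʲ.P⟩, for r : S
request : Nm source → SType → ℕ → Proc target → Proc target
request r S j P = send (c^ r) [ ƛ lin (zParams j S) P ] tt 𝟎

-- K adds the output on the next propagator.  Here and in appBlock, the clause for
-- names without a type is a default not reached on typable processes.

sendBlock : Env → Nm source → Val target → (Proc target → Proc target) → Proc target
sendBlock E u V K with E u
... | nothing      = send (u at[ 1 ]) [ V ] tt (K 𝟎)
... | just (C , i) with recType C
...   | nothing = send (u at[ i ]) [ V ] tt (K 𝟎)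
...   | just S  = request u S 0
                    (send (nv (zed 0 (f S))) [ V ] tt (K (callback u (zNames 0 S))))

recvBlock : Env → Nm source → ℕ → (Proc target → Proc target) → Proc target
recvBlock E u y K with E u
... | nothing      = recv (u at[ 1 ]) [ src y ] tt (K 𝟎)
... | just (C , i) with recType C
...   | nothing = recv (u at[ i ]) [ src y ] tt (K 𝟎)
...   | just S  = request u S 0
                    (recv (nv (zed 0 (f S))) [ src y ] tt (K (callback u (zNames 0 S))))

-- appBlock E V 1 ũ [] wraps one request around the application of V for each
-- recursive argument; the last parameter accumulates V's arguments.
appBlock : Env → Val target → ℕ → List (Nm source) → List (Nm target) → Proc target
appBlock E V j []       ws = V · ws
appBlock E V j (u ∷ us) ws with E u
... | nothing      = appBlock E V j us ws
... | just (C , i) with recType C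
...   | nothing = appBlock E V j us (ws ++ block u i (length (𝒢ᶜ C)))
...   | just S  = request u S j (appBlock E V (suc j) us (ws ++ zNames j S))

ν̃ : ℕ → ℕ → List SType → Proc target → Proc target
ν̃ s i []       P = P
ν̃ s i (M ∷ Ms) P = νₛ (s at i) (just M) (ν̃ s (suc i) Ms P)

νc : ℕ → ℕ → Proc target → Proc target
νc k zero    P = P
νc k (suc n) P = νₛ (prop k) nothing (νc (suc k) n P)

νcʳ : List (Nm source × SType) → Proc target → Proc target
νcʳ rs P = foldr (λ (r , S) → νₐ (rec r) (map ses (ℛ⋆ S) ⊸⋄)) P rs

servers : List (Nm source × SType) → Proc target → Proc target
servers rs P = foldr (λ (r , S) Q → callback r (block r 1 (length (𝒢 S))) ∣ Q) P rs

recParams : List (ℕ × CType) → List (Nm source × SType)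
recParams []               = []
recParams ((x , C) ∷ xCs) with recType C
... | just S  = (nv x , S) ∷ recParams xCs
... | nothing = recParams xCs

mutual
  𝒱 : Env → ℕ → List ℕ → Val source → Val target
  𝒱 E k xs (var y)     = var (src y)
  𝒱 E k xs (ƛ m yCs P) =
    ƛ m (concatMap (λ (y , C) → params (y at_) 1 (𝒢ᶜ C)) yCs)
      (νcʳ rs (νc k (props m) (servers rs (c̄ₖ k xs 𝟎 ∣ ℬ (E [ yCs ]ᴱ) k xs P))))
    where
    rs : List (Nm source × SType)
    rs = recParams yCs
    props : Mode → ℕ
    props lin = 0
    props shr = ∣ P ∣ᵖ

  ℬ : Env → ℕ → List ℕ → Proc source → Proc target
  ℬ E k xs (send u (V ∷ []) _ Q) =
    let E′ = after u E
        l  = ∣ V ∣ᵛ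
    in cₖ k xs (sendBlock E u (𝒱 E′ (k + 1) (fvᵛ V) V) (c̄ₖ (k + l + 1) (fv Q)))
       ∣ ℬ E′ (k + l + 1) (fv Q) Q
  ℬ E k xs (recv u (y ∷ []) _ Q) =
    cₖ k xs (recvBlock E u y (c̄ₖ (k + 1) (fv Q))) ∣ ℬ (after u E) (k + 1) (fv Q) Q
  ℬ E k xs (V · us) = cₖ k xs (appBlock E (𝒱 E (k + 1) xs V) 1 us [])
  ℬ E k xs (νₛ s S P) =
    ν̃ s 1 (𝒢 S)
      (if recursive S
       then νcʳ ((se s pos , S) ∷ (se s neg , dual S) ∷ [])
              (servers ((se s pos , S) ∷ (se s neg , dual S) ∷ []) B)
       else B)
    where
    B : Proc target
    B = ℬ ((E [ se s pos ↦ ses S , 1 ]ᴱ) [ se s neg ↦ ses (dual S) , 1 ]ᴱ) k xs P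
  ℬ E k xs (νₐ a U P) = νₐ (a at 1) (𝒢ᵁ U) (ℬ (E [ sh a ↦ ⟨ U ⟩ , 1 ]ᴱ) k xs P)
  ℬ E k xs (Q ∣ R) =
    let l = ∣ Q ∣ᵖ
    in cₖ k xs (c̄ₖ (k + 1) (fv Q) (c̄ₖ (k + l + 1) (fv R) 𝟎))
       ∣ ℬ E (k + 1) (fv Q) Q ∣ ℬ E (k + l + 1) (fv R) R
  ℬ E k xs 𝟎 = cₖ k [] 𝟎

rn : Env → Proc source → List (Nm source × SType)
rn E P = recs (deduplicate _≟ⁿ_ (fu P))
  where
  recs : List (Nm source) → List (Nm source × SType)
  recs []       = []
  recs (u ∷ us) with recOf E u
  ... | just S  = (u , S) ∷ recs us
  ... | nothing = recs us

𝒟 : ℕ → Env → Proc source → Proc target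
𝒟 k E P = νc k ∣ P ∣ᵖ (νcʳ (rn E P) (servers (rn E P) (c̄ₖ k [] 𝟎 ∣ ℬ E k [] P)))

{-# OPTIONS --safe #-}
module Submission where

-- Typing derivations are turned into a syntax-directed judgement WT, in which the
-- types of names are those the breakdown reads off its environment E and linearity
-- says that parallel components have disjoint sets of free session names: this
-- removes End, Conv and EProm.  By induction on WT, ℬ E k P is typable when each free
-- session name u of P of non-recursive type is given its 𝒢-types from its current
-- index on, each u of recursive type only the shared name c^u, and each propagator
-- the tuple of variables it carries.  In the target every received variable is put
-- into Γ, as EProm permits, so Λ stays empty throughout; in particular the values
-- sent on the c^u satisfy the premise of Req that they contain no linear variable.

-- Three mismatches shape the proof. First, `𝒢` drops the `end` after a last prefix, so a name that
-- has just finished its protocol has no target type left; `NoReuse` ensures that it no longer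
-- occurs. An endpoint of type `end` that the source discards by End without mentioning it still has
-- a target type, and has to be discarded by End in the target too. Second, a source derivation may
-- fold or unfold types anywhere, whereas `E` records one representative per name; hence the
-- invariants of `≈`: the head after one unfolding, being `end`, being recursive, and `𝒢` up to
-- pointwise `≈`. Third, a recursive name changes its current type at each action, while `c^u` needs
-- one type for good. That type is `ℛ⋆`, which depends only on the loop: an action borrows the whole
-- tuple, acts on the `f(S)`-th entry, a loop with a single prefix that is back at its old type
-- afterwards, and returns the tuple.

open import Defs
open import Data.Bool using (Bool; true; false; if_then_else_; not)
open import Data.Empty using (⊥; ⊥-elim)
open import Data.List using (List; []; _∷_; [_]; _++_; map; filter; length; drop; concatMap; deduplicate; applyUpTo)
open import Data.List.Membership.Propositional using (_∈_; _∉_)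
open import Data.List.Membership.Propositional.Properties
  using (∈-++⁺ˡ; ∈-++⁺ʳ; ∈-++⁻; ∈-map⁺; ∈-map⁻; ∈-filter⁺; ∈-filter⁻; ∈-deduplicate⁺; ∈-deduplicate⁻)
open import Data.List.Properties using (++-assoc; ++-identityʳ; length-++; length-map; map-++; map-∘)
open import Data.List.Relation.Binary.Pointwise as PW using (Pointwise; []; _∷_)
open import Data.List.Relation.Unary.All as All using (All; []; _∷_)
open import Data.List.Relation.Unary.AllPairs using ([]; _∷_)
open import Data.List.Relation.Unary.Any using (here; there)
open import Data.List.Relation.Unary.Unique.Propositional using (Unique)
open import Data.Maybe as Maybe using (Maybe; just; nothing; maybe; _>>=_; _<∣>_)
open import Data.Maybe.Properties using (just-injective)
open import Data.Maybe.Relation.Binary.Pointwise using (just; nothing) renaming (Pointwise to MaybeRel)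
open import Data.Nat using (ℕ; zero; suc; _+_; _∸_; _≤_; _<_; _≟_; s≤s; z≤n)
open import Data.Nat.Properties
  using (+-assoc; +-comm; +-identityʳ; +-suc; <-irrefl; <⇒≤; m+n∸n≡m; m<n⇒m<1+n; m≤m+n; n<1+n; ≤-refl)
open import Data.Product using (∃-syntax; _×_; _,_; proj₁; proj₂; uncurry)
open import Data.Sum using (_⊎_; inj₁; inj₂; [_,_]′)
open import Data.Unit using (tt)
open import Function using (_∘_)
open import Relation.Binary using (DecidableEquality)
open import Relation.Binary.PropositionalEquality using (_≡_; _≢_; _≗_; refl; sym; trans; cong; cong₂; subst)
open import Relation.Nullary using (Dec; yes; no; ¬_)
open import Relation.Nullary.Decidable using (dec-false; dec-true; does; map′; ¬?; _×-dec_)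
import Data.List.Membership.DecPropositional as DecMembership
import Data.List.Relation.Unary.All.Properties as AllP
import Data.List.Relation.Unary.Unique.DecPropositional.Properties as UniqueDec
import Data.List.Relation.Unary.Unique.Propositional.Properties as UniqueP

open DecMembership _≟ⁿ_ using (_∈?_)

-- Session types and their decomposition

mutual
  ≈ᵁ-sym : ∀ {U W} → U ≈ᵁ W → W ≈ᵁ U
  ≈ᵁ-sym (arr-cong ps) = arr-cong (≈ᶜˢ-sym ps)

  ≈ᶜ-sym : ∀ {C D} → C ≈ᶜ D → D ≈ᶜ C
  ≈ᶜ-sym (ses-cong p) = ses-cong (≈-sym p)
  ≈ᶜ-sym (⟨⟩-cong p) = ⟨⟩-cong (≈ᵁ-sym p)

  ≈ᶜˢ-sym : ∀ {Cs Ds} → Pointwise _≈ᶜ_ Cs Ds → Pointwise _≈ᶜ_ Ds Cs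
  ≈ᶜˢ-sym []       = []
  ≈ᶜˢ-sym (p ∷ ps) = ≈ᶜ-sym p ∷ ≈ᶜˢ-sym ps

mutual
  ≈ᵁ-trans : ∀ {U V W} → U ≈ᵁ V → V ≈ᵁ W → U ≈ᵁ W
  ≈ᵁ-trans (arr-cong ps) (arr-cong qs) = arr-cong (≈ᶜˢ-trans ps qs)

  ≈ᶜ-trans : ∀ {C D E} → C ≈ᶜ D → D ≈ᶜ E → C ≈ᶜ E
  ≈ᶜ-trans (ses-cong p) (ses-cong q) = ses-cong (≈-trans p q)
  ≈ᶜ-trans (⟨⟩-cong p) (⟨⟩-cong q) = ⟨⟩-cong (≈ᵁ-trans p q)

  ≈ᶜˢ-trans : ∀ {Cs Ds Es} → Pointwise _≈ᶜ_ Cs Ds → Pointwise _≈ᶜ_ Ds Es → Pointwise _≈ᶜ_ Cs Es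
  ≈ᶜˢ-trans []       []       = []
  ≈ᶜˢ-trans (p ∷ ps) (q ∷ qs) = ≈ᶜ-trans p q ∷ ≈ᶜˢ-trans ps qs

mutual
  ≈ᵁ-refl : ∀ U → U ≈ᵁ U
  ≈ᵁ-refl (arr m Cs) = arr-cong (≈ᶜˢ-refl Cs)

  ≈ᶜ-refl : ∀ C → C ≈ᶜ C
  ≈ᶜ-refl (ses S) = ses-cong ≈-refl
  ≈ᶜ-refl ⟨ U ⟩   = ⟨⟩-cong (≈ᵁ-refl U)

  ≈ᶜˢ-refl : ∀ Cs → Pointwise _≈ᶜ_ Cs Cs
  ≈ᶜˢ-refl []       = []
  ≈ᶜˢ-refl (C ∷ Cs) = ≈ᶜ-refl C ∷ ≈ᶜˢ-refl Cs

≈ᵁˢ-refl : ∀ Us → Pointwise _≈ᵁ_ Us Us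
≈ᵁˢ-refl Us = PW.refl (λ {U} → ≈ᵁ-refl U)

≈ᵁˢ-sym : ∀ {Us Ws} → Pointwise _≈ᵁ_ Us Ws → Pointwise _≈ᵁ_ Ws Us
≈ᵁˢ-sym = PW.symmetric ≈ᵁ-sym

≈ᵁˢ-trans : ∀ {Us Vs Ws} → Pointwise _≈ᵁ_ Us Vs → Pointwise _≈ᵁ_ Vs Ws → Pointwise _≈ᵁ_ Us Ws
≈ᵁˢ-trans = PW.transitive ≈ᵁ-trans

unf : SType → SType
unf end            = end
unf (!⟨ Us ⟩⨾ S) = !⟨ Us ⟩⨾ S
unf (?⟨ Us ⟩⨾ S) = ?⟨ Us ⟩⨾ S
unf (μ B)          = B [ μ B /𝐭]

-- A polarity stands for output (`pos`) or input (`neg`), so that facts about prefixes are stated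
-- once.
act : Pol → List HType → SType → SType
act pos Us S = !⟨ Us ⟩⨾ S
act neg Us S = ?⟨ Us ⟩⨾ S

actᴮ : Pol → List HType → Body → Body
actᴮ pos Us B = !⟨ Us ⟩⨾ B
actᴮ neg Us B = ?⟨ Us ⟩⨾ B

-- The relation that ≈ induces between unfolded types.
data _≋_ : SType → SType → Set where
  end : end ≋ end
  !⨾  : ∀ {Us Ws S T} → Pointwise _≈ᵁ_ Us Ws → S ≈ T → (!⟨ Us ⟩⨾ S) ≋ (!⟨ Ws ⟩⨾ T)
  ?⨾  : ∀ {Us Ws S T} → Pointwise _≈ᵁ_ Us Ws → S ≈ T → (?⟨ Us ⟩⨾ S) ≋ (?⟨ Ws ⟩⨾ T)
  -- Raw types include the non-contractive `μ 𝐭`, which unfolds to itself and never exposes a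
  -- prefix.
  μ𝐭  : (μ 𝐭) ≋ (μ 𝐭)

≋-sym : ∀ {S T} → S ≋ T → T ≋ S
≋-sym end           = end
≋-sym (!⨾ Us p) = !⨾ (≈ᵁˢ-sym Us) (≈-sym p)
≋-sym (?⨾ Us p) = ?⨾ (≈ᵁˢ-sym Us) (≈-sym p)
≋-sym μ𝐭           = μ𝐭

≋-trans : ∀ {S T R} → S ≋ T → T ≋ R → S ≋ R
≋-trans end end = end
≋-trans (!⨾ Us p) (!⨾ Ws q) = !⨾ (≈ᵁˢ-trans Us Ws) (≈-trans p q)
≋-trans (?⨾ Us p) (?⨾ Ws q) = ?⨾ (≈ᵁˢ-trans Us Ws) (≈-trans p q)
≋-trans μ𝐭 μ𝐭 = μ𝐭

≋-refl : ∀ S → unf S ≋ unf S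
≋-refl end            = end
≋-refl (!⟨ Us ⟩⨾ S) = !⨾ (≈ᵁˢ-refl Us) ≈-refl
≋-refl (?⟨ Us ⟩⨾ S) = ?⨾ (≈ᵁˢ-refl Us) ≈-refl
≋-refl (μ 𝐭)            = μ𝐭
≋-refl (μ (!⟨ Us ⟩⨾ B)) = !⨾ (≈ᵁˢ-refl Us) ≈-refl
≋-refl (μ (?⟨ Us ⟩⨾ B)) = ?⨾ (≈ᵁˢ-refl Us) ≈-refl

unf-unf : ∀ S → unf (unf S) ≡ unf S
unf-unf end                = refl
unf-unf (!⟨ _ ⟩⨾ _)     = refl
unf-unf (?⟨ _ ⟩⨾ _)     = refl
unf-unf (μ 𝐭)             = refl
unf-unf (μ (!⟨ _ ⟩⨾ _)) = refl
unf-unf (μ (?⟨ _ ⟩⨾ _)) = refl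

[/]-cong : ∀ {A B S T} → A ≈ᴮ B → S ≈ T → A [ S /𝐭] ≈ B [ T /𝐭]
[/]-cong 𝐭-cong        p = p
[/]-cong (!-cong Us q) p = !-cong Us ([/]-cong q p)
[/]-cong (?-cong Us q) p = ?-cong Us ([/]-cong q p)

-- A proof of `≈` cannot be inverted directly, since `≈-trans` may pass through foldings and
-- unfoldings. After one unfolding on both sides the heads have to match, and this relation is
-- itself symmetric and transitive.
≈⇒≋ : ∀ {S T} → S ≈ T → unf S ≋ unf T
≈⇒≋ (unfold {B}) = subst ((B [ μ B /𝐭]) ≋_) (sym (unf-unf (μ B))) (≋-refl (μ B))
≈⇒≋ (≈-refl {S}) = ≋-refl S
≈⇒≋ (≈-sym p)    = ≋-sym (≈⇒≋ p)
≈⇒≋ (≈-trans p q) = ≋-trans (≈⇒≋ p) (≈⇒≋ q)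
≈⇒≋ (!-cong Us p) = !⨾ Us p
≈⇒≋ (?-cong Us p) = ?⨾ Us p
≈⇒≋ (μ-cong 𝐭-cong) = μ𝐭
≈⇒≋ (μ-cong (!-cong Us q)) = !⨾ Us ([/]-cong q (μ-cong (!-cong Us q)))
≈⇒≋ (μ-cong (?-cong Us q)) = ?⨾ Us ([/]-cong q (μ-cong (?-cong Us q)))

unf-act : ∀ d {Us S} → unf (act d Us S) ≡ act d Us S
unf-act pos = refl
unf-act neg = refl

act-inv : ∀ d {Us S T} → act d Us S ≋ T → ∃[ Ws ] ∃[ R ] T ≡ act d Ws R × Pointwise _≈ᵁ_ Us Ws × S ≈ R
act-inv pos (!⨾ Us p) = _ , _ , refl , Us , p
act-inv neg (?⨾ Us p) = _ , _ , refl , Us , p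

unf⇒cont : ∀ d S {Us T} → unf S ≡ act d Us T → cont S ≡ T
unf⇒cont pos (!⟨ _ ⟩⨾ _)     refl = refl
unf⇒cont pos (μ (!⟨ _ ⟩⨾ _)) refl = refl
unf⇒cont neg (?⟨ _ ⟩⨾ _)     refl = refl
unf⇒cont neg (μ (?⟨ _ ⟩⨾ _)) refl = refl

-- Used to transfer a prefix rule to `E`: the derivation shows a prefix, while the type `T` recorded
-- in `E` may still be folded.
≈-act-inv : ∀ d {Us S T} → act d Us S ≈ T →
            ∃[ Ws ] unf T ≡ act d Ws (cont T) × Pointwise _≈ᵁ_ Us Ws × S ≈ cont T
≈-act-inv d {T = T} p with act-inv d (subst (_≋ unf T) (unf-act d) (≈⇒≋ p))
... | Ws , R , eq , Us , q rewrite unf⇒cont d T eq = Ws , eq , Us , q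

isEnd : SType → Bool
isEnd end            = true
isEnd (!⟨ _ ⟩⨾ _) = false
isEnd (?⟨ _ ⟩⨾ _) = false
isEnd (μ _)          = false

isEnd⇒≡ : ∀ S → isEnd S ≡ true → S ≡ end
isEnd⇒≡ end refl = refl

-- As a Boolean the property passes through `≈-sym` and `≈-trans` by plain induction, so no
-- inversion of `end ≈ S` is needed. `recursive-≈` follows the same pattern.
isEnd-≈ : ∀ {S T} → S ≈ T → isEnd S ≡ isEnd T
isEnd-≈ (unfold {𝐭})            = refl
isEnd-≈ (unfold { !⟨ _ ⟩⨾ _}) = refl
isEnd-≈ (unfold {?⟨ _ ⟩⨾ _}) = refl
isEnd-≈ ≈-refl        = refl
isEnd-≈ (≈-sym p)     = sym (isEnd-≈ p)
isEnd-≈ (≈-trans p q) = trans (isEnd-≈ p) (isEnd-≈ q)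
isEnd-≈ (!-cong _ _)  = refl
isEnd-≈ (?-cong _ _)  = refl
isEnd-≈ (μ-cong _)    = refl

end≈⇒≡ : ∀ {S} → end ≈ S → S ≡ end
end≈⇒≡ {S} p = isEnd⇒≡ S (sym (isEnd-≈ p))

recursive-[/] : ∀ B {T} → recursive (B [ T /𝐭]) ≡ recursive T
recursive-[/] 𝐭              = refl
recursive-[/] (!⟨ _ ⟩⨾ B) = recursive-[/] B
recursive-[/] (?⟨ _ ⟩⨾ B) = recursive-[/] B

ℛ⋆-[/] : ∀ B {T} → ℛ⋆ (B [ T /𝐭]) ≡ ℛ⋆ T
ℛ⋆-[/] 𝐭              = refl
ℛ⋆-[/] (!⟨ _ ⟩⨾ B) = ℛ⋆-[/] B
ℛ⋆-[/] (?⟨ _ ⟩⨾ B) = ℛ⋆-[/] B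

recursive-≈ : ∀ {S T} → S ≈ T → recursive S ≡ recursive T
recursive-≈ (unfold {B}) = sym (recursive-[/] B)
recursive-≈ ≈-refl        = refl
recursive-≈ (≈-sym p)     = sym (recursive-≈ p)
recursive-≈ (≈-trans p q) = trans (recursive-≈ p) (recursive-≈ q)
recursive-≈ (!-cong _ p)  = recursive-≈ p
recursive-≈ (?-cong _ p)  = recursive-≈ p
recursive-≈ (μ-cong _)    = refl

recursive-cont : ∀ S → recursive (cont S) ≡ recursive S
recursive-cont end               = refl
recursive-cont (!⟨ _ ⟩⨾ _)     = refl
recursive-cont (?⟨ _ ⟩⨾ _)     = refl
recursive-cont (μ 𝐭)             = refl
recursive-cont (μ (!⟨ _ ⟩⨾ B)) = recursive-[/] B
recursive-cont (μ (?⟨ _ ⟩⨾ B)) = recursive-[/] B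

ℛ⋆-cont : ∀ S → ℛ⋆ (cont S) ≡ ℛ⋆ S
ℛ⋆-cont end               = refl
ℛ⋆-cont (!⟨ _ ⟩⨾ _)     = refl
ℛ⋆-cont (?⟨ _ ⟩⨾ _)     = refl
ℛ⋆-cont (μ 𝐭)             = refl
ℛ⋆-cont (μ (!⟨ _ ⟩⨾ B)) = ℛ⋆-[/] B
ℛ⋆-cont (μ (?⟨ _ ⟩⨾ B)) = ℛ⋆-[/] B

-- The contribution of a continuation to `𝒢`: a trailing `end` counts only when it is the whole
-- type.
𝒢⁺ : SType → List SType
𝒢⁺ S = if isEnd S then [] else 𝒢 S

-- One equation for all prefixes. The clauses of `𝒢` split on the head of the continuation and would
-- otherwise force that split everywhere.
𝒢-act : ∀ d Us S →
        𝒢 (act d Us S) ≡ (if recursive S then ℛ⋆ S else act d (𝒢ᵁˢ Us) end ∷ 𝒢⁺ S)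
𝒢-act pos Us end            = refl
𝒢-act pos Us (!⟨ _ ⟩⨾ _) = refl
𝒢-act pos Us (?⟨ _ ⟩⨾ _) = refl
𝒢-act pos Us (μ _)          = refl
𝒢-act neg Us end            = refl
𝒢-act neg Us (!⟨ _ ⟩⨾ _) = refl
𝒢-act neg Us (?⟨ _ ⟩⨾ _) = refl
𝒢-act neg Us (μ _)          = refl

𝒢-recursive : ∀ S → recursive S ≡ true → 𝒢 S ≡ ℛ⋆ S
𝒢-recursive (!⟨ Us ⟩⨾ S) r rewrite 𝒢-act pos Us S | r = refl
𝒢-recursive (?⟨ Us ⟩⨾ S) r rewrite 𝒢-act neg Us S | r = refl
𝒢-recursive (μ B)          r = refl

mutual
  𝒢ᵁ-cong : ∀ {U W} → U ≈ᵁ W → 𝒢ᵁ U ≈ᵁ 𝒢ᵁ W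
  𝒢ᵁ-cong (arr-cong ps) = arr-cong (𝒢ᶜˢ-cong ps)

  𝒢ᵁˢ-cong : ∀ {Us Ws} → Pointwise _≈ᵁ_ Us Ws → Pointwise _≈ᵁ_ (𝒢ᵁˢ Us) (𝒢ᵁˢ Ws)
  𝒢ᵁˢ-cong []       = []
  𝒢ᵁˢ-cong (p ∷ ps) = 𝒢ᵁ-cong p ∷ 𝒢ᵁˢ-cong ps

  𝒢ᶜˢ-cong : ∀ {Cs Ds} → Pointwise _≈ᶜ_ Cs Ds → Pointwise _≈ᶜ_ (𝒢ᶜˢ Cs) (𝒢ᶜˢ Ds)
  𝒢ᶜˢ-cong []       = []
  𝒢ᶜˢ-cong (p ∷ ps) = PW.++⁺ (𝒢ᶜ-cong p) (𝒢ᶜˢ-cong ps)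

  𝒢ᶜ-cong : ∀ {C D} → C ≈ᶜ D → Pointwise _≈ᶜ_ (𝒢ᶜ C) (𝒢ᶜ D)
  𝒢ᶜ-cong (ses-cong p) = PW.map⁺ ses ses (PW.map ses-cong (𝒢-cong p))
  𝒢ᶜ-cong (⟨⟩-cong p)  = ⟨⟩-cong (𝒢ᵁ-cong p) ∷ []

  -- Unfolding is harmless because `𝒢` sends a recursive type, at whatever stage of unfolding, to
  -- `ℛ` of its loop. The prefix cases branch on `recursive`, which `≈` preserves.
  𝒢-cong : ∀ {S T} → S ≈ T → Pointwise _≈_ (𝒢 S) (𝒢 T)
  𝒢-cong (unfold {B})
    rewrite 𝒢-recursive (B [ μ B /𝐭]) (recursive-[/] B) | ℛ⋆-[/] B {μ B} = PW.refl ≈-refl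
  𝒢-cong ≈-refl        = PW.refl ≈-refl
  𝒢-cong (≈-sym p)     = PW.symmetric ≈-sym (𝒢-cong p)
  𝒢-cong (≈-trans p q) = PW.transitive ≈-trans (𝒢-cong p) (𝒢-cong q)
  𝒢-cong (!-cong {Us} {Ws} {S} {T} Ps p)
    rewrite 𝒢-act pos Us S | 𝒢-act pos Ws T | recursive-≈ p with recursive T
  ... | true  = ℛ⋆-cong p
  ... | false = !-cong (𝒢ᵁˢ-cong Ps) ≈-refl ∷ 𝒢⁺-cong p
  𝒢-cong (?-cong {Us} {Ws} {S} {T} Ps p)
    rewrite 𝒢-act neg Us S | 𝒢-act neg Ws T | recursive-≈ p with recursive T
  ... | true  = ℛ⋆-cong p
  ... | false = ?-cong (𝒢ᵁˢ-cong Ps) ≈-refl ∷ 𝒢⁺-cong p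
  𝒢-cong (μ-cong q) = ℛ-cong q

  𝒢⁺-cong : ∀ {S T} → S ≈ T → Pointwise _≈_ (𝒢⁺ S) (𝒢⁺ T)
  𝒢⁺-cong {S} {T} p rewrite isEnd-≈ p with isEnd T
  ... | true  = []
  ... | false = 𝒢-cong p

  ℛ⋆-cong : ∀ {S T} → S ≈ T → Pointwise _≈_ (ℛ⋆ S) (ℛ⋆ T)
  ℛ⋆-cong (unfold {B}) rewrite ℛ⋆-[/] B {μ B} = PW.refl ≈-refl
  ℛ⋆-cong ≈-refl        = PW.refl ≈-refl
  ℛ⋆-cong (≈-sym p)     = PW.symmetric ≈-sym (ℛ⋆-cong p)
  ℛ⋆-cong (≈-trans p q) = PW.transitive ≈-trans (ℛ⋆-cong p) (ℛ⋆-cong q)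
  ℛ⋆-cong (!-cong _ p)  = ℛ⋆-cong p
  ℛ⋆-cong (?-cong _ p)  = ℛ⋆-cong p
  ℛ⋆-cong (μ-cong q)    = ℛ-cong q

  ℛ-cong : ∀ {A B} → A ≈ᴮ B → Pointwise _≈_ (ℛ A) (ℛ B)
  ℛ-cong 𝐭-cong        = []
  ℛ-cong (!-cong Ps q) = μ-cong (!-cong (𝒢ᵁˢ-cong Ps) 𝐭-cong) ∷ ℛ-cong q
  ℛ-cong (?-cong Ps q) = μ-cong (?-cong (𝒢ᵁˢ-cong Ps) 𝐭-cong) ∷ ℛ-cong q

-- Duality, well-formedness and minimality of decomposed types

dual-[/] : ∀ B T → dual (B [ T /𝐭]) ≡ dualᴮ B [ dual T /𝐭]
dual-[/] 𝐭               T = refl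
dual-[/] (!⟨ Us ⟩⨾ B) T = cong (?⟨ Us ⟩⨾_) (dual-[/] B T)
dual-[/] (?⟨ Us ⟩⨾ B) T = cong (!⟨ Us ⟩⨾_) (dual-[/] B T)

recursive-dual : ∀ S → recursive (dual S) ≡ recursive S
recursive-dual end            = refl
recursive-dual (!⟨ _ ⟩⨾ S) = recursive-dual S
recursive-dual (?⟨ _ ⟩⨾ S) = recursive-dual S
recursive-dual (μ _)          = refl

isEnd-dual : ∀ S → isEnd (dual S) ≡ isEnd S
isEnd-dual end            = refl
isEnd-dual (!⟨ _ ⟩⨾ S) = refl
isEnd-dual (?⟨ _ ⟩⨾ S) = refl
isEnd-dual (μ _)          = refl

ℛ-dual : ∀ B → ℛ (dualᴮ B) ≡ map dual (ℛ B)
ℛ-dual 𝐭              = refl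
ℛ-dual (!⟨ _ ⟩⨾ B) = cong (_ ∷_) (ℛ-dual B)
ℛ-dual (?⟨ _ ⟩⨾ B) = cong (_ ∷_) (ℛ-dual B)

ℛ⋆-dual : ∀ S → ℛ⋆ (dual S) ≡ map dual (ℛ⋆ S)
ℛ⋆-dual end            = refl
ℛ⋆-dual (!⟨ _ ⟩⨾ S) = ℛ⋆-dual S
ℛ⋆-dual (?⟨ _ ⟩⨾ S) = ℛ⋆-dual S
ℛ⋆-dual (μ B)          = ℛ-dual B

-- Duality leaves payloads alone and keeps the number of prefixes, so the tuples of two restricted
-- endpoints can be bound pairwise as dual names.
𝒢-dual : ∀ S → 𝒢 (dual S) ≡ map dual (𝒢 S)
𝒢-dual end = refl
𝒢-dual (!⟨ Us ⟩⨾ S)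
  rewrite 𝒢-act neg Us (dual S) | 𝒢-act pos Us S | recursive-dual S | isEnd-dual S
  with recursive S | isEnd S
... | true  | _     = ℛ⋆-dual S
... | false | true  = refl
... | false | false = cong (_ ∷_) (𝒢-dual S)
𝒢-dual (?⟨ Us ⟩⨾ S)
  rewrite 𝒢-act pos Us (dual S) | 𝒢-act neg Us S | recursive-dual S | isEnd-dual S
  with recursive S | isEnd S
... | true  | _     = ℛ⋆-dual S
... | false | true  = refl
... | false | false = cong (_ ∷_) (𝒢-dual S)
𝒢-dual (μ B) = ℛ-dual B

Suffix-dual : ∀ {S T} → Suffix S T → Suffix (dual S) (dual T)
Suffix-dual here   = here
Suffix-dual (!⨾ p) = ?⨾ (Suffix-dual p)
Suffix-dual (?⨾ p) = !⨾ (Suffix-dual p)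

WFᴮ-dual : ∀ {B} → WFᴮ B → WFᴮ (dualᴮ B)
WFᴮ-dual 𝐭          = 𝐭
WFᴮ-dual (!⨾ u n w) = ?⨾ u n (WFᴮ-dual w)
WFᴮ-dual (?⨾ u n w) = !⨾ u n (WFᴮ-dual w)

Finite-dual : ∀ {S} → Finite S → Finite (dual S)
Finite-dual end      = end
Finite-dual (!⨾ u w) = ?⨾ u (Finite-dual w)
Finite-dual (?⨾ u w) = !⨾ u (Finite-dual w)

Tr-dual : ∀ {S} → Tr S → Tr (dual S)
Tr-dual {S} (mk {B} B≢𝐭 w p) =
  mk (λ eq → B≢𝐭 (dual≡𝐭 B eq)) (WFᴮ-dual w) (subst (Suffix (dual S)) (dual-[/] B (μ B)) (Suffix-dual p))
  where
  dual≡𝐭 : ∀ B → dualᴮ B ≡ 𝐭 → B ≡ 𝐭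
  dual≡𝐭 𝐭 refl = refl

WF-dual : ∀ {S} → WF S → WF (dual S)
WF-dual (finite w) = finite (Finite-dual w)
WF-dual (tr t)     = tr (Tr-dual t)

recursive-Finite : ∀ {S} → Finite S → recursive S ≡ false
recursive-Finite end      = refl
recursive-Finite (!⨾ _ w) = recursive-Finite w
recursive-Finite (?⨾ _ w) = recursive-Finite w

recursive-Suffix : ∀ {S T} → Suffix S T → recursive S ≡ recursive T
recursive-Suffix here   = refl
recursive-Suffix (!⨾ p) = recursive-Suffix p
recursive-Suffix (?⨾ p) = recursive-Suffix p

ℛ⋆-Suffix : ∀ {S T} → Suffix S T → ℛ⋆ S ≡ ℛ⋆ T
ℛ⋆-Suffix here   = refl
ℛ⋆-Suffix (!⨾ p) = ℛ⋆-Suffix p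
ℛ⋆-Suffix (?⨾ p) = ℛ⋆-Suffix p

recursive-Tr : ∀ {S} → Tr S → recursive S ≡ true
recursive-Tr (mk {B} _ _ p) = trans (recursive-Suffix p) (recursive-[/] B)

ℛ⋆-Tr : ∀ {S B} → Suffix S (B [ μ B /𝐭]) → ℛ⋆ S ≡ ℛ B
ℛ⋆-Tr {B = B} p = trans (ℛ⋆-Suffix p) (ℛ⋆-[/] B)

WF-Tr : ∀ {S} → WF S → recursive S ≡ true → Tr S
WF-Tr (finite w) r with trans (sym r) (recursive-Finite w)
... | ()
WF-Tr (tr t) r = t

mutual
  -- Recursive types are simple, and `Minimal` asks this of its loops as well: the payloads of a
  -- source loop contain no recursion, and decomposing them introduces none.
  𝒢ᵁ-norec : ∀ {U} → NoRecᵁ U → NoRecᵁ (𝒢ᵁ U)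
  𝒢ᵁ-norec (arr ns) = arr (𝒢ᶜˢ-norec ns)

  𝒢ᵁˢ-norec : ∀ {Us} → All NoRecᵁ Us → All NoRecᵁ (𝒢ᵁˢ Us)
  𝒢ᵁˢ-norec []       = []
  𝒢ᵁˢ-norec (n ∷ ns) = 𝒢ᵁ-norec n ∷ 𝒢ᵁˢ-norec ns

  𝒢ᶜˢ-norec : ∀ {Cs} → All NoRecᶜ Cs → All NoRecᶜ (𝒢ᶜˢ Cs)
  𝒢ᶜˢ-norec []       = []
  𝒢ᶜˢ-norec (n ∷ ns) = AllP.++⁺ (𝒢ᶜ-norec n) (𝒢ᶜˢ-norec ns)

  𝒢ᶜ-norec : ∀ {C} → NoRecᶜ C → All NoRecᶜ (𝒢ᶜ C)
  𝒢ᶜ-norec (ses n) = AllP.map⁺ (All.map ses (𝒢-norec n))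
  𝒢ᶜ-norec ⟨ n ⟩   = ⟨ 𝒢ᵁ-norec n ⟩ ∷ []

  𝒢-norec : ∀ {S} → NoRec S → All NoRec (𝒢 S)
  𝒢-norec end = end ∷ []
  𝒢-norec (!⨾ {Us} {S} ns n) rewrite 𝒢-act pos Us S | recursive-NoRec n =
    !⨾ (𝒢ᵁˢ-norec ns) end ∷ 𝒢⁺-norec n
  𝒢-norec (?⨾ {Us} {S} ns n) rewrite 𝒢-act neg Us S | recursive-NoRec n =
    ?⨾ (𝒢ᵁˢ-norec ns) end ∷ 𝒢⁺-norec n

  𝒢⁺-norec : ∀ {S} → NoRec S → All NoRec (𝒢⁺ S)
  𝒢⁺-norec {S} n with isEnd S
  ... | true  = []
  ... | false = 𝒢-norec n

  recursive-NoRec : ∀ {S} → NoRec S → recursive S ≡ false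
  recursive-NoRec end      = refl
  recursive-NoRec (!⨾ _ n) = recursive-NoRec n
  recursive-NoRec (?⨾ _ n) = recursive-NoRec n

mutual
  𝒢ᵁ-minimal : ∀ {U} → WFᵁ U → Minimalᵁ (𝒢ᵁ U)
  𝒢ᵁ-minimal (arr ws) = arr (𝒢ᶜˢ-minimal ws)

  𝒢ᶜˢ-minimal : ∀ {Cs} → All WFᶜ Cs → All Minimalᶜ (𝒢ᶜˢ Cs)
  𝒢ᶜˢ-minimal []       = []
  𝒢ᶜˢ-minimal (w ∷ ws) = AllP.++⁺ (𝒢ᶜ-minimal w) (𝒢ᶜˢ-minimal ws)

  𝒢ᶜ-minimal : ∀ {C} → WFᶜ C → All Minimalᶜ (𝒢ᶜ C)
  𝒢ᶜ-minimal (ses w) = AllP.map⁺ (All.map ses (𝒢-minimal w))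
  𝒢ᶜ-minimal ⟨ w ⟩   = ⟨ 𝒢ᵁ-minimal w ⟩ ∷ []

  𝒢-minimal : ∀ {S} → WF S → All Minimal (𝒢 S)
  𝒢-minimal (finite w) = 𝒢-minimalᶠ w
  𝒢-minimal {S} (tr (mk {B} ne w p))
    rewrite 𝒢-recursive S (recursive-Tr (mk ne w p)) | ℛ⋆-Tr {B = B} p = ℛ-minimal w

  𝒢-minimalᶠ : ∀ {S} → Finite S → All Minimal (𝒢 S)
  𝒢-minimalᶠ end = end ∷ []
  𝒢-minimalᶠ (!⨾ {U} {S} u w) rewrite 𝒢-act pos [ U ] S | recursive-Finite w =
    !⨾ (𝒢ᵁ-minimal u ∷ []) ∷ 𝒢⁺-minimal w
  𝒢-minimalᶠ (?⨾ {U} {S} u w) rewrite 𝒢-act neg [ U ] S | recursive-Finite w =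
    ?⨾ (𝒢ᵁ-minimal u ∷ []) ∷ 𝒢⁺-minimal w

  𝒢⁺-minimal : ∀ {S} → Finite S → All Minimal (𝒢⁺ S)
  𝒢⁺-minimal {S} w with isEnd S
  ... | true  = []
  ... | false = 𝒢-minimalᶠ w

  ℛ-minimal : ∀ {B} → WFᴮ B → All Minimal (ℛ B)
  ℛ-minimal 𝐭          = []
  ℛ-minimal (!⨾ u n w) = μ! (𝒢ᵁ-minimal u ∷ []) (𝒢ᵁ-norec n ∷ []) ∷ ℛ-minimal w
  ℛ-minimal (?⨾ u n w) = μ? (𝒢ᵁ-minimal u ∷ []) (𝒢ᵁ-norec n ∷ []) ∷ ℛ-minimal w

Minimal-dual : ∀ {M} → Minimal M → Minimal (dual M)
Minimal-dual end        = end
Minimal-dual (!⨾ us)    = ?⨾ us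
Minimal-dual (?⨾ us)    = !⨾ us
Minimal-dual (μ! us ns) = μ? us ns
Minimal-dual (μ? us ns) = μ! us ns

-- For recursive types this is contractivity: the body has a prefix. Consequently the index 1 of
-- each parameter of an abstraction is really bound after decomposition.
𝒢-nonempty : ∀ {S} → WF S → ∃[ M ] ∃[ Ms ] 𝒢 S ≡ M ∷ Ms
𝒢-nonempty (finite end) = _ , _ , refl
𝒢-nonempty (finite (!⨾ {U} {S} u w)) rewrite 𝒢-act pos [ U ] S | recursive-Finite w = _ , _ , refl
𝒢-nonempty (finite (?⨾ {U} {S} u w)) rewrite 𝒢-act neg [ U ] S | recursive-Finite w = _ , _ , refl
𝒢-nonempty {S} (tr (mk {B} ne w p))
  rewrite 𝒢-recursive S (recursive-Tr (mk ne w p)) | ℛ⋆-Tr {B = B} p = ℛ-nonempty B ne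
  where
  ℛ-nonempty : ∀ B → B ≢ 𝐭 → ∃[ M ] ∃[ Ms ] ℛ B ≡ M ∷ Ms
  ℛ-nonempty 𝐭 ne with ne refl
  ... | ()
  ℛ-nonempty (!⟨ _ ⟩⨾ _) ne = _ , _ , refl
  ℛ-nonempty (?⟨ _ ⟩⨾ _) ne = _ , _ , refl

Suffix-μ : ∀ B {A T} → Suffix (μ A) (B [ T /𝐭]) → Suffix (μ A) T
Suffix-μ 𝐭              p       = p
Suffix-μ (!⟨ _ ⟩⨾ B) (!⨾ p) = Suffix-μ B p
Suffix-μ (?⟨ _ ⟩⨾ B) (?⨾ p) = Suffix-μ B p

Suffix-μ≡ : ∀ B {A} → Suffix (μ A) (B [ μ B /𝐭]) → A ≡ B
Suffix-μ≡ B p with Suffix-μ B p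
... | here = refl

-- The only `μ` at the head of a suffix is the loop itself, and unfolding it restarts at the full
-- unfolded body. Thus a recursive type never gets beyond one unfolding.
Suffix-unf : ∀ {S B} → Suffix S (B [ μ B /𝐭]) → Suffix (unf S) (B [ μ B /𝐭])
Suffix-unf {end}           p = p
Suffix-unf { !⟨ _ ⟩⨾ S} p = p
Suffix-unf {?⟨ _ ⟩⨾ S} p = p
Suffix-unf {μ A} {B}       p with Suffix-μ≡ B p
... | refl = here

Suffix-act : ∀ d {Us S T} → Suffix (act d Us S) T → Suffix S T
Suffix-act pos here    = !⨾ here
Suffix-act pos (!⨾ p) = !⨾ (Suffix-act pos p)
Suffix-act pos (?⨾ p) = ?⨾ (Suffix-act pos p)
Suffix-act neg here    = ?⨾ here
Suffix-act neg (!⨾ p) = !⨾ (Suffix-act neg p)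
Suffix-act neg (?⨾ p) = ?⨾ (Suffix-act neg p)

WFᴮ-payload : ∀ d {B A Us S} → WFᴮ B → Suffix (act d Us S) (B [ μ A /𝐭]) → All WFᵁ Us
WFᴮ-payload pos (!⨾ u _ w) here    = u ∷ []
WFᴮ-payload neg (?⨾ u _ w) here    = u ∷ []
WFᴮ-payload d   (!⨾ _ _ w) (!⨾ p) = WFᴮ-payload d w p
WFᴮ-payload d   (?⨾ _ _ w) (?⨾ p) = WFᴮ-payload d w p

-- In the recursive case the unfolded type is a suffix of `B [ μ B /𝐭]`, and removing its first
-- prefix leaves another suffix of it.
WF-step : ∀ d {S Us} → WF S → unf S ≡ act d Us (cont S) → All WFᵁ Us × WF (cont S)
WF-step pos (finite (!⨾ u w)) refl = u ∷ [] , finite w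
WF-step neg (finite (?⨾ u w)) refl = u ∷ [] , finite w
WF-step d {S} (tr (mk {B} ne w p)) eq =
  let q = subst (λ T → Suffix T (B [ μ B /𝐭])) eq (Suffix-unf p)
  in WFᴮ-payload d w q , tr (mk ne w (Suffix-act d q))

𝒢-step : ∀ d {S Us} → WF S → recursive S ≡ false → unf S ≡ act d Us (cont S) →
         𝒢 S ≡ act d (𝒢ᵁˢ Us) end ∷ 𝒢⁺ (cont S)
𝒢-step pos { !⟨ Us ⟩⨾ S} w r refl rewrite 𝒢-act pos Us S | r = refl
𝒢-step neg {?⟨ Us ⟩⨾ S} w r refl rewrite 𝒢-act neg Us S | r = refl

-- The index function and the entries of `ℛ`

loop : Pol → List HType → SType
loop d Us = μ actᴮ d Us 𝐭

prefixes : Body → ℕ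
prefixes 𝐭              = 0
prefixes (!⟨ _ ⟩⨾ B) = suc (prefixes B)
prefixes (?⟨ _ ⟩⨾ B) = suc (prefixes B)

length-ℛ : ∀ B → length (ℛ B) ≡ prefixes B
length-ℛ 𝐭              = refl
length-ℛ (!⟨ _ ⟩⨾ B) = cong suc (length-ℛ B)
length-ℛ (?⟨ _ ⟩⨾ B) = cong suc (length-ℛ B)

-- `f′` counts the prefixes remaining until the loop is reached again and subtracts them from the
-- length of one round.
f′-[/] : ∀ l B {A} → f′ l (B [ μ A /𝐭]) ≡ length (ℛ A) ∸ (l + prefixes B) + 1
f′-[/] l 𝐭 {A} = cong (λ n → length (ℛ A) ∸ n + 1) (sym (+-comm l 0))
f′-[/] l (!⟨ _ ⟩⨾ B) {A} = trans (f′-[/] (suc l) B) (cong (λ n → length (ℛ A) ∸ n + 1) (sym (+-suc l _)))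
f′-[/] l (?⟨ _ ⟩⨾ B) {A} = trans (f′-[/] (suc l) B) (cong (λ n → length (ℛ A) ∸ n + 1) (sym (+-suc l _)))

f′-act : ∀ l d {Us S} → f′ l (act d Us S) ≡ f′ (suc l) S
f′-act l pos = refl
f′-act l neg = refl

-- A position in the unfolded body splits `ℛ` at the same place: `pre` comes from the prefixes
-- already performed in this round, `B′` is the part of the body still to come.
split-ℛ : ∀ d B {A Us S} → Suffix (act d Us S) (B [ μ A /𝐭]) →
          ∃[ pre ] ∃[ B′ ] S ≡ B′ [ μ A /𝐭] × ℛ B ≡ pre ++ loop d (𝒢ᵁˢ Us) ∷ ℛ B′
split-ℛ pos (!⟨ _ ⟩⨾ B) here    = [] , B , refl , refl
split-ℛ neg (?⟨ _ ⟩⨾ B) here    = [] , B , refl , refl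
split-ℛ pos 𝐭              ()
split-ℛ neg 𝐭              ()
split-ℛ d   (!⟨ _ ⟩⨾ B) (!⨾ p) with split-ℛ d B p
... | pre , B′ , eq , eq′ = _ ∷ pre , B′ , eq , cong (_ ∷_) eq′
split-ℛ d   (?⟨ _ ⟩⨾ B) (?⨾ p) with split-ℛ d B p
... | pre , B′ , eq , eq′ = _ ∷ pre , B′ , eq , cong (_ ∷_) eq′

f-unf : ∀ S → recursive S ≡ true → f S ≡ f′ 0 (unf S)
f-unf (!⟨ _ ⟩⨾ _) r = refl
f-unf (?⟨ _ ⟩⨾ _) r = refl
f-unf (μ _)          r = refl

-- Remaining in the round are the current prefix and those of `B′`, so subtracting `1 + prefixes B′`
-- leaves `length pre`; the final `+ 1` of `f′` turns this offset into an index starting at 1.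
ℛ⋆-at-f : ∀ d {S Us} → Tr S → unf S ≡ act d Us (cont S) →
          ∃[ pre ] ∃[ post ] ℛ⋆ S ≡ pre ++ loop d (𝒢ᵁˢ Us) ∷ post × f S ≡ suc (length pre)
ℛ⋆-at-f d {S} {Us} t@(mk {B} ne w p) eq
  with split-ℛ d B (subst (λ T → Suffix T (B [ μ B /𝐭])) eq (Suffix-unf p))
... | pre , B′ , eq₁ , eq₂ = pre , ℛ B′ , trans (ℛ⋆-Tr {B = B} p) eq₂ , f≡
  where
  len : length (ℛ B) ≡ length pre + (1 + prefixes B′)
  len = trans (cong length eq₂) (trans (length-++ pre) (cong (λ n → length pre + suc n) (length-ℛ B′)))
  f≡ : f S ≡ suc (length pre)
  f≡ = trans (f-unf S (recursive-Tr t)) (trans (cong (f′ 0) eq) (trans (f′-act 0 d {Us})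
         (trans (cong (f′ 1) eq₁) (trans (f′-[/] 1 B′ {B})
         (trans (cong (λ n → n ∸ (1 + prefixes B′) + 1) len)
         (trans (cong (_+ 1) (m+n∸n≡m (length pre) (1 + prefixes B′))) (+-comm _ 1)))))))

-- Splitting partial maps

if-yes : ∀ {P A : Set} (d : Dec P) {a b : A} → P → (if does d then a else b) ≡ a
if-yes d p rewrite dec-true d p = refl

if-no : ∀ {P A : Set} (d : Dec P) {a b : A} → ¬ P → (if does d then a else b) ≡ b
if-no d p rewrite dec-false d p = refl

-- Unlike `with`, this leaves the goal untouched, so the conditionals on `does` in it stay available
-- to `if-yes` and `if-no`.
by-cases : ∀ {P R : Set} → Dec P → (P → R) → (¬ P → R) → R
by-cases (yes p) f g = f p
by-cases (no n)  f g = g n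

just≢nothing : ∀ {A B : Set} {x : A} {m : Maybe A} → m ≡ just x → m ≡ nothing → B
just≢nothing refl ()

_≟ᵛ_ : DecidableEquality TVar
src x  ≟ᵛ src y  = map′ (cong src) (λ { refl → refl }) (x ≟ y)
src _  ≟ᵛ bvar   = no λ ()
src _  ≟ᵛ unused = no λ ()
bvar   ≟ᵛ src _  = no λ ()
bvar   ≟ᵛ bvar   = yes refl
bvar   ≟ᵛ unused = no λ ()
unused ≟ᵛ src _  = no λ ()
unused ≟ᵛ bvar   = no λ ()
unused ≟ᵛ unused = yes refl

_≟ᵃ_ : DecidableEquality TAtom
(n at i) ≟ᵃ (m at j) = map′ (uncurry (cong₂ _at_)) (λ { refl → refl , refl }) (n ≟ m ×-dec i ≟ j)
(_ at _) ≟ᵃ prop _   = no λ ()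
(_ at _) ≟ᵃ rec _    = no λ ()
(_ at _) ≟ᵃ zed _ _  = no λ ()
prop _   ≟ᵃ (_ at _) = no λ ()
prop k   ≟ᵃ prop l   = map′ (cong prop) (λ { refl → refl }) (k ≟ l)
prop _   ≟ᵃ rec _    = no λ ()
prop _   ≟ᵃ zed _ _  = no λ ()
rec _    ≟ᵃ (_ at _) = no λ ()
rec _    ≟ᵃ prop _   = no λ ()
rec r    ≟ᵃ rec q    = map′ (cong rec) (λ { refl → refl }) (r ≟ⁿ q)
rec _    ≟ᵃ zed _ _  = no λ ()
zed _ _  ≟ᵃ (_ at _) = no λ ()
zed _ _  ≟ᵃ prop _   = no λ ()
zed _ _  ≟ᵃ rec _    = no λ ()
zed i j  ≟ᵃ zed k l  = map′ (uncurry (cong₂ zed)) (λ { refl → refl , refl }) (i ≟ k ×-dec j ≟ l)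

_≟ᵗ_ : DecidableEquality (Nm target)
sh a   ≟ᵗ sh b   = map′ (cong sh) (λ { refl → refl }) (a ≟ᵃ b)
sh _   ≟ᵗ se _ _ = no λ ()
sh _   ≟ᵗ nv _   = no λ ()
se _ _ ≟ᵗ sh _   = no λ ()
se s p ≟ᵗ se t q = map′ (uncurry (cong₂ se)) (λ { refl → refl , refl }) (s ≟ᵃ t ×-dec p ≟ᵖ q)
se _ _ ≟ᵗ nv _   = no λ ()
nv _   ≟ᵗ sh _   = no λ ()
nv _   ≟ᵗ se _ _ = no λ ()
nv x   ≟ᵗ nv y   = map′ (cong nv) (λ { refl → refl }) (x ≟ᵃ y)

-- The condition that `_≐_⊎ᵐ_` imposes at a single key.
Sum : ∀ {V : Set} → Maybe V → Maybe V → Maybe V → Set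
Sum m a b = (m ≡ a × b ≡ nothing) ⊎ (a ≡ nothing × m ≡ b)

Sum-resp : ∀ {V : Set} {m m′ a a′ b b′ : Maybe V} → m ≡ m′ → a ≡ a′ → b ≡ b′ → Sum m′ a′ b′ → Sum m a b
Sum-resp refl refl refl s = s

module _ {K V : Set} where

  ⊎ᵐ-comm : ∀ {m a b : PMap K V} → m ≐ a ⊎ᵐ b → m ≐ b ⊎ᵐ a
  ⊎ᵐ-comm s k with s k
  ... | inj₁ (p , q) = inj₂ (q , p)
  ... | inj₂ (p , q) = inj₁ (q , p)

  ⊎ᵐ-∅ˡ : ∀ {m : PMap K V} → m ≐ ∅ ⊎ᵐ m
  ⊎ᵐ-∅ˡ k = inj₂ (refl , refl)

  ⊎ᵐ-∅ʳ : ∀ {m : PMap K V} → m ≐ m ⊎ᵐ ∅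
  ⊎ᵐ-∅ʳ k = inj₁ (refl , refl)

  ⊎ᵐ-resp : ∀ {m m′ a a′ b b′ : PMap K V} → m ≗ m′ → a ≗ a′ → b ≗ b′ → m ≐ a ⊎ᵐ b → m′ ≐ a′ ⊎ᵐ b′
  ⊎ᵐ-resp e f g s k with s k
  ... | inj₁ (p , q) = inj₁ (trans (sym (e k)) (trans p (f k)) , trans (sym (g k)) q)
  ... | inj₂ (p , q) = inj₂ (trans (sym (f k)) p , trans (sym (e k)) (trans q (g k)))

  ≗⇒⊎ᵐ-∅ˡ : ∀ {m m′ : PMap K V} → m ≗ m′ → m ≐ ∅ ⊎ᵐ m′
  ≗⇒⊎ᵐ-∅ˡ e k = inj₂ (refl , e k)

  -- At each key at most one of `a`, `b`, `d` is defined, so `b ∪ d` is a disjoint union and serves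
  -- as the intermediate map.
  ⊎ᵐ-assocʳ : ∀ {m n a b d : PMap K V} → m ≐ n ⊎ᵐ d → n ≐ a ⊎ᵐ b →
              ∃[ x ] m ≐ a ⊎ᵐ x × x ≐ b ⊎ᵐ d
  ⊎ᵐ-assocʳ {m} {n} {a} {b} {d} s t = b ∪ d , (λ k → proj₁ (go (s k) (t k))) , (λ k → proj₂ (go (s k) (t k)))
    where
    go : ∀ {m n a b d} → Sum m n d → Sum n a b → Sum m a (b <∣> d) × Sum (b <∣> d) b d
    go (inj₁ (refl , refl)) (inj₁ (refl , refl)) = inj₁ (refl , refl) , inj₁ (refl , refl)
    go {b = just _}  (inj₁ (refl , refl)) (inj₂ (refl , refl)) = inj₂ (refl , refl) , inj₁ (refl , refl)
    go {b = nothing} (inj₁ (refl , refl)) (inj₂ (refl , refl)) = inj₂ (refl , refl) , inj₁ (refl , refl)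
    go (inj₂ (refl , refl)) (inj₁ (refl , refl)) = inj₂ (refl , refl) , inj₂ (refl , refl)
    go (inj₂ (refl , refl)) (inj₂ (refl , refl)) = inj₂ (refl , refl) , inj₂ (refl , refl)

  ⊎ᵐ-assocˡ : ∀ {m n a b d : PMap K V} → m ≐ a ⊎ᵐ n → n ≐ b ⊎ᵐ d →
              ∃[ x ] m ≐ x ⊎ᵐ d × x ≐ a ⊎ᵐ b
  ⊎ᵐ-assocˡ s t with ⊎ᵐ-assocʳ (⊎ᵐ-comm s) (⊎ᵐ-comm t)
  ... | x , s′ , t′ = x , ⊎ᵐ-comm s′ , ⊎ᵐ-comm t′

  ⊎ᵐ-interchange : ∀ {m a b a₁ a₂ b₁ b₂ : PMap K V} → m ≐ a ⊎ᵐ b → a ≐ a₁ ⊎ᵐ a₂ → b ≐ b₁ ⊎ᵐ b₂ →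
                   ∃[ x ] ∃[ y ] m ≐ x ⊎ᵐ y × x ≐ a₁ ⊎ᵐ b₁ × y ≐ a₂ ⊎ᵐ b₂
  ⊎ᵐ-interchange s t r with ⊎ᵐ-assocʳ s t
  ... | n , s₁ , t₁ with ⊎ᵐ-assocʳ (⊎ᵐ-comm t₁) r
  ...   | y , s₂ , t₂ with ⊎ᵐ-assocˡ s₁ s₂
  ...     | x , s₃ , t₃ = x , y , s₃ , t₃ , ⊎ᵐ-comm t₂

  ⊎ᵐ-disjoint : ∀ {m a b : PMap K V} {k v w} {B : Set} → m ≐ a ⊎ᵐ b → a k ≡ just v → b k ≡ just w → B
  ⊎ᵐ-disjoint {k = k} s p q with s k
  ... | inj₁ (_ , r) = just≢nothing q r
  ... | inj₂ (r , _) = just≢nothing p r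

  ⊎ᵐ-⊆ˡ : ∀ {m a b : PMap K V} {k v} → m ≐ a ⊎ᵐ b → a k ≡ just v → m k ≡ just v
  ⊎ᵐ-⊆ˡ {k = k} s p with s k
  ... | inj₁ (q , _) = trans q p
  ... | inj₂ (q , _) = just≢nothing p q

  ⊎ᵐ-⊆ʳ : ∀ {m a b : PMap K V} {k v} → m ≐ a ⊎ᵐ b → b k ≡ just v → m k ≡ just v
  ⊎ᵐ-⊆ʳ s p = ⊎ᵐ-⊆ˡ (⊎ᵐ-comm s) p

  ⊎ᵐ-inv : ∀ {m a b : PMap K V} {k v} → m ≐ a ⊎ᵐ b → m k ≡ just v → a k ≡ just v ⊎ b k ≡ just v
  ⊎ᵐ-inv {k = k} s p with s k
  ... | inj₁ (q , _) = inj₁ (trans (sym q) p)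
  ... | inj₂ (_ , q) = inj₂ (trans (sym q) p)

  single-inv : ∀ {m : PMap K V} {k v k′ v′} → DecidableEquality K → m ≐⟦ k ↦ v ⟧ → m k′ ≡ just v′ → k′ ≡ k × v′ ≡ v
  single-inv {k = k} {k′ = k′} _≟ᴷ_ (p , q) r with k′ ≟ᴷ k
  ... | yes refl = refl , just-injective (trans (sym r) p)
  ... | no ne    = just≢nothing r (q k′ ne)

sng : ∀ {K V : Set} → DecidableEquality K → K → V → PMap K V
sng _≟ᴷ_ k v k′ = if does (k′ ≟ᴷ k) then just v else nothing

module _ {K V : Set} (_≟ᴷ_ : DecidableEquality K) where

  sng-at : ∀ k {v : V} → sng _≟ᴷ_ k v k ≡ just v
  sng-at k = if-yes (k ≟ᴷ k) refl

  sng-off : ∀ {k v k′} → k′ ≢ k → sng {K} {V} _≟ᴷ_ k v k′ ≡ nothing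
  sng-off {k} {k′ = k′} ne = if-no (k′ ≟ᴷ k) ne

  sng-single : ∀ k v → sng {K} {V} _≟ᴷ_ k v ≐⟦ k ↦ v ⟧
  sng-single k v = sng-at k , λ k′ → sng-off

-- A list laid out on consecutive indices from `k`. The function `g` lets one list of payloads
-- describe both the receiving and the sending ends of the propagators.
segᵍ : ∀ {X Y : Set} → (X → Y) → ℕ → List X → PMap ℕ Y
segᵍ g k []       j = nothing
segᵍ g k (x ∷ xs) j = if does (j ≟ k) then just (g x) else segᵍ g (suc k) xs j

seg : ∀ {X : Set} → ℕ → List X → PMap ℕ X
seg = segᵍ (λ x → x)

module _ {X Y : Set} (g : X → Y) where

  seg-low : ∀ {k} xs {j} → j < k → segᵍ g k xs j ≡ nothing
  seg-low []             j<k = refl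
  seg-low {k} (x ∷ xs) {j} j<k =
    trans (if-no (j ≟ k) (λ { refl → <-irrefl refl j<k })) (seg-low xs (m<n⇒m<1+n j<k))

  seg-cons-⊎ : ∀ {k k′ x xs} → k′ ≡ suc k → segᵍ g k (x ∷ xs) ≐ sng _≟_ k (g x) ⊎ᵐ segᵍ g k′ xs
  seg-cons-⊎ {k} {x = x} {xs} refl j = helper (j ≟ k)
    where
    helper : Dec (j ≡ k) → _
    helper (yes refl) = inj₁ (trans (if-yes (j ≟ j) refl) (sym (sng-at _≟_ j)) , seg-low xs (n<1+n j))
    helper (no ne)    = inj₂ (sng-off _≟_ ne , if-no (j ≟ k) ne)

  -- The head is given by an equation because `pays-head` provides it only propositionally.
  seg-head-⊎ : ∀ {k x xs} → xs ≡ x ∷ drop 1 xs → segᵍ g k xs ≐ sng _≟_ k (g x) ⊎ᵐ segᵍ g (suc k) (drop 1 xs)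
  seg-head-⊎ {k} {x} {xs} e =
    subst (λ ys → segᵍ g k ys ≐ sng _≟_ k (g x) ⊎ᵐ segᵍ g (suc k) (drop 1 xs)) (sym e)
      (seg-cons-⊎ {xs = drop 1 xs} refl)

  -- The start of the second part is given up to an equation, since indices such as `k + l + 1` in
  -- the breakdown do not reduce to `k + length xs`.
  seg-++-⊎ : ∀ {k m} xs {ys} → m ≡ k + length xs → segᵍ g k (xs ++ ys) ≐ segᵍ g k xs ⊎ᵐ segᵍ g m ys
  seg-++-⊎ {k} [] refl rewrite +-identityʳ k = ⊎ᵐ-∅ˡ
  seg-++-⊎ {k} {m} (x ∷ xs) {ys} eq j = helper (j ≟ k)
    where
    eq′ : m ≡ suc k + length xs
    eq′ = trans eq (+-suc k (length xs))
    helper : Dec (j ≡ k) → _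
    helper (yes refl) =
      inj₁ (trans (if-yes (j ≟ j) refl) (sym (if-yes (j ≟ j) refl)) ,
            seg-low ys (subst (j <_) (sym eq′) (m≤m+n (suc j) (length xs))))
    helper (no ne) with seg-++-⊎ {suc k} xs {ys} eq′ j
    ... | inj₁ (p , q) = inj₁ (trans (if-no (j ≟ k) ne) (trans p (sym (if-no (j ≟ k) ne))) , q)
    ... | inj₂ (p , q) = inj₂ (trans (if-no (j ≟ k) ne) p , trans (if-no (j ≟ k) ne) q)

  seg-suc : ∀ k xs j → segᵍ g (suc k) xs (suc j) ≡ segᵍ g k xs j
  seg-suc k []       j = refl
  seg-suc k (x ∷ xs) j with j ≟ k
  ... | yes refl = trans (if-yes (suc j ≟ suc j) refl) (sym (if-yes (j ≟ j) refl))
  ... | no ne    = trans (if-no (suc j ≟ suc k) (λ { refl → ne refl }))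
                         (trans (seg-suc (suc k) xs j) (sym (if-no (j ≟ k) ne)))

!≡seg : ∀ {X : Set} (xs : List X) i → xs ! i ≡ seg 1 xs i
!≡seg []       zero          = refl
!≡seg []       (suc i)       = refl
!≡seg (x ∷ xs) zero          = sym (seg-low (λ x → x) xs (m<n⇒m<1+n (n<1+n 0)))
!≡seg (x ∷ xs) (suc zero)    = refl
!≡seg (x ∷ xs) (suc (suc i)) = trans (!≡seg xs (suc i)) (sym (seg-suc (λ x → x) 1 xs (suc i)))

-- Session environments of the target

data Kind : Set where
  idx      : Nm source → ℕ → Kind
  cₚ c̄ₚ  : ℕ → Kind
  zₚ       : ℕ → ℕ → Kind
  other    : Kind

-- Tells which of the four components of `senv` types a name; `other` covers names, such as the
-- `c^ r`, that never have a session type in a breakdown.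
kind : Nm target → Kind
kind (sh (a at i))       = idx (sh a) i
kind (se (s at i) p)     = idx (se s p) i
kind (nv (x at i))       = idx (nv x) i
kind (se (prop k) pos)   = cₚ k
kind (se (prop k) neg)   = c̄ₚ k
kind (nv (zed j i))      = zₚ j i
kind _                   = other

-- Outside `other`, the kind determines the name. Hence a name different from the one owned by a
-- singleton component has a different key, which is what the lemmas on singletons need.
kind-idx : ∀ w {u i} → kind w ≡ idx u i → w ≡ u at[ i ]
kind-idx (sh (_ at _))         refl = refl
kind-idx (se (_ at _) _)       refl = refl
kind-idx (se (prop _) pos)     ()
kind-idx (se (prop _) neg)     ()
kind-idx (se (rec _) _)        ()
kind-idx (se (zed _ _) _)      ()
kind-idx (nv (_ at _))         refl = refl

kind-c : ∀ w {k} → kind w ≡ cₚ k → w ≡ c k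
kind-c (se (prop _) pos) refl = refl
kind-c (sh (_ at _)) ()
kind-c (se (_ at _) _) ()
kind-c (se (prop _) neg) ()
kind-c (nv (_ at _)) ()

kind-c̄ : ∀ w {k} → kind w ≡ c̄ₚ k → w ≡ c̄ k
kind-c̄ (se (prop _) neg) refl = refl
kind-c̄ (sh (_ at _)) ()
kind-c̄ (se (_ at _) _) ()
kind-c̄ (se (prop _) pos) ()
kind-c̄ (nv (_ at _)) ()

kind-z : ∀ w {j i} → kind w ≡ zₚ j i → w ≡ nv (zed j i)
kind-z (nv (zed _ _)) refl = refl
kind-z (sh (_ at _)) ()
kind-z (se (_ at _) _) ()
kind-z (se (prop _) pos) ()
kind-z (se (prop _) neg) ()
kind-z (nv (_ at _)) ()

AMap CMap ZMap : Set
AMap = PMap (Nm source × ℕ) SType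
CMap = PMap ℕ SType
ZMap = PMap (ℕ × ℕ) SType

-- The session environments that occur in the typing of a breakdown: A types the
-- indexed names, C the c_k, D the c̄_k and Z the zⁱⱼ.
senv : AMap → CMap → CMap → ZMap → SessionEnv target
senv A C D Z w = senvᴷ (kind w)
  where
  senvᴷ : Kind → Maybe SType
  senvᴷ (idx u i) = A (u , i)
  senvᴷ (cₚ k)    = C k
  senvᴷ (c̄ₚ k)   = D k
  senvᴷ (zₚ j i)  = Z (j , i)
  senvᴷ other     = nothing

senv-⊎ : ∀ {A A₁ A₂ C C₁ C₂ D D₁ D₂ Z Z₁ Z₂} →
       A ≐ A₁ ⊎ᵐ A₂ → C ≐ C₁ ⊎ᵐ C₂ → D ≐ D₁ ⊎ᵐ D₂ → Z ≐ Z₁ ⊎ᵐ Z₂ →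
       senv A C D Z ≐ senv A₁ C₁ D₁ Z₁ ⊎ᵐ senv A₂ C₂ D₂ Z₂
senv-⊎ a ch d z w with kind w
... | idx u i = a (u , i)
... | cₚ k    = ch k
... | c̄ₚ k   = d k
... | zₚ j i  = z (j , i)
... | other   = inj₁ (refl , refl)

senv-≗ : ∀ {A A′ C C′ D D′ Z Z′} → A ≗ A′ → C ≗ C′ → D ≗ D′ → Z ≗ Z′ → senv A C D Z ≗ senv A′ C′ D′ Z′
senv-≗ a ch d z w with kind w
... | idx u i = a (u , i)
... | cₚ k    = ch k
... | c̄ₚ k   = d k
... | zₚ j i  = z (j , i)
... | other   = refl

senv-≗ᴬ : ∀ {A A′ C D Z} → A ≗ A′ → senv A C D Z ≗ senv A′ C D Z
senv-≗ᴬ a = senv-≗ a (λ _ → refl) (λ _ → refl) (λ _ → refl)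

senv-∅ : Empty (senv ∅ ∅ ∅ ∅)
senv-∅ w with kind w
... | idx u i = refl
... | cₚ k    = refl
... | c̄ₚ k   = refl
... | zₚ j i  = refl
... | other   = refl

senv-at : ∀ A C D Z u i → senv A C D Z (u at[ i ]) ≡ A (u , i)
senv-at A C D Z (sh _)   i = refl
senv-at A C D Z (se _ _) i = refl
senv-at A C D Z (nv _)   i = refl

senv-singleᴬ : ∀ {A u i M} → A ≐⟦ (u , i) ↦ M ⟧ → senv A ∅ ∅ ∅ ≐⟦ u at[ i ] ↦ M ⟧
senv-singleᴬ {A} {u} {i} {M} (p , q) = trans (senv-at A ∅ ∅ ∅ u i) p , go
  where
  go : ∀ w → w ≢ u at[ i ] → senv A ∅ ∅ ∅ w ≡ nothing
  go w ne with kind w in eq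
  ... | idx v j = q (v , j) λ { refl → ne (kind-idx w eq) }
  ... | cₚ k    = refl
  ... | c̄ₚ k   = refl
  ... | zₚ j i  = refl
  ... | other   = refl

senv-singleᶜ : ∀ {C k M} → C ≐⟦ k ↦ M ⟧ → senv ∅ C ∅ ∅ ≐⟦ c k ↦ M ⟧
senv-singleᶜ {C} {k} {M} (p , q) = p , go
  where
  go : ∀ w → w ≢ c k → senv ∅ C ∅ ∅ w ≡ nothing
  go w ne with kind w in eq
  ... | idx v j = refl
  ... | cₚ l    = q l λ { refl → ne (kind-c w eq) }
  ... | c̄ₚ l   = refl
  ... | zₚ j i  = refl
  ... | other   = refl

senv-singleᴰ : ∀ {D k M} → D ≐⟦ k ↦ M ⟧ → senv ∅ ∅ D ∅ ≐⟦ c̄ k ↦ M ⟧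
senv-singleᴰ {D} {k} {M} (p , q) = p , go
  where
  go : ∀ w → w ≢ c̄ k → senv ∅ ∅ D ∅ w ≡ nothing
  go w ne with kind w in eq
  ... | idx v j = refl
  ... | cₚ l    = refl
  ... | c̄ₚ l   = q l λ { refl → ne (kind-c̄ w eq) }
  ... | zₚ j i  = refl
  ... | other   = refl

senv-singleᶻ : ∀ {Z j i M} → Z ≐⟦ (j , i) ↦ M ⟧ → senv ∅ ∅ ∅ Z ≐⟦ nv (zed j i) ↦ M ⟧
senv-singleᶻ {Z} {j} {i} {M} (p , q) = p , go
  where
  go : ∀ w → w ≢ nv (zed j i) → senv ∅ ∅ ∅ Z w ≡ nothing
  go w ne with kind w in eq
  ... | idx v j = refl
  ... | cₚ l    = refl
  ... | c̄ₚ l   = refl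
  ... | zₚ k l  = q (k , l) λ { refl → ne (kind-z w eq) }
  ... | other   = refl

-- The part of a target environment that 𝒢 assigns to the session names us, at
-- their current types and indices in E, restricted to the types satisfying p.
entry : (SType → Bool) → Maybe (CType × ℕ) → ℕ → Maybe SType
entry p (just (ses S , i)) j = if p S then seg i (𝒢 S) j else nothing
entry p _                  j = nothing

live : (SType → Bool) → Env → List (Nm source) → AMap
live p E us (u , j) = if does (u ∈? us) then entry p (E u) j else nothing

nonrec allTypes : SType → Bool
nonrec S   = not (recursive S)
allTypes S = true

Ses : Env → Nm source → Set
Ses E u = ∃[ S ] ∃[ i ] E u ≡ just (ses S , i)

Apart : Env → List (Nm source) → List (Nm source) → Set
Apart E us ws = ∀ u → Ses E u → u ∈ us → u ∉ ws

module _ (p : SType → Bool) (E : Env) where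

  live-∈ : ∀ us {u} j → u ∈ us → live p E us (u , j) ≡ entry p (E u) j
  live-∈ us {u} j m = if-yes (u ∈? us) m

  live-∉ : ∀ us {u} j → u ∉ us → live p E us (u , j) ≡ nothing
  live-∉ us {u} j m = if-no (u ∈? us) m

  live-¬Ses : ∀ us {u} j → ¬ Ses E u → live p E us (u , j) ≡ nothing
  live-¬Ses us {u} j ns =
    by-cases (u ∈? us) (λ m → trans (live-∈ us j m) (entry-¬Ses (E u) refl)) (live-∉ us j)
    where
    entry-¬Ses : ∀ t → E u ≡ t → entry p t j ≡ nothing
    entry-¬Ses nothing            eq = refl
    entry-¬Ses (just (⟨ _ ⟩ , _)) eq = refl
    entry-¬Ses (just (ses S , i)) eq = ⊥-elim (ns (S , i , eq))

ses? : ∀ E u → Dec (Ses E u)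
ses? E u with E u
... | nothing            = no λ { (_ , _ , ()) }
... | just (⟨ _ ⟩ , _)   = no λ { (_ , _ , ()) }
... | just (ses S , i)   = yes (S , i , refl)

module _ (p : SType → Bool) {E : Env} where

  live-⇔ : ∀ {us ws} → (∀ u → Ses E u → u ∈ us → u ∈ ws) → (∀ u → Ses E u → u ∈ ws → u ∈ us) →
           live p E us ≗ live p E ws
  live-⇔ {us} {ws} f g (u , j) =
    by-cases (ses? E u)
      (λ s → by-cases (u ∈? us)
        (λ m → trans (live-∈ p E us j m) (sym (live-∈ p E ws j (f u s m))))
        (λ m → trans (live-∉ p E us j m) (sym (live-∉ p E ws j (λ m′ → m (g u s m′))))))
      (λ ns → trans (live-¬Ses p E us j ns) (sym (live-¬Ses p E ws j ns)))

  -- `Apart` makes the union disjoint: a name occurring on both sides has no session type in `E`,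
  -- and `live` ignores it.
  live-++-⊎ : ∀ {us ws} → Apart E us ws → live p E (us ++ ws) ≐ live p E us ⊎ᵐ live p E ws
  live-++-⊎ {us} {ws} ap (u , j) =
    by-cases (ses? E u)
      (λ s → by-cases (u ∈? us)
        (λ m → inj₁ (trans (live-∈ p E (us ++ ws) j (∈-++⁺ˡ m)) (sym (live-∈ p E us j m)) ,
                     live-∉ p E ws j (ap u s m)))
        (λ m → inj₂ (live-∉ p E us j m ,
                     by-cases (u ∈? ws)
                       (λ m′ → trans (live-∈ p E (us ++ ws) j (∈-++⁺ʳ us m′)) (sym (live-∈ p E ws j m′)))
                       (λ m′ → trans (live-∉ p E (us ++ ws) j (n m m′)) (sym (live-∉ p E ws j m′))))))
      (λ ns → inj₁ (trans (live-¬Ses p E (us ++ ws) j ns) (sym (live-¬Ses p E us j ns)) ,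
                    live-¬Ses p E ws j ns))
    where
    n : u ∉ us → u ∉ ws → u ∉ us ++ ws
    n m m′ k with ∈-++⁻ us k
    ... | inj₁ x = m x
    ... | inj₂ x = m′ x

  live-cong : ∀ {E′ us} → (∀ u → u ∈ us → E u ≡ E′ u) → live p E us ≗ live p E′ us
  live-cong {E′} {us} h (u , j) =
    by-cases (u ∈? us)
      (λ m → trans (live-∈ p E us j m) (trans (cong (λ t → entry p t j) (h u m)) (sym (live-∈ p E′ us j m))))
      (λ m → trans (live-∉ p E us j m) (sym (live-∉ p E′ us j m)))

entry-⊎ : ∀ t j → Sum (entry allTypes t j) (entry nonrec t j) (entry recursive t j)
entry-⊎ nothing            j = inj₁ (refl , refl)
entry-⊎ (just (⟨ _ ⟩ , _)) j = inj₁ (refl , refl)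
entry-⊎ (just (ses S , i)) j with recursive S
... | true  = inj₂ (refl , refl)
... | false = inj₁ (refl , refl)

-- The decomposed environment contains all tuples; the recursive ones go to the servers, the others
-- to the breakdown.
live-all-⊎ : ∀ {E us} → live allTypes E us ≐ live nonrec E us ⊎ᵐ live recursive E us
live-all-⊎ {E} {us} (u , j) =
  by-cases (u ∈? us)
    (λ m → Sum-resp (live-∈ allTypes E us j m) (live-∈ nonrec E us j m) (live-∈ recursive E us j m) (entry-⊎ (E u) j))
    (λ m → inj₁ (trans (live-∉ allTypes E us j m) (sym (live-∉ nonrec E us j m)) , live-∉ recursive E us j m))

-- Syntax-directed source typing

∈-∖ⁿ⁺ : ∀ {us ws u} → u ∈ us → u ∉ ws → u ∈ us ∖ⁿ ws
∈-∖ⁿ⁺ {ws = ws} = ∈-filter⁺ (λ u → ¬? (u ∈? ws))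

∈-∖ⁿ⁻ : ∀ us ws {u} → u ∈ us ∖ⁿ ws → u ∈ us × u ∉ ws
∈-∖ⁿ⁻ us ws = ∈-filter⁻ (λ u → ¬? (u ∈? ws))

[↦]-at : ∀ E u t → (E [ u ↦ t ]ᴱ) u ≡ just t
[↦]-at E u t = if-yes (u ≟ⁿ u) refl

[↦]-off : ∀ E u t {w} → w ≢ u → (E [ u ↦ t ]ᴱ) w ≡ E w
[↦]-off E u t {w} ne = if-no (w ≟ⁿ u) ne

[]ᴱ-∉ : ∀ xCs E {u} → u ∉ map nv (map proj₁ xCs) → (E [ xCs ]ᴱ) u ≡ E u
[]ᴱ-∉ []              E n = refl
[]ᴱ-∉ ((x , C) ∷ xCs) E n =
  trans ([]ᴱ-∉ xCs _ (λ m → n (there m))) ([↦]-off E (nv x) (C , 1) (λ eq → n (here eq)))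

[]ᴱ-∈ : ∀ xCs E {x C} → Unique (map nv (map proj₁ xCs)) → (x , C) ∈ xCs → (E [ xCs ]ᴱ) (nv x) ≡ just (C , 1)
[]ᴱ-∈ ((x , C) ∷ xCs) E (n ∷ un) (here refl) =
  trans ([]ᴱ-∉ xCs _ (λ m → All.lookup n m refl)) ([↦]-at E (nv x) (C , 1))
[]ᴱ-∈ ((x , C) ∷ xCs) E (n ∷ un) (there m)   = []ᴱ-∈ xCs _ un m

∈-params : ∀ (xCs : List (ℕ × CType)) {u} → u ∈ map nv (map proj₁ xCs) → ∃[ x ] ∃[ C ] u ≡ nv x × (x , C) ∈ xCs
∈-params ((x , C) ∷ xCs) (here eq) = x , C , eq , here refl
∈-params ((x , C) ∷ xCs) (there m) with ∈-params xCs m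
... | x′ , C′ , eq , m′ = x′ , C′ , eq , there m′

params-∈ : ∀ {xCs : List (ℕ × CType)} {x C} → (x , C) ∈ xCs → nv x ∈ map nv (map proj₁ xCs)
params-∈ m = ∈-map⁺ nv (∈-map⁺ proj₁ m)

module _ (E : Env) (u : Nm source) {S : SType} {i : ℕ} (eq : E u ≡ just (ses S , i)) where

  after-ses : after u E ≡ E [ u ↦ ses (cont S) , (if recursive S then i else suc i) ]ᴱ
  after-ses rewrite eq = refl

  after-at : after u E u ≡ just (ses (cont S) , (if recursive S then i else suc i))
  after-at rewrite after-ses = [↦]-at E u _

  after-off : ∀ {w} → w ≢ u → after u E w ≡ E w
  after-off ne rewrite after-ses = [↦]-off E u _ ne

  after-ended : cont S ≡ end → Ended (after u E) u
  after-ended c≡ = _ , trans after-at (cong (λ T → just (ses T , (if recursive S then i else suc i))) c≡)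

after-shared : ∀ {E u U i} → E u ≡ just (⟨ U ⟩ , i) → after u E ≡ E
after-shared eq rewrite eq = refl

Unshared : Env → Nm source → Set
Unshared E u = ∀ {U i} → E u ≢ just (⟨ U ⟩ , i)

¬Ses-shared : ∀ E u {U i} {B : Set} → E u ≡ just (⟨ U ⟩ , i) → Ses E u → B
¬Ses-shared E u p (_ , _ , q) with trans (sym p) q
... | ()

VEnv : Set
VEnv = PMap ℕ (List CType)

_[_↦_]ˣ : VEnv → ℕ → List CType → VEnv
(X [ x ↦ Cs ]ˣ) y = if does (y ≟ x) then just Cs else X y

[↦]ˣ-at : ∀ X x Cs → (X [ x ↦ Cs ]ˣ) x ≡ just Cs
[↦]ˣ-at X x Cs = if-yes (x ≟ x) refl

[↦]ˣ-off : ∀ X {x Cs y} → y ≢ x → (X [ x ↦ Cs ]ˣ) y ≡ X y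
[↦]ˣ-off X {x} {y = y} ne = if-no (y ≟ x) ne

-- The expected types come from the applied value and match those of `E` only up to `≈`. A session
-- name must not occur twice in the tuple, a shared one may.
data Args (E : Env) : List (Nm source) → List CType → Set where
  []  : Args E [] []
  ses : ∀ {u us S i T Ds} → E u ≡ just (ses S , i) → WF S → WF T → S ≈ T → u ∉ us →
        Args E us Ds → Args E (u ∷ us) (ses T ∷ Ds)
  ⟨⟩  : ∀ {u us U W Ds} → E u ≡ just (⟨ U ⟩ , 1) → WFᵁ U → U ≈ᵁ W →
        Args E us Ds → Args E (u ∷ us) (⟨ W ⟩ ∷ Ds)

-- Absence after the end comes from `NoReuse`, presence before it from linearity. Together they make
-- the entries left over by `𝒢` agree with those assigned by `live` after the action.
Continues : Nm source → SType → List (Nm source) → Set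
Continues u S us = (cont S ≡ end → u ∉ us) × (cont S ≢ end → u ∈ us)

-- X merges the variables of Γ and Λ; what remains of linearity are the premises Apart
-- and, for an abstraction used at a shared type, the absence of session names.
mutual
  data WTᵛ (E : Env) (X : VEnv) : Val source → HType → Set where
    var : ∀ {x Cs m Ds} → X x ≡ just Cs → All WFᶜ Cs → Pointwise _≈ᶜ_ Cs Ds →
          WTᵛ E X (var x) (arr m Ds)
    ƛ   : ∀ {m xCs P m′ Ds} → Unique (map nv (map proj₁ xCs)) → All WFᶜ (map proj₂ xCs) →
          (∀ {x S} → (x , ses S) ∈ xCs → nv x ∈ fu P ⊎ S ≡ end) →
          (m′ ≡ shr → ∀ u → Ses E u → u ∉ fuᵛ (ƛ m xCs P)) →
          WT (E [ xCs ]ᴱ) X P → Pointwise _≈ᶜ_ (map proj₂ xCs) Ds →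
          WTᵛ E X (ƛ m xCs P) (arr m′ Ds)

  data WT (E : Env) (X : VEnv) : Proc source → Set where
    𝟎    : WT E X 𝟎
    _∣_  : ∀ {P Q} → WT E X P → WT E X Q → Apart E (fu P) (fu Q) → WT E X (P ∣ Q)
    app  : ∀ {V us m Ds} → Agrees V (arr m Ds) → WTᵛ E X V (arr m Ds) → Args E us Ds →
           Apart E (fuᵛ V) us → WT E X (V · us)
    send : ∀ {u V n P S i U} → E u ≡ just (ses S , i) → WF S → unf S ≡ !⟨ [ U ] ⟩⨾ cont S →
           Agrees V U → WTᵛ (after u E) X V U → WT (after u E) X P →
           Apart (after u E) (fuᵛ V) (fu P) → Continues u S (fuᵛ V ++ fu P) →
           WT E X (send u [ V ] n P)
    req  : ∀ {u V n P U} → E u ≡ just (⟨ U ⟩ , 1) → WFᵁ U →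
           Agrees V U → WTᵛ (after u E) X V U → WT (after u E) X P →
           Apart (after u E) (fuᵛ V) (fu P) → WT E X (send u [ V ] n P)
    recv : ∀ {u x n P S i m Cs Ds} → E u ≡ just (ses S , i) → WF S →
           unf S ≡ ?⟨ [ arr m Ds ] ⟩⨾ cont S → Pointwise _≈ᶜ_ Cs Ds →
           WT (after u E) (X [ x ↦ Cs ]ˣ) P → Continues u S (fu P) → WT E X (recv u [ x ] n P)
    acc  : ∀ {u x n P m Cs Ds} → E u ≡ just (⟨ arr m Ds ⟩ , 1) → WFᵁ (arr m Ds) → Pointwise _≈ᶜ_ Cs Ds →
           WT (after u E) (X [ x ↦ Cs ]ˣ) P → WT E X (recv u [ x ] n P)
    νₛ   : ∀ {s S P} → WF S → Unshared E (se s pos) → Unshared E (se s neg) →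
           se s pos ∈ fu P ⊎ S ≡ end → se s neg ∈ fu P ⊎ S ≡ end →
           WT ((E [ se s pos ↦ ses S , 1 ]ᴱ) [ se s neg ↦ ses (dual S) , 1 ]ᴱ) X P → WT E X (νₛ s S P)
    νₐ   : ∀ {a U P} → WFᵁ U → WT (E [ sh a ↦ ⟨ U ⟩ , 1 ]ᴱ) X P → WT E X (νₐ a U P)

WTᵛ-≈ : ∀ {E X V U W} → WTᵛ E X V U → U ≈ᵁ W → WTᵛ E X V W
WTᵛ-≈ (var p w q)         (arr-cong r) = var p w (≈ᶜˢ-trans q r)
WTᵛ-≈ (ƛ un w d n t q) (arr-cong r) = ƛ un w d n t (≈ᶜˢ-trans q r)

Agrees-≈ : ∀ {V : Val source} {U W} → Agrees V U → U ≈ᵁ W → Agrees V W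
Agrees-≈ {var _}   a (arr-cong _) = tt
Agrees-≈ {ƛ _ _ _} a (arr-cong _) = a

module _ {K V : Set} (_≟ᴷ_ : (x y : K) → Dec (x ≡ y)) where

  []-back : ∀ {m m₀ : PMap K V} {k v v′ k′ w} → m ≐ m₀ [ k ∶ v ⇒ v′ ] → m k′ ≡ just w →
            (k′ ≡ k × w ≡ v′) ⊎ (k′ ≢ k × m₀ k′ ≡ just w)
  []-back {k = k} {k′ = k′} (p , q , r) e with k′ ≟ᴷ k
  ... | yes refl = inj₁ (refl , just-injective (trans (sym e) q))
  ... | no ne    = inj₂ (ne , trans (sym (r k′ ne)) e)

  []-fwd : ∀ {m m₀ : PMap K V} {k v v′ k′ w} → m ≐ m₀ [ k ∶ v ⇒ v′ ] → m₀ k′ ≡ just w → ∃[ w′ ] m k′ ≡ just w′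
  []-fwd {k = k} {k′ = k′} (p , q , r) e with k′ ≟ᴷ k
  ... | yes refl = _ , q
  ... | no ne    = _ , trans (r k′ ne) e

  ,-back : ∀ {m m₀ : PMap K V} {k v k′ w} → m ≐ m₀ , k ↦ v → m k′ ≡ just w →
           (k′ ≡ k × w ≡ v) ⊎ (k′ ≢ k × m₀ k′ ≡ just w)
  ,-back {k = k} {k′ = k′} (p , q , r) e with k′ ≟ᴷ k
  ... | yes refl = inj₁ (refl , just-injective (trans (sym e) q))
  ... | no ne    = inj₂ (ne , trans (sym (r k′ ne)) e)

  ,-fwd : ∀ {m m₀ : PMap K V} {k v k′ w} → m ≐ m₀ , k ↦ v → m₀ k′ ≡ just w → m k′ ≡ just w
  ,-fwd {k = k} {k′ = k′} (p , q , r) e with k′ ≟ᴷ k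
  ... | yes refl = just≢nothing e p
  ... | no ne    = trans (r k′ ne) e

-- Inversion of source derivations

data NameInv (Γ : SharedEnv source) (Δ : SessionEnv source) (u : Nm source) : CType → Set where
  ses : ∀ {S S′} → names Γ u ≡ nothing → Δ ≐⟦ u ↦ S′ ⟧ → S′ ≈ S → WF S′ → WF S → NameInv Γ Δ u (ses S)
  ⟨⟩  : ∀ {U U′} → names Γ u ≡ just U′ → Empty Δ → U′ ≈ᵁ U → WFᵁ U′ → WFᵁ U → NameInv Γ Δ u ⟨ U ⟩

name-inv : ∀ {Γ Δ u C} → Γ ⨾ Δ ⊢ⁿ u ▷ C → NameInv Γ Δ u C
name-inv (Sess n d w) = ses n d ≈-refl w w
name-inv (Sh n d w)   = ⟨⟩ n d (≈ᵁ-refl _) w w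
name-inv (Conv t q w) with name-inv t | q
... | ses n d p w′ _ | ses-cong q′ = ses n d (≈-trans p q′) w′ w
... | ⟨⟩ n d p w′ _  | ⟨⟩-cong q′  = ⟨⟩ n d (≈ᵁ-trans p q′) w′ w

data ParamInv (Γ : SharedEnv source) (Δ : SessionEnv source) (u : Nm source) : CType → Set where
  ses : ∀ {S S′} → names Γ u ≡ nothing → Δ u ≡ just S′ → S′ ≈ S → WF S → ParamInv Γ Δ u (ses S)
  ⟨⟩  : ∀ {U U′} → names Γ u ≡ just U′ → U′ ≈ᵁ U → WFᵁ U → ParamInv Γ Δ u ⟨ U ⟩

params-inv : ∀ {Γ Δ} xCs → Γ ⨾ Δ ⊢ⁿˢ map nv (map proj₁ xCs) ▷ map proj₂ xCs →
             ∀ {x C} → (x , C) ∈ xCs → ParamInv Γ Δ (nv x) C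
params-inv (_ ∷ xCs) (cons s t ts) (here refl) with name-inv t
... | ses n (d , _) p _ w = ses n (⊎ᵐ-⊆ˡ s d) p w
... | ⟨⟩ n _ p _ w        = ⟨⟩ n p w
params-inv (_ ∷ xCs) (cons s t ts) (there m) with params-inv xCs ts m
... | ses n d p w = ses n (⊎ᵐ-⊆ʳ s d) p w
... | ⟨⟩ n p w    = ⟨⟩ n p w

params-WF : ∀ {Γ : SharedEnv source} {Δ} xCs → Γ ⨾ Δ ⊢ⁿˢ map nv (map proj₁ xCs) ▷ map proj₂ xCs → All WFᶜ (map proj₂ xCs)
params-WF []        ts            = []
params-WF (_ ∷ xCs) (cons s t ts) with name-inv t
... | ses _ _ _ _ w = ses w ∷ params-WF xCs ts
... | ⟨⟩ _ _ _ _ w  = ⟨ w ⟩ ∷ params-WF xCs ts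

module _ {Γ : SharedEnv source} where

  names-dom : ∀ {Δ us Cs u S} → Γ ⨾ Δ ⊢ⁿˢ us ▷ Cs → Δ u ≡ just S → u ∈ us
  names-dom ([] e) d = just≢nothing d (e _)
  names-dom (cons s t ts) d with ⊎ᵐ-inv s d
  ... | inj₂ d′ = there (names-dom ts d′)
  ... | inj₁ d′ with name-inv t
  ...   | ses _ sg _ _ _ = here (proj₁ (single-inv _≟ⁿ_ sg d′))
  ...   | ⟨⟩ _ e _ _ _   = just≢nothing d′ (e _)

  names-WF : ∀ {Δ us Cs u S} → Γ ⨾ Δ ⊢ⁿˢ us ▷ Cs → Δ u ≡ just S → WF S × names Γ u ≡ nothing
  names-WF ([] e) d = just≢nothing d (e _)
  names-WF (cons s t ts) d with ⊎ᵐ-inv s d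
  ... | inj₂ d′ = names-WF ts d′
  ... | inj₁ d′ with name-inv t
  ...   | ⟨⟩ _ e _ _ _   = just≢nothing d′ (e _)
  ...   | ses n sg _ w _ with single-inv _≟ⁿ_ sg d′
  ...     | refl , refl = w , n

  names-scoped : ∀ {Δ us Cs u} → Γ ⨾ Δ ⊢ⁿˢ us ▷ Cs → u ∈ us →
                 (∃[ U ] names Γ u ≡ just U) ⊎ (∃[ S ] Δ u ≡ just S)
  names-scoped (cons s t ts) (here refl) with name-inv t
  ... | ses _ (d , _) _ _ _ = inj₂ (_ , ⊎ᵐ-⊆ˡ s d)
  ... | ⟨⟩ n _ _ _ _        = inj₁ (_ , n)
  names-scoped (cons s t ts) (there m) with names-scoped ts m
  ... | inj₁ x       = inj₁ x
  ... | inj₂ (_ , d) = inj₂ (_ , ⊎ᵐ-⊆ʳ s d)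

-- EProm lets a variable be looked up in Γ or in Λ, so inversion cannot say which; `only` excludes
-- any further linear variable, and `Cs` is the type as stored, before conversions.
record VarInv (Γ : SharedEnv source) (Λ : LinearEnv source) (y : ℕ) (U : HType) : Set where
  field
    {m}     : Mode
    {Cs Ds} : List CType
    type    : U ≡ arr m Ds
    found   : vars Γ y ≡ just Cs ⊎ Λ y ≡ just Cs
    equiv   : Pointwise _≈ᶜ_ Cs Ds
    wf      : All WFᶜ Cs
    only    : ∀ {z Es} → Λ z ≡ just Es → z ≡ y

var-inv : ∀ {Γ Λ Δ y U} → Γ ⨾ Λ ⨾ Δ ⊢ᵛ var y ▷ U → VarInv Γ Λ y U
var-inv (LVar n (l , l′) e (arr w)) = record
  { type = refl ; found = inj₂ l ; equiv = ≈ᶜˢ-refl _ ; wf = w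
  ; only = λ p → proj₁ (single-inv _≟_ (l , l′) p) }
var-inv (Prom e e′ t) with var-inv t
... | record { type = refl ; found = f ; equiv = q ; wf = w ; only = o } =
  record { type = refl ; found = f ; equiv = q ; wf = w ; only = o }
var-inv {Γ} {Λ} {y = y} (EProm {Γ′} {Λ′} {x} (so , _) n v l t) with var-inv t
... | record { Cs = Cs ; type = ty ; found = f ; equiv = q ; wf = w ; only = o } =
  record { type = ty ; found = found f ; equiv = q ; wf = w ; only = λ p → o (,-fwd _≟_ l p) }
  where
  found : vars Γ′ y ≡ just Cs ⊎ Λ′ y ≡ just Cs → vars Γ y ≡ just Cs ⊎ Λ y ≡ just Cs
  found (inj₁ p) = inj₁ (trans (sym (so y (λ { (here refl) → just≢nothing p n }))) p)
  found (inj₂ p) with ,-back _≟_ l p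
  ... | inj₁ (refl , refl) = inj₁ v
  ... | inj₂ (_ , p′)      = inj₂ p′
var-inv (Conv t (arr-cong q) w) with var-inv t
... | record { type = refl ; found = f ; equiv = q′ ; wf = w′ ; only = o } =
  record { type = refl ; found = f ; equiv = ≈ᶜˢ-trans q′ q ; wf = w′ ; only = o }

-- `dead` collects the names introduced by End. It is a list because session environments are
-- functions without an enumerable domain, whereas the target has to add these names back one at a
-- time.
record Facts (Γ : SharedEnv source) (Λ : LinearEnv source) (Δ : SessionEnv source) (us : List (Nm source)) : Set where
  field
    wf      : ∀ {u S} → Δ u ≡ just S → WF S
    apart   : ∀ {u S} → Δ u ≡ just S → names Γ u ≡ nothing
    vapart  : ∀ {x Cs} → Λ x ≡ just Cs → vars Γ x ≡ nothing
    scoped  : ∀ {u} → u ∈ us → (∃[ U ] names Γ u ≡ just U) ⊎ (∃[ S ] Δ u ≡ just S)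
    dead    : List (Nm source)
    dead-ok : ∀ {u S} → Δ u ≡ just S → u ∈ us ⊎ (S ≡ end × u ∈ dead)

open Facts

facts-EProm : ∀ {Γ Γ′ Λ Λ′ Δ x Cs us} → SameOff [ x ] [] Γ Γ′ → vars Γ x ≡ just Cs → Λ′ ≐ Λ , x ↦ Cs →
              Facts Γ′ Λ′ Δ us → Facts Γ Λ Δ us
facts-EProm {Γ} {Γ′} {Λ} {x = x} (so , sn) v l F = record
  { wf = wf F
  ; apart = λ d → trans (sym (sn _ (λ ()))) (apart F d)
  ; vapart = λ {y} p → trans (sym (so y (λ { (here refl) → just≢nothing p (proj₁ l) }))) (vapart F (,-fwd _≟_ l p))
  ; scoped = λ m → [ (λ { (U , p) → inj₁ (U , trans (sym (sn _ (λ ()))) p) }) , inj₂ ]′ (scoped F m)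
  ; dead = dead F
  ; dead-ok = dead-ok F }

facts-Par : ∀ {Γ Λ Λ₁ Λ₂ Δ Δ₁ Δ₂ us ws} → Λ ≐ Λ₁ ⊎ᵐ Λ₂ → Δ ≐ Δ₁ ⊎ᵐ Δ₂ →
            Facts Γ Λ₁ Δ₁ us → Facts Γ Λ₂ Δ₂ ws → Facts Γ Λ Δ (us ++ ws)
facts-Par {Γ} {Δ = Δ} {us = us} {ws} l s F G = record
  { wf = λ d → [ wf F , wf G ]′ (⊎ᵐ-inv s d)
  ; apart = λ d → [ apart F , apart G ]′ (⊎ᵐ-inv s d)
  ; vapart = λ p → [ vapart F , vapart G ]′ (⊎ᵐ-inv l p)
  ; scoped = λ m → sc (∈-++⁻ us m)
  ; dead = dead F ++ dead G
  ; dead-ok = λ d → dd (⊎ᵐ-inv s d) }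
  where
  sc : ∀ {u} → u ∈ us ⊎ u ∈ ws → (∃[ U ] names Γ u ≡ just U) ⊎ (∃[ S ] Δ u ≡ just S)
  sc (inj₁ m) with scoped F m
  ... | inj₁ x       = inj₁ x
  ... | inj₂ (_ , d) = inj₂ (_ , ⊎ᵐ-⊆ˡ s d)
  sc (inj₂ m) with scoped G m
  ... | inj₁ x       = inj₁ x
  ... | inj₂ (_ , d) = inj₂ (_ , ⊎ᵐ-⊆ʳ s d)
  dd : ∀ {u S} → _ → u ∈ us ++ ws ⊎ (S ≡ end × u ∈ dead F ++ dead G)
  dd (inj₁ d) with dead-ok F d
  ... | inj₁ m        = inj₁ (∈-++⁺ˡ m)
  ... | inj₂ (e , m)  = inj₂ (e , ∈-++⁺ˡ m)
  dd (inj₂ d) with dead-ok G d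
  ... | inj₁ m        = inj₁ (∈-++⁺ʳ us m)
  ... | inj₂ (e , m)  = inj₂ (e , ∈-++⁺ʳ (dead F) m)

facts-∅ : ∀ {Γ Λ Δ} → Empty Λ → Empty Δ → Facts Γ Λ Δ []
facts-∅ e e′ = record
  { wf = λ d → just≢nothing d (e′ _) ; apart = λ d → just≢nothing d (e′ _)
  ; vapart = λ p → just≢nothing p (e _) ; scoped = λ () ; dead = [] ; dead-ok = λ d → just≢nothing d (e′ _) }

facts-names : ∀ {Γ Δ us Cs} → Γ ⨾ Δ ⊢ⁿˢ us ▷ Cs → Facts Γ ∅ Δ us
facts-names ts = record
  { wf = λ d → proj₁ (names-WF ts d) ; apart = λ d → proj₂ (names-WF ts d) ; vapart = λ ()
  ; scoped = names-scoped ts ; dead = [] ; dead-ok = λ d → inj₁ (names-dom ts d) }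

facts-act : ∀ {Γ Λ Δ₀ Δ u S T us} → Δ ≐ Δ₀ [ u ∶ S ⇒ T ] → WF T → Facts Γ Λ Δ₀ us → Facts Γ Λ Δ (u ∷ us)
facts-act {Γ} {Δ = Δ} {u = u} {us = us} s w F = record
  { wf = λ d → [ (λ { (_ , refl) → w }) , (λ (_ , d′) → wf F d′) ]′ ([]-back _≟ⁿ_ s d)
  ; apart = λ d → [ (λ { (refl , _) → apart F (proj₁ s) }) , (λ (_ , d′) → apart F d′) ]′ ([]-back _≟ⁿ_ s d)
  ; vapart = vapart F
  ; scoped = sc
  ; dead = dead F
  ; dead-ok = λ d → dd ([]-back _≟ⁿ_ s d) }
  where
  sc : ∀ {w} → w ∈ u ∷ us → (∃[ U ] names Γ w ≡ just U) ⊎ (∃[ S ] Δ w ≡ just S)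
  sc (here refl) = inj₂ (_ , proj₁ (proj₂ s))
  sc (there m) with scoped F m
  ... | inj₁ x       = inj₁ x
  ... | inj₂ (_ , d) = inj₂ ([]-fwd _≟ⁿ_ s d)
  dd : ∀ {w R} → _ → w ∈ u ∷ us ⊎ (R ≡ end × w ∈ dead F)
  dd (inj₁ (refl , _)) = inj₁ (here refl)
  dd (inj₂ (_ , d)) with dead-ok F d
  ... | inj₁ m = inj₁ (there m)
  ... | inj₂ x = inj₂ x

facts-recv : ∀ {Γ Γ′ Λ Λ₁ Λ₂ ΛV ΛE Δ us x U} → SameOff [ x ] [] Γ Γ′ → Λ₁ ≐ Λ ⊎ᵐ Λ₂ → Λ₂ ≐ ΛV ⊎ᵐ ΛE →
             VarInv Γ′ ΛV x U → Facts Γ′ Λ₁ Δ us → Facts Γ Λ Δ us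
facts-recv {Γ} {Γ′} {Λ} {x = x} (so , sn) l lv v F = record
  { wf = wf F
  ; apart = λ d → trans (sym (sn _ (λ ()))) (apart F d)
  ; vapart = va
  ; scoped = λ m → [ (λ { (U , p) → inj₁ (U , trans (sym (sn _ (λ ()))) p) }) , inj₂ ]′ (scoped F m)
  ; dead = dead F
  ; dead-ok = dead-ok F }
  where
  va : ∀ {y Cs} → Λ y ≡ just Cs → vars Γ y ≡ nothing
  va {y} p with y ≟ x
  ... | no ne = trans (sym (so y (λ { (here refl) → ne refl }))) (vapart F (⊎ᵐ-⊆ˡ l p))
  -- A linear variable of the context cannot bear the name of the received one: the latter is typed
  -- in `Γ′` or in `Λ₂`, and `Λ` is disjoint from both.
  ... | yes refl with VarInv.found v
  ...   | inj₁ q = just≢nothing q (vapart F (⊎ᵐ-⊆ˡ l p))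
  ...   | inj₂ q = ⊎ᵐ-disjoint l p (⊎ᵐ-⊆ˡ lv q)

⊎ᵐ-Emptyʳ : ∀ {K V : Set} {m a e : PMap K V} → m ≐ a ⊎ᵐ e → Empty e → ∀ k → a k ≡ m k
⊎ᵐ-Emptyʳ s h k with s k
... | inj₁ (p , _) = sym p
... | inj₂ (p , q) = trans p (sym (trans q (h k)))

facts-≗ : ∀ {Γ Λ Λ′ Δ Δ′ us} → (∀ x → Λ x ≡ Λ′ x) → (∀ u → Δ u ≡ Δ′ u) → Facts Γ Λ Δ us → Facts Γ Λ′ Δ′ us
facts-≗ l d F = record
  { wf = λ p → wf F (trans (d _) p) ; apart = λ p → apart F (trans (d _) p)
  ; vapart = λ p → vapart F (trans (l _) p)
  ; scoped = λ m → [ inj₁ , (λ (S , p) → inj₂ (S , trans (sym (d _)) p)) ]′ (scoped F m)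
  ; dead = dead F ; dead-ok = λ p → dead-ok F (trans (d _) p) }

facts-shared : ∀ {Γ Λ Δ us u U} → Γ ⨾ ∅ ⊢ⁿ u ▷ ⟨ U ⟩ → Facts Γ Λ Δ us → Facts Γ Λ Δ (u ∷ us)
facts-shared {Γ} {Δ = Δ} tu F = record
  { wf = wf F ; apart = apart F ; vapart = vapart F
  ; scoped = λ { (here refl) → shared (name-inv tu) ; (there m) → scoped F m }
  ; dead = dead F ; dead-ok = λ d → [ (λ m → inj₁ (there m)) , inj₂ ]′ (dead-ok F d) }
  where
  shared : ∀ {u U} → NameInv Γ ∅ u ⟨ U ⟩ → (∃[ U ] names Γ u ≡ just U) ⊎ (∃[ S ] Δ u ≡ just S)
  shared (⟨⟩ n _ _ _ _) = inj₁ (_ , n)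

mutual
  -- A session assumption is consumed at an occurrence of its name or by End, which requires `end`;
  -- Conv does not interfere, because `≈` relates `end` only to itself.
  facts : ∀ {Γ Λ Δ P} → Γ ⨾ Λ ⨾ Δ ⊢ P → Facts Γ Λ Δ (fu P)
  facts (Nil e e′) = facts-∅ e e′
  facts (EProm so _ v l t) = facts-EProm so v l (facts t)
  facts {Γ} {Δ = Δ} {P} (End {Δ′} {u} n s t) = record
    { wf = λ d → [ (λ { (_ , refl) → finite end }) , (λ (_ , d′) → wf F d′) ]′ (,-back _≟ⁿ_ s d)
    ; apart = λ d → [ (λ { (refl , _) → n }) , (λ (_ , d′) → apart F d′) ]′ (,-back _≟ⁿ_ s d)
    ; vapart = vapart F
    ; scoped = λ m → [ inj₁ , (λ (_ , d) → inj₂ (_ , ,-fwd _≟ⁿ_ s d)) ]′ (scoped F m)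
    ; dead = u ∷ dead F
    ; dead-ok = λ d → dd (,-back _≟ⁿ_ s d) }
    where
    F = facts t
    dd : ∀ {w R} → (w ≡ u × R ≡ end) ⊎ (w ≢ u × Δ′ w ≡ just R) → w ∈ fu P ⊎ (R ≡ end × w ∈ u ∷ dead F)
    dd (inj₁ (refl , e)) = inj₂ (e , here refl)
    dd (inj₂ (_ , d)) with dead-ok F d
    ... | inj₁ m       = inj₁ m
    ... | inj₂ (e , m) = inj₂ (e , there m)
  facts {Γ} {Δ = Δ} {P} (Conv {Δ′} r ok t) = record
    { wf = ok _ _
    ; apart = λ d → apart F (proj₁ (proj₂ (back d)))
    ; vapart = vapart F
    ; scoped = λ m → [ inj₁ , (λ (_ , d) → inj₂ (fwd d)) ]′ (scoped F m)
    ; dead = dead F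
    ; dead-ok = dd }
    where
    F = facts t
    back : ∀ {u S} → Δ u ≡ just S → ∃[ S′ ] Δ′ u ≡ just S′ × S′ ≈ S
    back {u} d with Δ u | Δ′ u | r u
    back refl | just _ | just _ | just q = _ , refl , q
    fwd : ∀ {u S} → Δ′ u ≡ just S → ∃[ S′ ] Δ u ≡ just S′
    fwd {u} d with Δ u | Δ′ u | r u
    fwd refl | just _ | just _ | just q = _ , refl
    dd : ∀ {u S} → Δ u ≡ just S → u ∈ fu P ⊎ (S ≡ end × u ∈ dead F)
    dd d with back d
    ... | _ , d′ , q with dead-ok F d′
    ...   | inj₁ m          = inj₁ m
    ...   | inj₂ (refl , m) = inj₂ (end≈⇒≡ q , m)
  facts (App s a t ts) = facts-Par ⊎ᵐ-∅ʳ s (factsᵛ t) (facts-names ts)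
  facts (Send l s t (cons lv sv _ tv ([] e e′)) st w) = facts-act st w
    (facts-Par (⊎ᵐ-comm l) (⊎ᵐ-comm s) (facts-≗ (⊎ᵐ-Emptyʳ lv e) (⊎ᵐ-Emptyʳ sv e′) (factsᵛ tv)) (facts t))
  facts (Rcv {xs = _ ∷ []} un so t (cons lv _ _ tv ([] e e′)) l st w) =
    facts-act st w (facts-recv so l lv (var-inv tv) (facts t))
  facts {Γ} {Δ = Δ} (Req {u = u} s tu t a tv) = facts-shared tu
    (facts-Par ⊎ᵐ-∅ˡ (⊎ᵐ-comm s) (factsᵛ tv) (facts t))
  facts (Acc so tu t tv l) = facts-shared tu (facts-recv so l ⊎ᵐ-∅ʳ (var-inv tv) (facts t))
  facts (Par l s t t′) = facts-Par l s (facts t) (facts t′)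
  facts {Γ} {Δ = Δ} (Res {Γ′} {a} {P = P} (sv , so) n _ t) = record
    { wf = wf F
    ; apart = λ d → trans (sym (so _ (off d))) (apart F d)
    ; vapart = λ p → trans (sym (sv _ (λ ()))) (vapart F p)
    ; scoped = λ m → sc (∈-∖ⁿ⁻ (fu P) [ sh a ] m)
    ; dead = dead F
    ; dead-ok = λ d → [ (λ m → inj₁ (∈-∖ⁿ⁺ m (off d))) , inj₂ ]′ (dead-ok F d) }
    where
    F = facts t
    off : ∀ {u S} → Δ u ≡ just S → u ∉ [ sh a ]
    off d (here refl) = just≢nothing n (apart F d)
    sc : ∀ {u} → u ∈ fu P × u ∉ [ sh a ] → (∃[ U ] names Γ u ≡ just U) ⊎ (∃[ S ] Δ u ≡ just S)
    sc (m , ne) with scoped F m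
    ... | inj₁ (U , p) = inj₁ (U , trans (sym (so _ ne)) p)
    ... | inj₂ x       = inj₂ x
  facts {Γ} {Δ = Δ} (ResS {Δ₁} {Δ₂} {s} {P = P} _ _ _ _ s₁ s₂ t) = record
    { wf = λ d → wf F (fwd d)
    ; apart = λ d → apart F (fwd d)
    ; vapart = vapart F
    ; scoped = λ m → sc (∈-∖ⁿ⁻ (fu P) _ m)
    ; dead = dead F
    ; dead-ok = λ d → [ (λ m → inj₁ (∈-∖ⁿ⁺ m (off d))) , inj₂ ]′ (dead-ok F (fwd d)) }
    where
    F = facts t
    fwd : ∀ {u S} → Δ u ≡ just S → Δ₂ u ≡ just S
    fwd d = ,-fwd _≟ⁿ_ s₂ (,-fwd _≟ⁿ_ s₁ d)
    off : ∀ {u S} → Δ u ≡ just S → u ∉ se s pos ∷ se s neg ∷ []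
    off d (here refl)         = just≢nothing d (proj₁ s₁)
    off d (there (here refl)) = just≢nothing (,-fwd _≟ⁿ_ s₁ d) (proj₁ s₂)
    sc : ∀ {u} → u ∈ fu P × u ∉ se s pos ∷ se s neg ∷ [] → (∃[ U ] names Γ u ≡ just U) ⊎ (∃[ S ] Δ u ≡ just S)
    sc (m , ne) with scoped F m
    ... | inj₁ x = inj₁ x
    ... | inj₂ (S , d) with ,-back _≟ⁿ_ s₂ d
    ...   | inj₁ (refl , _) = ⊥-elim (ne (there (here refl)))
    ...   | inj₂ (_ , d′) with ,-back _≟ⁿ_ s₁ d′
    ...     | inj₁ (refl , _) = ⊥-elim (ne (here refl))
    ...     | inj₂ (_ , d″)   = inj₂ (_ , d″)

  factsᵛ : ∀ {Γ Λ Δ V U} → Γ ⨾ Λ ⨾ Δ ⊢ᵛ V ▷ U → Facts Γ Λ Δ (fuᵛ V)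
  factsᵛ {Γ} {Λ} (LVar {x} n s e w) = record
    { wf = λ d → just≢nothing d (e _) ; apart = λ d → just≢nothing d (e _)
    ; vapart = vap ; scoped = λ () ; dead = []
    ; dead-ok = λ d → just≢nothing d (e _) }
    where
    vap : ∀ {y Cs} → Λ y ≡ just Cs → vars Γ y ≡ nothing
    vap p with single-inv _≟_ s p
    ... | refl , _ = n
  factsᵛ (Prom _ _ t) = factsᵛ t
  factsᵛ (EProm so _ v l t) = facts-EProm so v l (factsᵛ t)
  factsᵛ (Conv t _ _) = factsᵛ t
  factsᵛ {Γ} {Δ = Δ} (Abs {Γ′} {Δ₁} {Δ₂} {xCs = xCs} {P} un (sv , so) t ts s) = record
    { wf = λ d → wf F (⊎ᵐ-⊆ˡ s d)
    ; apart = λ d → trans (sym (so _ (off d))) (apart F (⊎ᵐ-⊆ˡ s d))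
    ; vapart = λ p → trans (sym (sv _ (λ ()))) (vapart F p)
    ; scoped = λ m → sc (∈-∖ⁿ⁻ (fu P) _ m)
    ; dead = dead F
    ; dead-ok = λ d → [ (λ m → inj₁ (∈-∖ⁿ⁺ m (off d))) , inj₂ ]′ (dead-ok F (⊎ᵐ-⊆ˡ s d)) }
    where
    F = facts t
    off : ∀ {u S} → Δ u ≡ just S → u ∉ map nv (map proj₁ xCs)
    off d m with names-scoped ts m
    ... | inj₁ (_ , n)  = just≢nothing n (apart F (⊎ᵐ-⊆ˡ s d))
    ... | inj₂ (_ , d′) = ⊎ᵐ-disjoint s d d′
    sc : ∀ {u} → u ∈ fu P × u ∉ map nv (map proj₁ xCs) → (∃[ U ] names Γ u ≡ just U) ⊎ (∃[ S ] Δ u ≡ just S)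
    sc (m , ne) with scoped F m
    ... | inj₁ (U , p) = inj₁ (U , trans (sym (so _ ne)) p)
    ... | inj₂ (_ , d) with ⊎ᵐ-inv s d
    ...   | inj₁ d′ = inj₂ (_ , d′)
    ...   | inj₂ d′ = ⊥-elim (ne (names-dom ts d′))

-- Derived rules of the target system

module _ {L : Lang} {Γ : SharedEnv L} where

  name-ext : ∀ {Δ Δ′ u C} → Δ ≗ Δ′ → Γ ⨾ Δ ⊢ⁿ u ▷ C → Γ ⨾ Δ′ ⊢ⁿ u ▷ C
  name-ext e (Sess n (d , d′) w) = Sess n (trans (sym (e _)) d , λ k ne → trans (sym (e k)) (d′ k ne)) w
  name-ext e (Sh n d w)          = Sh n (λ k → trans (sym (e k)) (d k)) w
  name-ext e (Conv t q w)        = Conv (name-ext e t) q w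

  ⊎ᵐ-ext : ∀ {K V : Set} {m m′ a b : PMap K V} → m ≗ m′ → m ≐ a ⊎ᵐ b → m′ ≐ a ⊎ᵐ b
  ⊎ᵐ-ext e = ⊎ᵐ-resp e (λ _ → refl) (λ _ → refl)

  names-ext : ∀ {Δ Δ′ us Cs} → Δ ≗ Δ′ → Γ ⨾ Δ ⊢ⁿˢ us ▷ Cs → Γ ⨾ Δ′ ⊢ⁿˢ us ▷ Cs
  names-ext e ([] d)        = [] λ k → trans (sym (e k)) (d k)
  names-ext e (cons s t ts) = cons (⊎ᵐ-ext e s) t ts

-- Environments are functions and extensionality is not assumed; replacing one by a pointwise equal
-- one means rebuilding the derivation as far down as Δ is passed on unchanged.
session-ext : ∀ {L} {Γ : SharedEnv L} {Λ Δ Δ′ P} → Δ ≗ Δ′ → Γ ⨾ Λ ⨾ Δ ⊢ P → Γ ⨾ Λ ⨾ Δ′ ⊢ P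
session-ext e (Nil l d)          = Nil l λ k → trans (sym (e k)) (d k)
session-ext e (EProm so n v l t) = EProm so n v l (session-ext e t)
session-ext e (End n (p , q , r) t) =
  End n (p , trans (sym (e _)) q , λ k ne → trans (sym (e k)) (r k ne)) t
session-ext {Δ = Δ} {Δ′} e (Conv {Δ″} r ok t) =
  Conv (λ u → subst (MaybeRel _≈_ (Δ″ u)) (e u) (r u)) (λ u S d → ok u S (trans (e u) d)) t
session-ext {Γ = Γ} e (App s a t ts)     = App (⊎ᵐ-ext {Γ = Γ} e s) a t ts
session-ext e (Send l s t ts (p , q , r) w) =
  Send l s t ts (p , trans (sym (e _)) q , λ k ne → trans (sym (e k)) (r k ne)) w
session-ext e (Rcv un so t ts l (p , q , r) w) =
  Rcv un so t ts l (p , trans (sym (e _)) q , λ k ne → trans (sym (e k)) (r k ne)) w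
session-ext {Γ = Γ} e (Req s tu t a tv)  = Req (⊎ᵐ-ext {Γ = Γ} e s) tu t a tv
session-ext e (Acc so tu t tv l) = Acc so tu (session-ext e t) tv l
session-ext {Γ = Γ} e (Par l s t t′)     = Par l (⊎ᵐ-ext {Γ = Γ} e s) t t′
session-ext e (Res so n w t)     = Res so n w (session-ext e t)
session-ext e (ResS a q w w′ (p , p′ , p″) s₂ t) =
  ResS a q w w′ (trans (sym (e _)) p , p′ , λ k ne → trans (p″ k ne) (e k)) s₂ t

names-++ : ∀ {L} {Γ : SharedEnv L} {Δ Δ₁ Δ₂ us ws Cs Ds} → Δ ≐ Δ₁ ⊎ᵐ Δ₂ →
           Γ ⨾ Δ₁ ⊢ⁿˢ us ▷ Cs → Γ ⨾ Δ₂ ⊢ⁿˢ ws ▷ Ds → Γ ⨾ Δ ⊢ⁿˢ us ++ ws ▷ Cs ++ Ds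
names-++ s ([] e) ts        = names-ext (⊎ᵐ-Emptyʳ (⊎ᵐ-comm s) e) ts
names-++ s (cons s₁ t us) ts with ⊎ᵐ-assocʳ s s₁
... | _ , s₂ , s₃ = cons s₂ t (names-++ s₃ us ts)

single-⊎⇒, : ∀ {K V : Set} {m a s : PMap K V} {k v} → m ≐ s ⊎ᵐ a → s ≐⟦ k ↦ v ⟧ → m ≐ a , k ↦ v
single-⊎⇒, {m = m} {a} {s} {k} {v} d (p , q) = a-k , ⊎ᵐ-⊆ˡ d p , off
  where
  a-k : a k ≡ nothing
  a-k with d k
  ... | inj₁ (_ , e) = e
  ... | inj₂ (e , _) = just≢nothing p e
  off : ∀ k′ → k′ ≢ k → m k′ ≡ a k′
  off k′ ne with d k′
  ... | inj₂ (_ , e) = e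
  ... | inj₁ (e , z) = trans e (trans (q k′ ne) (sym z))

ok : ∀ {M} → Minimal M → Ok target M
ok {M} m = M , ≈-refl , m

okᵁ : ∀ {U} → Minimalᵁ U → Okᵁ target U
okᵁ {U} m = U , ≈ᵁ-refl U , m

okᵁ-≈ : ∀ {U W} → U ≈ᵁ W → Okᵁ target W → Okᵁ target U
okᵁ-≈ q (M , r , m) = M , ≈ᵁ-trans q r , m

-- Keeps the `names` field fixed definitionally, so that facts about names, such as
-- `Fits (names Γ)`, hold for the new environment without transport.
rebind : (TVar → Maybe (List CType)) → SharedEnv target → SharedEnv target
rebind v Γ = record { vars = v ; names = names Γ }

-- There is no axiom for variables of Γ: EProm moves `x` into Λ, where LVar applies. For a shared
-- type Prom is used below EProm, where Λ is still empty.
var-typed : ∀ {Γ : SharedEnv target} {Δ x m Cs} → vars Γ x ≡ just Cs → Okᵁ target (arr lin Cs) → Empty Δ →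
            Γ ⨾ ∅ ⨾ Δ ⊢ᵛ var x ▷ arr m Cs
var-typed {Γ} {Δ} {x} {m} {Cs} v w e = mode m
  where
  vs : TVar → Maybe (List CType)
  vs y = if does (y ≟ᵛ x) then nothing else vars Γ y
  linear : Γ ⨾ ∅ ⨾ Δ ⊢ᵛ var x ▷ Cs ⊸⋄
  linear = EProm {Γ′ = rebind vs Γ} {Λ′ = sng _≟ᵛ_ x Cs}
    ((λ y n → if-no (y ≟ᵛ x) (λ { refl → n (here refl) })) , λ _ _ → refl)
    (if-yes (x ≟ᵛ x) refl) v (refl , sng-at _≟ᵛ_ x , λ _ → sng-off _≟ᵛ_)
    (LVar (if-yes (x ≟ᵛ x) refl) (sng-single _≟ᵛ_ x Cs) e w)
  mode : ∀ m → Γ ⨾ ∅ ⨾ Δ ⊢ᵛ var x ▷ arr m Cs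
  mode lin = linear
  mode shr = Prom (λ _ → refl) e linear

-- A non-recursive minimal prefix leaves its name at type `end`, and the continuation does not own
-- that name; End bridges the two. The same holds for `send-end`.
recv-end : ∀ {Γ Γ′ : SharedEnv target} {Δ Δₛ Δ′ w xs Us P} → names Γ w ≡ nothing → Unique xs → SameOff xs [] Γ Γ′ →
           Γ′ ⨾ ∅ ⨾ ∅ ⊢ᵛˢ map var xs ▷ Us → Ok target (?⟨ Us ⟩⨾ end) →
           Δ′ ≐ Δₛ ⊎ᵐ Δ → Δₛ ≐⟦ w ↦ ?⟨ Us ⟩⨾ end ⟧ → Γ′ ⨾ ∅ ⨾ Δ ⊢ P → Γ ⨾ ∅ ⨾ Δ′ ⊢ recv w xs tt P
recv-end {Δ = Δ} {Δₛ} {Δ′} {w} n un so vs o s sg t with single-⊎⇒, s sg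
... | p , q , r =
  Rcv {Δ₁ = Δ₁} un so (End (trans (proj₂ so w (λ ())) n) (p , if-yes (w ≟ᵗ w) refl , λ k ne → if-no (k ≟ᵗ w) ne) t)
    vs ⊎ᵐ-∅ʳ (if-yes (w ≟ᵗ w) refl , q , λ k ne → trans (r k ne) (sym (if-no (k ≟ᵗ w) ne))) o
  where
  Δ₁ : SessionEnv target
  Δ₁ k = if does (k ≟ᵗ w) then just end else Δ k

send-end : ∀ {Γ : SharedEnv target} {Δ Δ₁ Δ₂ Δₛ Δ′ w Vs Us P} → names Γ w ≡ nothing →
           Γ ⨾ ∅ ⨾ Δ₂ ⊢ᵛˢ Vs ▷ Us → Ok target (!⟨ Us ⟩⨾ end) →
           Δ′ ≐ Δₛ ⊎ᵐ Δ → Δₛ ≐⟦ w ↦ !⟨ Us ⟩⨾ end ⟧ → Δ ≐ Δ₁ ⊎ᵐ Δ₂ → Γ ⨾ ∅ ⨾ Δ₁ ⊢ P → Γ ⨾ ∅ ⨾ Δ′ ⊢ send w Vs tt P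
send-end {Δ = Δ} {Δ₁} {Δ₂} {Δₛ} {Δ′} {w} n vs o s sg s′ t with single-⊎⇒, s sg
... | p , q , r =
  Send {Δ₀ = Δ₀} {Δ₁′} {Δ₂} ⊎ᵐ-∅ʳ split
    (End n (Δ₁-w , if-yes (w ≟ᵗ w) refl , λ k ne → if-no (k ≟ᵗ w) ne) t) vs
    (if-yes (w ≟ᵗ w) refl , q , λ k ne → trans (r k ne) (sym (if-no (k ≟ᵗ w) ne))) o
  where
  Δ₀ Δ₁′ : SessionEnv target
  Δ₀ k  = if does (k ≟ᵗ w) then just end else Δ k
  Δ₁′ k = if does (k ≟ᵗ w) then just end else Δ₁ k
  none : Δ₁ w ≡ nothing × Δ₂ w ≡ nothing
  none with s′ w
  ... | inj₁ (e , f) = trans (sym e) p , f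
  ... | inj₂ (e , f) = e , trans (sym f) p
  Δ₁-w = proj₁ none
  split : Δ₀ ≐ Δ₁′ ⊎ᵐ Δ₂
  split k = by-cases (k ≟ᵗ w)
    (λ { refl → inj₁ (trans (if-yes (k ≟ᵗ w) refl) (sym (if-yes (k ≟ᵗ w) refl)) , proj₂ none) })
    (λ ne → Sum-resp (if-no (k ≟ᵗ w) ne) (if-no (k ≟ᵗ w) ne) refl (s′ k))

module _ {Γ : SharedEnv target} where

  one-value : ∀ {Δ V U} → Agrees V U → Γ ⨾ ∅ ⨾ Δ ⊢ᵛ V ▷ U → Γ ⨾ ∅ ⨾ Δ ⊢ᵛˢ [ V ] ▷ [ U ]
  one-value a t = cons ⊎ᵐ-∅ʳ ⊎ᵐ-∅ʳ a t ([] (λ _ → refl) (λ _ → refl))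

-- Propagators carry every variable at a shared type, since the target keeps it in Γ.
payload : VEnv → ℕ → HType
payload X x = arr shr (maybe 𝒢ᶜˢ [] (X x))

payloads : VEnv → List ℕ → List HType
payloads X []         = [ arr shr [ ses end ] ]
payloads X (x ∷ xs) = map (payload X) (x ∷ xs)

Typed : VEnv → List ℕ → Set
Typed X xs = ∀ {x} → x ∈ xs → ∃[ Cs ] X x ≡ just Cs × All WFᶜ Cs

Holds : SharedEnv target → VEnv → List ℕ → Set
Holds Γ X xs = ∀ {x Cs} → x ∈ xs → X x ≡ just Cs → vars Γ (src x) ≡ just (𝒢ᶜˢ Cs)

payloads-minimal : ∀ {X} xs → Typed X xs → All Minimalᵁ (payloads X xs)
payloads-minimal []       h = arr (ses end ∷ []) ∷ []
payloads-minimal {X} (x ∷ xs) h = AllP.map⁺ (All.tabulate λ m → go (h m))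
  where
  go : ∀ {x} → ∃[ Cs ] X x ≡ just Cs × All WFᶜ Cs → Minimalᵁ (payload X x)
  go (Cs , e , w) rewrite e = arr (𝒢ᶜˢ-minimal w)

module _ {Γ : SharedEnv target} {X : VEnv} where

  variables-typed : ∀ {xs} → Holds Γ X xs → Typed X xs →
                    Γ ⨾ ∅ ⨾ ∅ ⊢ᵛˢ map (λ x → var (src x)) xs ▷ map (payload X) xs
  variables-typed {[]}     h ty = [] (λ _ → refl) (λ _ → refl)
  variables-typed {x ∷ xs} h ty with ty (here refl)
  ... | Cs , e , w = cons ⊎ᵐ-∅ˡ ⊎ᵐ-∅ˡ tt
      (subst (λ t → Γ ⨾ ∅ ⨾ ∅ ⊢ᵛ var (src x) ▷ arr shr (maybe 𝒢ᶜˢ [] t)) (sym e)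
        (var-typed (h (here refl) e) (okᵁ (arr (𝒢ᶜˢ-minimal w))) (λ _ → refl)))
      (variables-typed (λ m → h (there m)) (λ m → ty (there m)))

  c̄ₖ-typed : ∀ {k xs Δ Δₛ Δ′ P} → names Γ (c̄ k) ≡ nothing → names Γ (nv (zed 0 0)) ≡ nothing →
             Holds Γ X xs → Typed X xs →
             Δ′ ≐ Δₛ ⊎ᵐ Δ → Δₛ ≐⟦ c̄ k ↦ !⟨ payloads X xs ⟩⨾ end ⟧ → Γ ⨾ ∅ ⨾ Δ ⊢ P →
             Γ ⨾ ∅ ⨾ Δ′ ⊢ c̄ₖ k xs P
  c̄ₖ-typed {xs = []} n z h ty s sg t =
    -- The dummy `λx.𝟎` binds `zed 0 0` at type `end`, discarded by End; it owns nothing else, so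
    -- Prom gives it its shared type.
    send-end n (one-value refl (Prom (λ _ → refl) (λ _ → refl)
      (Abs {Δ₁ = sng _≟ᵗ_ w end} ([] ∷ []) ((λ _ _ → refl) , λ _ _ → refl)
        (End z (refl , refl , λ k ne → if-no (k ≟ᵗ w) ne) (Nil (λ _ → refl) (λ _ → refl)))
        (cons ⊎ᵐ-∅ʳ (Sess z (sng-single _≟ᵗ_ w end) (ok end)) ([] (λ _ → refl))) ⊎ᵐ-∅ˡ)))
      (ok (!⨾ (payloads-minimal [] ty))) s sg ⊎ᵐ-∅ʳ t
    where
    w : Nm target
    w = nv (zed 0 0)
  c̄ₖ-typed {xs = x ∷ xs} n z h ty s sg t =
    send-end n (variables-typed h ty) (ok (!⨾ (payloads-minimal (x ∷ xs) ty))) s sg ⊎ᵐ-∅ʳ t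

-- The body is typed under any `vs` satisfying `Holds`, so the particular extension of Γ stays
-- hidden from the inductions that use this rule.
cₖ-typed : ∀ {Γ : SharedEnv target} {X k xs Δ Δₛ Δ′ P} → names Γ (c k) ≡ nothing → Unique xs → Typed X xs →
           Δ′ ≐ Δₛ ⊎ᵐ Δ → Δₛ ≐⟦ c k ↦ ?⟨ payloads X xs ⟩⨾ end ⟧ →
           (∀ vs → Holds (rebind vs Γ) X xs → rebind vs Γ ⨾ ∅ ⨾ Δ ⊢ P) →
           Γ ⨾ ∅ ⨾ Δ′ ⊢ cₖ k xs P
cₖ-typed {Γ} {xs = []} n un ty s sg t =
  recv-end {Γ′ = rebind vs Γ} n ([] ∷ []) (so , λ _ _ → refl)
    (one-value tt (var-typed {Γ = rebind vs Γ} refl (okᵁ (arr (ses end ∷ []))) (λ _ → refl)))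
    (ok (?⨾ (payloads-minimal [] ty))) s sg (t vs λ ())
  where
  vs : TVar → Maybe (List CType)
  vs x = if does (x ≟ᵛ unused) then just [ ses end ] else vars Γ x
  so : ∀ x → x ∉ [ unused ] → vs x ≡ vars Γ x
  so x n = if-no (x ≟ᵛ unused) (λ { refl → n (here refl) })
cₖ-typed {Γ} {X} {xs = xs@(x ∷ xs′)} n un ty s sg t =
  recv-end {Γ′ = rebind vs Γ} n (UniqueP.map⁺ (λ { refl → refl }) un) (so , λ _ _ → refl)
    (subst (λ Vs → rebind vs Γ ⨾ ∅ ⨾ ∅ ⊢ᵛˢ Vs ▷ map (payload X) xs) (map-∘ xs) (variables-typed h ty))
    (ok (?⨾ (payloads-minimal xs ty))) s sg (t vs h)
  where
  open DecMembership _≟_ using () renaming (_∈?_ to _∈ⁿ?_)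
  vs : TVar → Maybe (List CType)
  vs (src y) = if does (y ∈ⁿ? xs) then Maybe.map 𝒢ᶜˢ (X y) else vars Γ (src y)
  vs y       = vars Γ y
  h : Holds (rebind vs Γ) X xs
  h {y} m e = trans (if-yes (y ∈ⁿ? xs) m) (cong (Maybe.map 𝒢ᶜˢ) e)
  so : ∀ y → y ∉ map src xs → vs y ≡ vars Γ y
  so (src y) n = if-no (y ∈ⁿ? xs) (λ m → n (∈-map⁺ src m))
  so bvar    n = refl
  so unused  n = refl

callback-typed : ∀ {Γ : SharedEnv target} {r Cs Δ ws} → names Γ (c^ r) ≡ just (arr lin Cs) → Minimalᵁ (arr lin Cs) →
                 (∀ vs → rebind vs Γ ⨾ Δ ⊢ⁿˢ ws ▷ Cs) → Γ ⨾ ∅ ⨾ Δ ⊢ callback r ws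
callback-typed {Γ} {r} {Cs} n w ts =
  Acc {Γ′ = rebind vs Γ} (so , λ _ _ → refl) (Sh n (λ _ → refl) (okᵁ w))
    (App ⊎ᵐ-∅ˡ tt (typed (λ _ → refl)) (ts vs)) (typed (λ _ → refl)) ⊎ᵐ-∅ʳ
  where
  vs : TVar → Maybe (List CType)
  vs x = if does (x ≟ᵛ bvar) then just Cs else vars Γ x
  so : ∀ x → x ∉ [ bvar ] → vs x ≡ vars Γ x
  so x n = if-no (x ≟ᵛ bvar) (λ { refl → n (here refl) })
  typed : ∀ {Δ} → Empty Δ → rebind vs Γ ⨾ ∅ ⨾ Δ ⊢ᵛ var bvar ▷ arr lin Cs
  typed = var-typed {Γ = rebind vs Γ} refl (okᵁ w)

-- Common form of the tuples built by `block` and `params`. In contrast to a map over `upTo`, it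
-- recurses in step with `seg`.
run : (ℕ → Nm target) → ℕ → ℕ → List (Nm target)
run nm i zero    = []
run nm i (suc n) = nm i ∷ run nm (suc i) n

block≡run : ∀ u i n → block u i n ≡ run (u at[_]) i n
block≡run u i n = go n i (λ j → j) (λ _ → refl)
  where
  go : ∀ {g : ℕ → Nm target} n i h → (∀ j → g (h j) ≡ u at[ i + j ]) → map g (applyUpTo h n) ≡ run (u at[_]) i n
  go zero    i h e = refl
  go (suc n) i h e = cong₂ _∷_ (trans (e 0) (cong (u at[_]) (+-identityʳ i)))
    (go n (suc i) (h ∘ suc) (λ j → trans (e (suc j)) (cong (u at[_]) (+-suc i j))))

∈-run : ∀ nm i n {w} → w ∈ run nm i n → ∃[ j ] i ≤ j × w ≡ nm j
∈-run nm i (suc n) (here e)  = i , ≤-refl , e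
∈-run nm i (suc n) (there m) with ∈-run nm (suc i) n m
... | j , i<j , e = j , <⇒≤ i<j , e

run-unique : ∀ {nm} → (∀ {i j} → nm i ≡ nm j → i ≡ j) → ∀ i n → Unique (run nm i n)
run-unique inj i zero    = []
run-unique {nm} inj i (suc n) = All.tabulate fresh ∷ run-unique inj (suc i) n
  where
  fresh : ∀ {w} → w ∈ run nm (suc i) n → nm i ≢ w
  fresh m e with ∈-run nm (suc i) n m
  ... | j , i<j , e′ = <-irrefl (inj (trans e e′)) i<j

params-types : ∀ a i Cs → map proj₂ (params a i Cs) ≡ Cs
params-types a i []       = refl
params-types a i (C ∷ Cs) = cong (C ∷_) (params-types a (suc i) Cs)

params-names : ∀ a i Cs → map nv (map proj₁ (params a i Cs)) ≡ run (λ j → nv (a j)) i (length Cs)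
params-names a i []       = refl
params-names a i (C ∷ Cs) = cong (_ ∷_) (params-names a (suc i) Cs)

zNames≡run : ∀ j S → zNames j S ≡ run (λ i → nv (zed j i)) 1 (length (ℛ⋆ S))
zNames≡run j S = trans (params-names (zed j) 1 (map ses (ℛ⋆ S)))
                       (cong (run _ 1) (length-map ses (ℛ⋆ S)))

module _ {K : Set} (_≟ᴷ_ : (x y : K) → Dec (x ≡ y)) where

  column : K → PMap ℕ SType → PMap (K × ℕ) SType
  column u m (v , j) = if does (v ≟ᴷ u) then m j else nothing

  column-⊎ : ∀ u {m a b} → m ≐ a ⊎ᵐ b → column u m ≐ column u a ⊎ᵐ column u b
  column-⊎ u s (v , j) with does (v ≟ᴷ u)
  ... | true  = s j
  ... | false = inj₁ (refl , refl)

  column-∅ : ∀ u → Empty (column u ∅)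
  column-∅ u (v , j) with does (v ≟ᴷ u)
  ... | true  = refl
  ... | false = refl

  column-single : ∀ u {m i M} → m ≐⟦ i ↦ M ⟧ → column u m ≐⟦ (u , i) ↦ M ⟧
  column-single u {m} {i} (p , q) = trans (if-yes (u ≟ᴷ u) refl) p , off
    where
    off : ∀ k → k ≢ (u , i) → column u m k ≡ nothing
    off (v , j) ne = by-cases (v ≟ᴷ u)
      (λ { refl → trans (if-yes (v ≟ᴷ v) refl) (q j λ { refl → ne refl }) })
      (if-no (v ≟ᴷ u))

-- K embeds the maps on indices of one name into session environments.
record Lift (nm : ℕ → Nm target) (K : PMap ℕ SType → SessionEnv target) : Set where
  field
    K-∅      : Empty (K ∅)
    K-⊎      : ∀ {m a b} → m ≐ a ⊎ᵐ b → K m ≐ K a ⊎ᵐ K b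
    K-single : ∀ {m i M} → m ≐⟦ i ↦ M ⟧ → K m ≐⟦ nm i ↦ M ⟧

lift-at : ∀ u → Lift (u at[_]) (λ m → senv (column _≟ⁿ_ u m) ∅ ∅ ∅)
lift-at u = record
  { K-∅ = λ w → trans (senv-≗ᴬ (column-∅ _≟ⁿ_ u) w) (senv-∅ w)
  ; K-⊎ = λ s → senv-⊎ (column-⊎ _≟ⁿ_ u s) ⊎ᵐ-∅ˡ ⊎ᵐ-∅ˡ ⊎ᵐ-∅ˡ
  ; K-single = λ s → senv-singleᴬ (column-single _≟ⁿ_ u s) }

lift-zed : ∀ j → Lift (λ i → nv (zed j i)) (λ m → senv ∅ ∅ ∅ (column _≟_ j m))
lift-zed j = record
  { K-∅ = λ w → trans (senv-≗ (λ _ → refl) (λ _ → refl) (λ _ → refl) (column-∅ _≟_ j) w) (senv-∅ w)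
  ; K-⊎ = λ s → senv-⊎ ⊎ᵐ-∅ˡ ⊎ᵐ-∅ˡ ⊎ᵐ-∅ˡ (column-⊎ _≟_ j s)
  ; K-single = λ s → senv-singleᶻ (column-single _≟_ j s) }

-- `Ms` are the types in the environment and `Ns` the expected ones. The slack up to `≈` admits
-- arguments whose recorded type is another representative of the expected type.
run-typed : ∀ {Γ : SharedEnv target} {nm K} → Lift nm K → (∀ i → names Γ (nm i) ≡ nothing) →
            ∀ i {Ms Ns} → Pointwise _≈_ Ms Ns → All Minimal Ns →
            Γ ⨾ K (seg i Ms) ⊢ⁿˢ run nm i (length Ms) ▷ map ses Ns
run-typed l n i [] [] = [] (Lift.K-∅ l)
run-typed l n i {M ∷ Ms} (q ∷ qs) (m ∷ ms) =
  cons (Lift.K-⊎ l (seg-cons-⊎ (λ x → x) {xs = Ms} refl))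
    (Conv (Sess (n i) (Lift.K-single l (sng-single _≟_ i M)) (_ , q , m)) (ses-cong q) (ok m))
    (run-typed l n (suc i) qs ms)

abs-typed : ∀ {Γ Γ′ : SharedEnv target} {Λ Δ Δ₁ Δ₂ m xCs P x̃ C̃} →
            map nv (map proj₁ xCs) ≡ x̃ → map proj₂ xCs ≡ C̃ → Unique x̃ → SameOff [] x̃ Γ Γ′ →
            Γ′ ⨾ Λ ⨾ Δ₁ ⊢ P → Γ′ ⨾ Δ₂ ⊢ⁿˢ x̃ ▷ C̃ → Δ₁ ≐ Δ ⊎ᵐ Δ₂ → Γ ⨾ Λ ⨾ Δ ⊢ᵛ ƛ m xCs P ▷ C̃ ⊸⋄
abs-typed refl refl = Abs

-- All of Δ goes into the abstraction sent, as its continuation is `𝟎`. Inside, the tuple may be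
-- typed by any `Ms` pointwise `≈` to `ℛ⋆ S`; this is where one loop gets unfolded.
request-typed : ∀ {Γ : SharedEnv target} {Δ Δ₁ u S j Ms P} →
                names Γ (c^ u) ≡ just (arr lin (map ses (ℛ⋆ S))) → (∀ j i → names Γ (nv (zed j i)) ≡ nothing) →
                All Minimal (ℛ⋆ S) → Pointwise _≈_ Ms (ℛ⋆ S) →
                Δ₁ ≐ Δ ⊎ᵐ senv ∅ ∅ ∅ (column _≟_ j (seg 1 Ms)) → Γ ⨾ ∅ ⨾ Δ₁ ⊢ P →
                Γ ⨾ ∅ ⨾ Δ ⊢ request u S j P
request-typed {Γ} {S = S} {j} {Ms} n z ms qs s t =
  Req ⊎ᵐ-∅ˡ (Sh n (λ _ → refl) (okᵁ (arr (AllP.map⁺ (All.map ses ms))))) (Nil (λ _ → refl) (λ _ → refl)) refl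
    (abs-typed (trans (zNames≡run j S) (cong (run _ 1) (sym (PW.Pointwise-length qs)))) (params-types (zed j) 1 _)
      (run-unique (λ { refl → refl }) 1 (length Ms)) ((λ _ _ → refl) , λ _ _ → refl)
      t (run-typed (lift-zed j) (z j) 1 qs ms) s)

-- Names of the breakdown and how actions change their types

NamesEnv : Set
NamesEnv = PMap (Nm target) HType

sharedAt : Maybe (CType × ℕ) → ℕ → Maybe HType
sharedAt (just (⟨ U ⟩ , _)) i = [ 𝒢ᵁ U ] ! i
sharedAt _                  i = nothing

-- N types the names of the breakdown under E of a term with free names us.
record Fits (N : NamesEnv) (E : Env) (us : List (Nm source)) : Set where
  field
    indexed    : ∀ u i → N (u at[ i ]) ≡ sharedAt (E u) i
    propagator : ∀ k p → N (se (prop k) p) ≡ nothing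
    variable-z : ∀ j i → N (nv (zed j i)) ≡ nothing
    server     : ∀ {u S i} → u ∈ us → E u ≡ just (ses S , i) → recursive S ≡ true →
                 N (c^ u) ≡ just (arr lin (map ses (ℛ⋆ S)))

open Fits

Fits-⊆ : ∀ {N E us ws} → (∀ {u} → u ∈ ws → u ∈ us) → Fits N E us → Fits N E ws
Fits-⊆ h F = record { indexed = indexed F ; propagator = propagator F ; variable-z = variable-z F
                    ; server = λ m → server F (h m) }

session-index : ∀ {N E us u S i} → Fits N E us → E u ≡ just (ses S , i) → ∀ j → N (u at[ j ]) ≡ nothing
session-index F e j = trans (indexed F _ j) (cong (λ t → sharedAt t j) e)

-- An action changes the entry of a session name only, and `ℛ⋆` is the same before and after it, so
-- the servers keep their types.
Fits-after : ∀ {N E us} u {ws} → (∀ {w} → w ∈ ws → w ∈ us) → Fits N E us → Fits N (after u E) ws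
Fits-after {N} {E} {us} u {ws} h F = go (E u) refl
  where
  go : ∀ t → E u ≡ t → Fits N (after u E) ws
  go nothing e            = subst (λ E′ → Fits N E′ ws) (sym unchanged) (Fits-⊆ h F)
    where
    unchanged : after u E ≡ E
    unchanged rewrite e = refl
  go (just (⟨ U ⟩ , i)) e = subst (λ E′ → Fits N E′ ws) (sym (after-shared e)) (Fits-⊆ h F)
  go (just (ses S , i)) e = record
    { indexed = λ v j → by-cases (v ≟ⁿ u)
        (λ { refl → trans (session-index F e j) (cong (λ t → sharedAt t j) (sym (after-at E u e))) })
        (λ ne → trans (indexed F v j) (cong (λ t → sharedAt t j) (sym (after-off E u e ne))))
    ; propagator = propagator F ; variable-z = variable-z F
    ; server = λ {v} m e′ r → by-cases (v ≟ⁿ u)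
        (λ { refl → moved m e′ r })
        (λ ne → server F (h m) (trans (sym (after-off E u e ne)) e′) r) }
    where
    moved : ∀ {T j} → u ∈ ws → after u E u ≡ just (ses T , j) → recursive T ≡ true →
            N (c^ u) ≡ just (arr lin (map ses (ℛ⋆ T)))
    moved m e′ r with trans (sym (after-at E u e)) e′
    ... | refl rewrite ℛ⋆-cont S = server F (h m) e (trans (sym (recursive-cont S)) r)

entry-hit : ∀ p {t S i} → t ≡ just (ses S , i) → p S ≡ true → ∀ j → entry p t j ≡ seg i (𝒢 S) j
entry-hit p {S = S} {i} refl h j = cong (λ b → if b then seg i (𝒢 S) j else nothing) h

entry-miss : ∀ p {t S i} → t ≡ just (ses S , i) → p S ≡ false → ∀ j → entry p t j ≡ nothing
entry-miss p {S = S} {i} refl h j = cong (λ b → if b then seg i (𝒢 S) j else nothing) h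

module _ (p : SType → Bool) (E E′ : Env) (u : Nm source) (us : List (Nm source)) where

  live-off : ∀ v j → v ≢ u → E v ≡ E′ v → live p E (u ∷ us) (v , j) ≡ live p E′ us (v , j)
  live-off v j ne e = by-cases (v ∈? us)
    (λ m → trans (live-∈ p E (u ∷ us) j (there m)) (trans (cong (λ t → entry p t j) e) (sym (live-∈ p E′ us j m))))
    (λ m → trans (live-∉ p E (u ∷ us) j (λ { (here x) → ne x ; (there x) → m x })) (sym (live-∉ p E′ us j m)))

  live-drop : (∀ v → v ≢ u → E v ≡ E′ v) → (∀ j → entry p (E u) j ≡ nothing) → (∀ j → entry p (E′ u) j ≡ nothing) →
              live p E (u ∷ us) ≗ live p E′ us
  live-drop e n n′ (v , j) = by-cases (v ≟ⁿ u) at-u (λ ne → live-off v j ne (e v ne))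
    where
    at-u : v ≡ u → live p E (u ∷ us) (v , j) ≡ live p E′ us (v , j)
    at-u refl = trans (live-∈ p E (u ∷ us) j (here refl)) (trans (n j) (sym (by-cases (u ∈? us)
      (λ m → trans (live-∈ p E′ us j m) (n′ j)) (live-∉ p E′ us j))))

  live-take : ∀ {S i Ms} → E u ≡ just (ses S , i) → p S ≡ true → (∀ v → v ≢ u → E v ≡ E′ v) →
              (∀ j → Sum (seg i (𝒢 S) j) (seg i Ms j) (live p E′ us (u , j))) →
              live p E (u ∷ us) ≐ column _≟ⁿ_ u (seg i Ms) ⊎ᵐ live p E′ us
  live-take {S} {i} {Ms} eq h e s (v , j) = by-cases (v ≟ⁿ u) at-u off
    where
    at-u : v ≡ u → Sum (live p E (u ∷ us) (v , j)) (column _≟ⁿ_ u (seg i Ms) (v , j)) (live p E′ us (v , j))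
    at-u refl = Sum-resp (trans (live-∈ p E (u ∷ us) j (here refl)) (entry-hit p eq h j)) (if-yes (v ≟ⁿ v) refl) refl (s j)
    off : v ≢ u → Sum (live p E (u ∷ us) (v , j)) (column _≟ⁿ_ u (seg i Ms) (v , j)) (live p E′ us (v , j))
    off ne = inj₂ (if-no (v ≟ⁿ u) ne , live-off v j ne (e v ne))

live-cons : ∀ p {E u S i} us → E u ≡ just (ses S , i) → p S ≡ true → u ∉ us →
            live p E (u ∷ us) ≐ column _≟ⁿ_ u (seg i (𝒢 S)) ⊎ᵐ live p E us
live-cons p {E} {u} {S} us eq h n = live-take p E E u us {Ms = 𝒢 S} eq h (λ _ _ → refl) (λ j → inj₁ (refl , live-∉ p E us j n))

live-shared : ∀ p {E u U i} us → E u ≡ just (⟨ U ⟩ , i) → live p E (u ∷ us) ≗ live p E us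
live-shared p {E} {u} us eq = live-drop p E E u us (λ _ _ → refl) none none
  where
  none : ∀ j → entry p (E u) j ≡ nothing
  none j = cong (λ t → entry p t j) eq

live-rec : ∀ {E u S i} us → E u ≡ just (ses S , i) → recursive S ≡ true → live nonrec E (u ∷ us) ≗ live nonrec E us
live-rec {E} {u} us eq r = live-drop nonrec E E u us (λ _ _ → refl) none none
  where
  none : ∀ j → entry nonrec (E u) j ≡ nothing
  none = entry-miss nonrec eq (cong not r)

live-rec-after : ∀ {E u S i} us → E u ≡ just (ses S , i) → recursive S ≡ true →
                 live nonrec E (u ∷ us) ≗ live nonrec (after u E) us
live-rec-after {E} {u} {S} us eq r =
  live-drop nonrec E (after u E) u us (λ v ne → sym (after-off E u eq ne)) (entry-miss nonrec eq (cong not r))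
    (entry-miss nonrec (after-at E u eq) (cong not (trans (recursive-cont S) r)))

-- The prefix uses up the entry at index `i`, and the remaining entries are those that `after`
-- assigns from `suc i` on. If the continuation is `end` there are none, in agreement with
-- `Continues`, by which the name is then absent from `us`.
live-step : ∀ d {E u S i Us} us → E u ≡ just (ses S , i) → WF S → recursive S ≡ false → unf S ≡ act d Us (cont S) →
            Continues u S us →
            live nonrec E (u ∷ us) ≐ column _≟ⁿ_ u (seg i [ act d (𝒢ᵁˢ Us) end ]) ⊎ᵐ live nonrec (after u E) us
live-step d {E} {u} {S} {i} {Us} us eq w r st (dead , alive) =
  live-take nonrec E (after u E) u us {Ms = [ act d (𝒢ᵁˢ Us) end ]} eq (cong not r) (λ v ne → sym (after-off E u eq ne)) λ j →
    Sum-resp (cong (λ Ms → seg i Ms j) (𝒢-step d w r st)) refl (rest j) (seg-cons-⊎ (λ x → x) {xs = 𝒢⁺ (cont S)} refl j)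
  where
  at-u : after u E u ≡ just (ses (cont S) , suc i)
  at-u = trans (after-at E u eq) (cong (λ b → just (ses (cont S) , (if b then i else suc i))) r)
  go : ∀ b → isEnd (cont S) ≡ b → ∀ j → live nonrec (after u E) us (u , j) ≡
       seg (suc i) (if b then [] else 𝒢 (cont S)) j
  go true  e j = live-∉ nonrec (after u E) us j (dead (isEnd⇒≡ (cont S) e))
  go false e j = trans (live-∈ nonrec (after u E) us j (alive λ e′ → contra (trans (sym e) (cong isEnd e′))))
                       (entry-hit nonrec at-u (cong not (trans (recursive-cont S) r)) j)
    where
    contra : false ≢ true
    contra ()
  rest : ∀ j → live nonrec (after u E) us (u , j) ≡ seg (suc i) (𝒢⁺ (cont S)) j
  rest = go (isEnd (cont S)) refl

module _ {Γ : SharedEnv target} {E : Env} {C D : CMap} {Z : ZMap} {P : Proc target}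
         (idx-free : ∀ {u S i} → E u ≡ just (ses S , i) → ∀ j → names Γ (u at[ j ]) ≡ nothing) where

  -- Repeats End in the target for names that the source discarded. Elements of `ws` that are
  -- already present or have no session type leave the environment as it is.
  weaken-ended : ∀ ws {us} → (∀ {w S i} → w ∈ ws → E w ≡ just (ses S , i) → w ∈ us ⊎ S ≡ end) →
                 Γ ⨾ ∅ ⨾ senv (live nonrec E us) C D Z ⊢ P → Γ ⨾ ∅ ⨾ senv (live nonrec E (ws ++ us)) C D Z ⊢ P
  weaken-ended []       h t = t
  weaken-ended (w ∷ ws) {us} h t =
    by-cases (w ∈? (ws ++ us)) same (λ n → by-cases (ses? E w) (λ (S , i , e) → ended n e) unused′)
    where
    IH : Γ ⨾ ∅ ⨾ senv (live nonrec E (ws ++ us)) C D Z ⊢ P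
    IH = weaken-ended ws (λ m → h (there m)) t
    ext : live nonrec E (ws ++ us) ≗ live nonrec E (w ∷ ws ++ us) → Γ ⨾ ∅ ⨾ senv (live nonrec E (w ∷ ws ++ us)) C D Z ⊢ P
    ext e = session-ext (senv-≗ᴬ e) IH
    same : w ∈ ws ++ us → Γ ⨾ ∅ ⨾ senv (live nonrec E (w ∷ ws ++ us)) C D Z ⊢ P
    same m = ext (live-⇔ nonrec {E} {ws ++ us} {w ∷ ws ++ us} (λ _ _ → there) (λ { _ _ (here refl) → m ; _ _ (there m′) → m′ }))
    unused′ : ¬ Ses E w → Γ ⨾ ∅ ⨾ senv (live nonrec E (w ∷ ws ++ us)) C D Z ⊢ P
    unused′ n = ext (live-⇔ nonrec {E} {ws ++ us} {w ∷ ws ++ us} (λ _ _ → there)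
      (λ { _ s (here refl) → ⊥-elim (n s) ; _ _ (there m′) → m′ }))
    ended : w ∉ ws ++ us → ∀ {S i} → E w ≡ just (ses S , i) → Γ ⨾ ∅ ⨾ senv (live nonrec E (w ∷ ws ++ us)) C D Z ⊢ P
    ended n {S} {i} e with h (here refl) e
    ... | inj₁ m    = ⊥-elim (n (∈-++⁺ʳ ws m))
    ... | inj₂ refl = End (idx-free e i)
      (single-⊎⇒, (senv-⊎ (live-cons nonrec {E} (ws ++ us) e refl n) ⊎ᵐ-∅ˡ ⊎ᵐ-∅ˡ ⊎ᵐ-∅ˡ)
        (senv-singleᴬ (column-single _≟ⁿ_ w (sng-single _≟_ i end)))) IH

seg-single : ∀ {X Y : Set} (g : X → Y) i x → segᵍ g i [ x ] ≐⟦ i ↦ g x ⟧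
seg-single g i x = sng-single _≟_ i (g x)

recvT sendT : List HType → SType
recvT Us = ?⟨ Us ⟩⨾ end
sendT Us = !⟨ Us ⟩⨾ end

-- Both ends take their types from one list, so they are dual by computation; the missing
-- annotations put no constraint on them.
νc-typed : ∀ {Γ : SharedEnv target} {A C C′ D D′ Z P} k ps {n} → length ps ≡ n → All (All Minimalᵁ) ps →
           C′ ≐ C ⊎ᵐ segᵍ recvT k ps → D′ ≐ D ⊎ᵐ segᵍ sendT k ps →
           Γ ⨾ ∅ ⨾ senv A C′ D′ Z ⊢ P → Γ ⨾ ∅ ⨾ senv A C D Z ⊢ νc k n P
νc-typed k []       refl [] ch d t =
  session-ext (senv-≗ (λ _ → refl) (λ j → sym (⊎ᵐ-Emptyʳ ch (λ _ → refl) j))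
    (λ j → sym (⊎ᵐ-Emptyʳ d (λ _ → refl) j)) (λ _ → refl)) t
νc-typed k (p ∷ ps) refl (m ∷ ms) ch d t
  with ⊎ᵐ-assocˡ ch (seg-cons-⊎ recvT {xs = ps} refl) | ⊎ᵐ-assocˡ d (seg-cons-⊎ sendT {xs = ps} refl)
... | C₁ , ch₁ , ch₂ | D₁ , d₁ , d₂ =
  ResS tt ≈-refl (ok (?⨾ m)) (ok (!⨾ m))
    (single-⊎⇒, (senv-⊎ ⊎ᵐ-∅ˡ (⊎ᵐ-comm ch₂) ⊎ᵐ-∅ˡ ⊎ᵐ-∅ˡ) (senv-singleᶜ (sng-single _≟_ k (recvT p))))
    (single-⊎⇒, (senv-⊎ ⊎ᵐ-∅ˡ ⊎ᵐ-∅ˡ (⊎ᵐ-comm d₂) ⊎ᵐ-∅ˡ) (senv-singleᴰ (sng-single _≟_ k (sendT p))))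
    (νc-typed (suc k) ps refl ms ch₁ d₁ t)

ν̃-typed : ∀ {Γ : SharedEnv target} {A A₁ A₂ C D Z P} s i {Ms} → All Minimal Ms →
          A₁ ≐ A ⊎ᵐ column _≟ⁿ_ (se s pos) (seg i Ms) → A₂ ≐ A₁ ⊎ᵐ column _≟ⁿ_ (se s neg) (seg i (map dual Ms)) →
          Γ ⨾ ∅ ⨾ senv A₂ C D Z ⊢ P → Γ ⨾ ∅ ⨾ senv A C D Z ⊢ ν̃ s i Ms P
ν̃-typed s i [] a b t =
  session-ext (senv-≗ᴬ (λ j → sym (trans (⊎ᵐ-Emptyʳ a (column-∅ _≟ⁿ_ (se s pos)) j)
    (⊎ᵐ-Emptyʳ b (column-∅ _≟ⁿ_ (se s neg)) j)))) t
ν̃-typed s i {M ∷ Ms} (m ∷ ms) a b t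
  with ⊎ᵐ-assocˡ a (column-⊎ _≟ⁿ_ (se s pos) (seg-cons-⊎ (λ x → x) {xs = Ms} refl))
... | X , a₁ , a₂
  with ⊎ᵐ-interchange b a₁ (column-⊎ _≟ⁿ_ (se s neg) (seg-cons-⊎ (λ x → x) {xs = map dual Ms} refl))
... | Y , R , b₁ , b₂ , b₃ with ⊎ᵐ-assocˡ b₁ b₃
... | A₁′ , b₄ , b₅ =
  ResS refl ≈-refl (ok m) (ok (Minimal-dual m))
    (single-⊎⇒, (senv-⊎ (⊎ᵐ-comm a₂) ⊎ᵐ-∅ˡ ⊎ᵐ-∅ˡ ⊎ᵐ-∅ˡ) (senv-singleᴬ (column-single _≟ⁿ_ (se s pos) (sng-single _≟_ i M))))
    (single-⊎⇒, (senv-⊎ (⊎ᵐ-comm b₂) ⊎ᵐ-∅ˡ ⊎ᵐ-∅ˡ ⊎ᵐ-∅ˡ) (senv-singleᴬ (column-single _≟ⁿ_ (se s neg) (sng-single _≟_ i (dual M)))))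
    (ν̃-typed s (suc i) ms b₅ b₄ t)

rename : NamesEnv → SharedEnv target → SharedEnv target
rename N Γ = record { vars = vars Γ ; names = N }

-- The body only learns that `N` is unchanged off the new names and correct at them; this spares it
-- the iterated update that the restrictions build up.
νcʳ-typed : ∀ {Γ : SharedEnv target} {Δ P} rs → Unique (map proj₁ rs) → (∀ {r S} → (r , S) ∈ rs → All Minimal (ℛ⋆ S)) →
            (∀ N → (∀ w → (∀ r → r ∈ map proj₁ rs → w ≢ c^ r) → N w ≡ names Γ w) →
                   (∀ {r S} → (r , S) ∈ rs → N (c^ r) ≡ just (arr lin (map ses (ℛ⋆ S)))) →
                   rename N Γ ⨾ ∅ ⨾ Δ ⊢ P) →
            Γ ⨾ ∅ ⨾ Δ ⊢ νcʳ rs P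
νcʳ-typed {Γ} [] un ms t = t (names Γ) (λ _ _ → refl) (λ ())
νcʳ-typed {Γ} {Δ} {P} ((r , S) ∷ rs) (fresh ∷ un) ms t =
  Res {Γ′ = rename N₁ Γ} ((λ _ _ → refl) , λ w n → if-no (w ≟ᵗ (c^ r)) (λ { refl → n (here refl) }))
    (if-yes ((c^ r) ≟ᵗ (c^ r)) refl) (okᵁ (arr (AllP.map⁺ (All.map ses (ms (here refl))))))
    (νcʳ-typed rs un (λ m → ms (there m)) λ N off at-rs →
      t N (λ w n → trans (off w (λ q m → n q (there m))) (if-no (w ≟ᵗ (c^ r)) (n r (here refl))))
        λ { (here refl) → trans (off (c^ r) (λ { q m refl → All.lookup fresh m refl })) (if-yes ((c^ r) ≟ᵗ (c^ r)) refl)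
          ; (there m) → at-rs m })
  where
  N₁ : NamesEnv
  N₁ w = if does (w ≟ᵗ (c^ r)) then just (arr lin (map ses (ℛ⋆ S))) else names Γ w

-- Each server owns the complete tuple of its name, which it hands to the first request. Together
-- the servers use up exactly the recursive part of the environment.
servers-typed : ∀ {Γ : SharedEnv target} {E A A′ C D Z Q} rs → Unique (map proj₁ rs) →
                (∀ {r S} → (r , S) ∈ rs → E r ≡ just (ses S , 1) × recursive S ≡ true × WF S) →
                (∀ {r S} → (r , S) ∈ rs → names Γ (c^ r) ≡ just (arr lin (map ses (ℛ⋆ S)))) →
                (∀ {u S i} → E u ≡ just (ses S , i) → ∀ j → names Γ (u at[ j ]) ≡ nothing) →
                A′ ≐ A ⊎ᵐ live recursive E (map proj₁ rs) →
                Γ ⨾ ∅ ⨾ senv A C D Z ⊢ Q → Γ ⨾ ∅ ⨾ senv A′ C D Z ⊢ servers rs Q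
servers-typed {E = E} [] un h n ix s t =
  session-ext (senv-≗ᴬ (λ (v , j) → ⊎ᵐ-Emptyʳ s (λ (v , j) → live-∉ recursive E [] {v} j (λ ())) (v , j))) t
servers-typed {Γ} {E = E} ((r , S) ∷ rs) (fresh ∷ un) h n ix s t with h (here refl)
... | e , rc , w with ⊎ᵐ-assocʳ (⊎ᵐ-comm s) (live-cons recursive {E} (map proj₁ rs) e rc (λ m → All.lookup fresh m refl))
... | A″ , s₁ , s₂ =
  Par ⊎ᵐ-∅ˡ (senv-⊎ s₁ ⊎ᵐ-∅ˡ ⊎ᵐ-∅ˡ ⊎ᵐ-∅ˡ)
    (callback-typed (n (here refl)) (arr (AllP.map⁺ (All.map ses min))) λ vs →
      subst (λ ws → rebind vs Γ ⨾ senv (column _≟ⁿ_ r (seg 1 (𝒢 S))) ∅ ∅ ∅ ⊢ⁿˢ ws ▷ map ses (ℛ⋆ S))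
        (sym (block≡run r 1 (length (𝒢 S))))
        (run-typed {Γ = rebind vs Γ} (lift-at r) (ix e) 1 same min))
    (servers-typed rs un (λ m → h (there m)) (λ m → n (there m)) ix (⊎ᵐ-comm s₂) t)
  where
  min : All Minimal (ℛ⋆ S)
  min = subst (All Minimal) (𝒢-recursive S rc) (𝒢-minimal w)
  same : Pointwise _≈_ (𝒢 S) (ℛ⋆ S)
  same = subst (Pointwise _≈_ (𝒢 S)) (𝒢-recursive S rc) (PW.refl ≈-refl)

-- Typing the pieces of a breakdown

∪-⊎ : ∀ {K V : Set} {a b : PMap K V} → Disjoint a b → (a ∪ b) ≐ a ⊎ᵐ b
∪-⊎ {a = a} {b} d k with a k | b k | d k
... | just _  | nothing | _      = inj₁ (refl , refl)
... | nothing | _       | _      = inj₂ (refl , refl)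
... | just _  | just _  | inj₁ ()
... | just _  | just _  | inj₂ ()

recType-rec : ∀ {S} → recursive S ≡ true → recType (ses S) ≡ just S
recType-rec {S} r = cong (λ b → if b then just S else nothing) r

recType-nonrec : ∀ {S} → recursive S ≡ false → recType (ses S) ≡ nothing
recType-nonrec {S} r = cong (λ b → if b then just S else nothing) r

module _ (E : Env) (u : Nm source) (K : Proc target → Proc target) where

  -- These equations name the outcomes of the `with` in the block, so that typing proofs can
  -- transport along them without repeating its case split.
  sendBlock-plain : ∀ {V C i} → E u ≡ just (C , i) → recType C ≡ nothing →
                    sendBlock E u V K ≡ send (u at[ i ]) [ V ] tt (K 𝟎)
  sendBlock-plain e r rewrite e | r = refl

  sendBlock-rec : ∀ {V C S i} → E u ≡ just (C , i) → recType C ≡ just S → sendBlock E u V K ≡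
                  request u S 0 (send (nv (zed 0 (f S))) [ V ] tt (K (callback u (zNames 0 S))))
  sendBlock-rec e r rewrite e | r = refl

  recvBlock-plain : ∀ {y C i} → E u ≡ just (C , i) → recType C ≡ nothing →
                    recvBlock E u y K ≡ recv (u at[ i ]) [ src y ] tt (K 𝟎)
  recvBlock-plain e r rewrite e | r = refl

  recvBlock-rec : ∀ {y C S i} → E u ≡ just (C , i) → recType C ≡ just S → recvBlock E u y K ≡
                  request u S 0 (recv (nv (zed 0 (f S))) [ src y ] tt (K (callback u (zNames 0 S))))
  recvBlock-rec e r rewrite e | r = refl

module _ (E : Env) (V : Val target) (j : ℕ) (u : Nm source) (us : List (Nm source)) (ws : List (Nm target)) where

  appBlock-plain : ∀ {C i} → E u ≡ just (C , i) → recType C ≡ nothing →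
                   appBlock E V j (u ∷ us) ws ≡ appBlock E V j us (ws ++ block u i (length (𝒢ᶜ C)))
  appBlock-plain e r rewrite e | r = refl

  appBlock-rec : ∀ {C S i} → E u ≡ just (C , i) → recType C ≡ just S →
                 appBlock E V j (u ∷ us) ws ≡ request u S j (appBlock E V (suc j) us (ws ++ zNames j S))
  appBlock-rec e r rewrite e | r = refl

ℛ⋆-minimal : ∀ {S} → WF S → recursive S ≡ true → All Minimal (ℛ⋆ S)
ℛ⋆-minimal {S} w r = subst (All Minimal) (𝒢-recursive S r) (𝒢-minimal w)

arr-minimal : ∀ {Ms} → All Minimal Ms → Minimalᵁ (arr lin (map ses Ms))
arr-minimal ms = arr (AllP.map⁺ (All.map ses ms))

loop-minimal : ∀ pre {d Us post} → All Minimal (pre ++ loop d Us ∷ post) → Minimal (loop d Us)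
loop-minimal pre ms with AllP.++⁻ʳ pre ms
... | m ∷ _ = m

unfold-loop : ∀ d {Us} → act d Us (loop d Us) ≈ loop d Us
unfold-loop pos = ≈-sym unfold
unfold-loop neg = ≈-sym unfold

seg-update : ∀ {X : Set} i pre {x y : X} {post} →
             seg i (pre ++ y ∷ post) ≐ seg i (pre ++ x ∷ post) [ i + length pre ∶ x ⇒ y ]
seg-update i [] {x} {y} {post} rewrite +-identityʳ i =
  if-yes (i ≟ i) refl , if-yes (i ≟ i) refl , λ j ne → trans (if-no (j ≟ i) ne) (sym (if-no (j ≟ i) ne))
seg-update i (z ∷ pre) {x} {y} {post} with seg-update (suc i) pre {x} {y} {post}
... | p , q , r rewrite +-suc i (length pre) =
  trans (if-no (suc (i + length pre) ≟ i) ne) p , trans (if-no (suc (i + length pre) ≟ i) ne) q ,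
  λ j n → by-cases (j ≟ i) (λ e → trans (if-yes (j ≟ i) e) (sym (if-yes (j ≟ i) e)))
            (λ e → trans (if-no (j ≟ i) e) (trans (r j n) (sym (if-no (j ≟ i) e))))
  where
  ne : suc (i + length pre) ≢ i
  ne e = <-irrefl (sym e) (m<n i)
    where
    m<n : ∀ i → i < suc (i + length pre)
    m<n zero    = s≤s z≤n
    m<n (suc i) = s≤s (m<n i)

column-update : ∀ j {m m₀ i x y} → m ≐ m₀ [ i ∶ x ⇒ y ] → column _≟_ j m ≐ column _≟_ j m₀ [ (j , i) ∶ x ⇒ y ]
column-update j {m} {m₀} {i} (p , q , r) =
  trans (if-yes (j ≟ j) refl) p , trans (if-yes (j ≟ j) refl) q , off
  where
  off : ∀ k → k ≢ (j , i) → column _≟_ j m k ≡ column _≟_ j m₀ k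
  off (j′ , i′) ne = by-cases (j′ ≟ j)
    (λ { refl → trans (if-yes (j′ ≟ j′) refl) (trans (r i′ λ { refl → ne refl }) (sym (if-yes (j′ ≟ j′) refl))) })
    (λ e → trans (if-no (j′ ≟ j) e) (sym (if-no (j′ ≟ j) e)))

senv-update : ∀ {A C D Z Z₀ j i x y} → Z ≐ Z₀ [ (j , i) ∶ x ⇒ y ] →
              senv A C D Z ≐ senv A C D Z₀ [ nv (zed j i) ∶ x ⇒ y ]
senv-update {A} {C} {D} {Z} {Z₀} {j} {i} (p , q , r) = p , q , off
  where
  off : ∀ w → w ≢ nv (zed j i) → senv A C D Z w ≡ senv A C D Z₀ w
  off w ne with kind w in eq
  ... | idx _ _ = refl
  ... | cₚ _    = refl
  ... | c̄ₚ _   = refl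
  ... | zₚ k l  = r (k , l) λ { refl → ne (kind-z w eq) }
  ... | other   = refl

-- The type of the f(S)-th z is unfolded once, so that Send and Rcv apply to it without a Conv.
record Opened (d : Pol) (S : SType) (Us : List HType) : Set where
  field
    before behind : List SType
    list   : ℛ⋆ S ≡ before ++ loop d Us ∷ behind
    index  : f S ≡ suc (length before)

  opened : List SType
  opened = before ++ act d Us (loop d Us) ∷ behind

  opened-≈ : Pointwise _≈_ opened (ℛ⋆ S)
  opened-≈ = subst (Pointwise _≈_ opened) (sym list)
    (PW.++⁺ (PW.refl ≈-refl) (unfold-loop d ∷ PW.refl ≈-refl))

  opened-update : column _≟_ 0 (seg 1 opened) ≐ column _≟_ 0 (seg 1 (ℛ⋆ S)) [ (0 , f S) ∶ loop d Us ⇒ act d Us (loop d Us) ]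
  opened-update rewrite list | index = column-update 0 (seg-update 1 before)

open-loop : ∀ d {S Us} → Tr S → unf S ≡ act d Us (cont S) → Opened d S (𝒢ᵁˢ Us)
open-loop d t e with ℛ⋆-at-f d t e
... | pre , post , p , q = record { before = pre ; behind = post ; list = p ; index = q }

opened-ok : ∀ d {S Us} → Opened d S Us → All Minimal (ℛ⋆ S) → Ok target (act d Us (loop d Us))
opened-ok d o ms = _ , unfold-loop d , loop-minimal (Opened.before o) (subst (All Minimal) (Opened.list o) ms)

-- Once the action is done the opened loop is folded again, so the whole tuple has type `ℛ⋆ S` and
-- can be passed to the next request on the same `c^ u`.
callback-z-typed : ∀ {Γ : SharedEnv target} {E us u S i} → Fits (names Γ) E us → u ∈ us → E u ≡ just (ses S , i) →
                   WF S → recursive S ≡ true →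
                   Γ ⨾ ∅ ⨾ senv ∅ ∅ ∅ (column _≟_ 0 (seg 1 (ℛ⋆ S))) ⊢ callback u (zNames 0 S)
callback-z-typed {Γ} {S = S} F m e w r =
  callback-typed (server F m e r) (arr-minimal (ℛ⋆-minimal w r)) λ vs →
    subst (λ ws → rebind vs Γ ⨾ senv ∅ ∅ ∅ (column _≟_ 0 (seg 1 (ℛ⋆ S))) ⊢ⁿˢ ws ▷ map ses (ℛ⋆ S)) (sym (zNames≡run 0 S))
      (run-typed {Γ = rebind vs Γ} (lift-zed 0) (variable-z F 0) 1 (PW.refl ≈-refl) (ℛ⋆-minimal w r))

module _ {Γ : SharedEnv target} {E : Env} {us : List (Nm source)} (F : Fits (names Γ) E us)
         {u : Nm source} {V : Val target} {K : Proc target → Proc target} {U : HType} {Av : AMap} {Cv Dv Dk D : CMap}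
         (a : Agrees V (𝒢ᵁ U)) (tv : Γ ⨾ ∅ ⨾ senv Av Cv Dv ∅ ⊢ᵛ V ▷ 𝒢ᵁ U) (d : D ≐ Dv ⊎ᵐ Dk)
         -- `Z` is arbitrary because `K` wraps either `𝟎`, which owns nothing, or the callback,
         -- which owns the borrowed tuple.
         (hK : ∀ {Z Q} → Γ ⨾ ∅ ⨾ senv ∅ ∅ ∅ Z ⊢ Q → Γ ⨾ ∅ ⨾ senv ∅ ∅ Dk Z ⊢ K Q) where

  private
    nil : Γ ⨾ ∅ ⨾ senv ∅ ∅ ∅ ∅ ⊢ 𝟎
    nil = Nil (λ _ → refl) senv-∅

    parts : ∀ {Z} → senv Av Cv D Z ≐ senv ∅ ∅ Dk Z ⊎ᵐ senv Av Cv Dv ∅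
    parts = senv-⊎ ⊎ᵐ-∅ˡ ⊎ᵐ-∅ˡ (⊎ᵐ-comm d) ⊎ᵐ-∅ʳ

  sendBlock-typed : ∀ {A S i} → E u ≡ just (ses S , i) → WF S → recursive S ≡ false → unf S ≡ !⟨ [ U ] ⟩⨾ cont S →
                    A ≐ column _≟ⁿ_ u (seg i [ !⟨ [ 𝒢ᵁ U ] ⟩⨾ end ]) ⊎ᵐ Av →
                    Γ ⨾ ∅ ⨾ senv A Cv D ∅ ⊢ sendBlock E u V K
  sendBlock-typed {i = i} e w r st s =
    subst (Γ ⨾ ∅ ⨾ _ ⊢_) (sym (sendBlock-plain E u K e (recType-nonrec r)))
      (send-end (session-index F e i) (one-value a tv) (ok payload-ok) (senv-⊎ s ⊎ᵐ-∅ˡ ⊎ᵐ-∅ˡ ⊎ᵐ-∅ˡ)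
        (senv-singleᴬ (column-single _≟ⁿ_ u (seg-single (λ x → x) i _))) parts (hK nil))
    where
    payload-ok : Minimal (!⟨ [ 𝒢ᵁ U ] ⟩⨾ end)
    payload-ok with proj₁ (WF-step pos w st)
    ... | wU ∷ [] = !⨾ (𝒢ᵁ-minimal wU ∷ [])

  sendBlock-rec-typed : ∀ {S i} → u ∈ us → E u ≡ just (ses S , i) → WF S → recursive S ≡ true →
                        unf S ≡ !⟨ [ U ] ⟩⨾ cont S → Γ ⨾ ∅ ⨾ senv Av Cv D ∅ ⊢ sendBlock E u V K
  sendBlock-rec-typed {S} m e w r st =
    subst (Γ ⨾ ∅ ⨾ _ ⊢_) (sym (sendBlock-rec E u K e (recType-rec r)))
      (request-typed {S = S} (server F m e r) (variable-z F) (ℛ⋆-minimal w r) (Opened.opened-≈ o)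
        (senv-⊎ ⊎ᵐ-∅ʳ ⊎ᵐ-∅ʳ ⊎ᵐ-∅ʳ ⊎ᵐ-∅ˡ)
        (Send ⊎ᵐ-∅ˡ parts (hK (callback-z-typed F m e w r)) (one-value a tv)
          (senv-update (Opened.opened-update o)) (opened-ok pos o (ℛ⋆-minimal w r))))
    where
    o = open-loop pos (WF-Tr w r) st

  sendBlock-req-typed : E u ≡ just (⟨ U ⟩ , 1) → WFᵁ U → Γ ⨾ ∅ ⨾ senv Av Cv D ∅ ⊢ sendBlock E u V K
  sendBlock-req-typed e w =
    subst (Γ ⨾ ∅ ⨾ _ ⊢_) (sym (sendBlock-plain E u K e refl))
      (Req parts (Sh (trans (indexed F u 1) (cong (λ t → sharedAt t 1) e)) (λ _ → refl) (okᵁ (𝒢ᵁ-minimal w)))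
        (hK nil) a tv)

module _ {Γ : SharedEnv target} {E : Env} {us : List (Nm source)} (F : Fits (names Γ) E us)
         {u : Nm source} {y : ℕ} {K : Proc target → Proc target} {m : Mode} {Cs Ds : List CType}
         {Dk : CMap} {X : VEnv} {ys xs : List ℕ}
         (q : Pointwise _≈ᶜ_ Cs Ds) (h : Holds Γ X xs) (sub : ∀ {x} → x ∈ ys → x ≢ y → x ∈ xs)
         -- The received `y` is already in Γ when the next propagator sends, since it may be among
         -- the variables forwarded.
         (hK : ∀ vs → Holds (rebind vs Γ) (X [ y ↦ Cs ]ˣ) ys →
               ∀ {Z Q} → rebind vs Γ ⨾ ∅ ⨾ senv ∅ ∅ ∅ Z ⊢ Q → rebind vs Γ ⨾ ∅ ⨾ senv ∅ ∅ Dk Z ⊢ K Q) where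

  private
    vs : TVar → Maybe (List CType)
    vs x = if does (x ≟ᵛ src y) then just (𝒢ᶜˢ Cs) else vars Γ x

    so : SameOff [ src y ] [] Γ (rebind vs Γ)
    so = (λ x n → if-no (x ≟ᵛ src y) (λ { refl → n (here refl) })) , λ _ _ → refl

    holds : Holds (rebind vs Γ) (X [ y ↦ Cs ]ˣ) ys
    holds {x} {Es} mx e = by-cases (x ≟ y) bound free
      where
      bound : x ≡ y → vs (src x) ≡ just (𝒢ᶜˢ Es)
      bound refl with trans (sym ([↦]ˣ-at X x Cs)) e
      ... | refl = if-yes (src x ≟ᵛ src x) refl
      free : x ≢ y → vs (src x) ≡ just (𝒢ᶜˢ Es)
      free ne = trans (if-no (src x ≟ᵛ src y) (λ { refl → ne refl })) (h (sub mx ne) (trans (sym ([↦]ˣ-off X ne)) e))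

    typed : Minimalᵁ (𝒢ᵁ (arr m Ds)) → rebind vs Γ ⨾ ∅ ⨾ ∅ ⊢ᵛ var (src y) ▷ 𝒢ᵁ (arr m Ds)
    typed mn@(arr ms) = Conv (var-typed {Γ = rebind vs Γ} (if-yes (src y ≟ᵛ src y) refl)
      (okᵁ-≈ (arr-cong (𝒢ᶜˢ-cong q)) (okᵁ (arr ms))) (λ _ → refl)) (arr-cong (𝒢ᶜˢ-cong q)) (okᵁ mn)

    nil : rebind vs Γ ⨾ ∅ ⨾ senv ∅ ∅ ∅ ∅ ⊢ 𝟎
    nil = Nil (λ _ → refl) senv-∅

  recvBlock-typed : ∀ {A S i} → E u ≡ just (ses S , i) → WF S → recursive S ≡ false →
                    unf S ≡ ?⟨ [ arr m Ds ] ⟩⨾ cont S → A ≐ column _≟ⁿ_ u (seg i [ ?⟨ [ 𝒢ᵁ (arr m Ds) ] ⟩⨾ end ]) ⊎ᵐ ∅ →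
                    Γ ⨾ ∅ ⨾ senv A ∅ Dk ∅ ⊢ recvBlock E u y K
  recvBlock-typed {i = i} e w r st s with proj₁ (WF-step neg w st)
  ... | wU ∷ [] =
    subst (Γ ⨾ ∅ ⨾ _ ⊢_) (sym (recvBlock-plain E u K e (recType-nonrec r)))
      (recv-end {Γ′ = rebind vs Γ} (session-index F e i) ([] ∷ []) so (one-value tt (typed (𝒢ᵁ-minimal wU)))
        (ok (?⨾ (𝒢ᵁ-minimal wU ∷ []))) (senv-⊎ s ⊎ᵐ-∅ˡ ⊎ᵐ-∅ˡ ⊎ᵐ-∅ˡ)
        (senv-singleᴬ (column-single _≟ⁿ_ u (seg-single (λ x → x) i _))) (hK vs holds nil))

  recvBlock-rec-typed : ∀ {S i} → u ∈ us → E u ≡ just (ses S , i) → WF S → recursive S ≡ true →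
                        unf S ≡ ?⟨ [ arr m Ds ] ⟩⨾ cont S → Γ ⨾ ∅ ⨾ senv ∅ ∅ Dk ∅ ⊢ recvBlock E u y K
  recvBlock-rec-typed {S} mu e w r st with proj₁ (WF-step neg w st)
  ... | wU ∷ [] =
    subst (Γ ⨾ ∅ ⨾ _ ⊢_) (sym (recvBlock-rec E u K e (recType-rec r)))
      (request-typed {S = S} (server F mu e r) (variable-z F) (ℛ⋆-minimal w r) (Opened.opened-≈ o)
        (senv-⊎ ⊎ᵐ-∅ʳ ⊎ᵐ-∅ʳ ⊎ᵐ-∅ʳ ⊎ᵐ-∅ˡ)
        (Rcv {Γ′ = rebind vs Γ} ([] ∷ []) so (hK vs holds (callback-z-typed {Γ = rebind vs Γ} F mu e w r))
          (one-value tt (typed (𝒢ᵁ-minimal wU))) ⊎ᵐ-∅ʳ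
          (senv-update (Opened.opened-update o)) (opened-ok neg o (ℛ⋆-minimal w r))))
    where
    o = open-loop neg (WF-Tr w r) st

  recvBlock-acc-typed : E u ≡ just (⟨ arr m Ds ⟩ , 1) → WFᵁ (arr m Ds) → Γ ⨾ ∅ ⨾ senv ∅ ∅ Dk ∅ ⊢ recvBlock E u y K
  recvBlock-acc-typed e w =
    subst (Γ ⨾ ∅ ⨾ _ ⊢_) (sym (recvBlock-plain E u K e refl))
      (Acc {Γ′ = rebind vs Γ} so (Sh (trans (indexed F u 1) (cong (λ t → sharedAt t 1) e)) (λ _ → refl) (okᵁ (𝒢ᵁ-minimal w)))
        (hK vs holds nil) (typed (𝒢ᵁ-minimal w)) ⊎ᵐ-∅ʳ)

-- Bookkeeping common to inputs and outputs: `pv` belongs to the value sent and `pq` to the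
-- continuation. The block `B` owns both ends of `pv` and the sending end that triggers `Q`; the
-- other sending ends of `pq` and all its receiving ends go to `Q`.
prefix-typed : ∀ {Γ : SharedEnv target} {X k k′ k″ xs pv pq p′ ps A A₁ A₂ B Q} →
               (∀ k p → names Γ (se (prop k) p) ≡ nothing) → Unique xs → Typed X xs → pq ≡ p′ ∷ ps →
               k′ ≡ suc k → k″ ≡ k′ + length pv → A ≐ A₁ ⊎ᵐ A₂ →
               (∀ {D} → D ≐ segᵍ sendT k′ pv ⊎ᵐ sng _≟_ k″ (sendT p′) → ∀ vs → Holds (rebind vs Γ) X xs →
                  rebind vs Γ ⨾ ∅ ⨾ senv A₁ (segᵍ recvT k′ pv) D ∅ ⊢ B) →
               Γ ⨾ ∅ ⨾ senv A₂ (segᵍ recvT k″ pq) (segᵍ sendT (suc k″) (drop 1 pq)) ∅ ⊢ Q →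
               Γ ⨾ ∅ ⨾ senv A (segᵍ recvT k (payloads X xs ∷ pv ++ pq)) (segᵍ sendT (suc k) (pv ++ pq)) ∅ ⊢ cₖ k xs B ∣ Q
prefix-typed {Γ} {X} {k} {xs = xs} {pv} {p′ = p′} {ps} n un ty refl refl k″≡ a tB tQ
  with ⊎ᵐ-assocˡ (seg-cons-⊎ recvT {x = payloads X xs} {xs = pv ++ p′ ∷ ps} refl) (seg-++-⊎ recvT pv {p′ ∷ ps} k″≡)
     | ⊎ᵐ-assocˡ (seg-++-⊎ sendT pv {p′ ∷ ps} k″≡) (seg-cons-⊎ sendT {x = p′} {xs = ps} refl)
... | C₁ , ch , ch₁ | D₁ , d , d₁ =
  Par ⊎ᵐ-∅ˡ (senv-⊎ a ch d ⊎ᵐ-∅ˡ)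
    (cₖ-typed (n k pos) un ty (senv-⊎ ⊎ᵐ-∅ˡ ch₁ ⊎ᵐ-∅ˡ ⊎ᵐ-∅ˡ) (senv-singleᶜ (sng-single _≟_ k _)) (tB d₁)) tQ

next-typed : ∀ {Γ : SharedEnv target} {X k ys} → (∀ k p → names Γ (se (prop k) p) ≡ nothing) →
             names Γ (nv (zed 0 0)) ≡ nothing → Typed X ys → Holds Γ X ys →
             ∀ {A C D D′ Z Q} → D′ ≐ sng _≟_ k (sendT (payloads X ys)) ⊎ᵐ D →
             Γ ⨾ ∅ ⨾ senv A C D Z ⊢ Q → Γ ⨾ ∅ ⨾ senv A C D′ Z ⊢ c̄ₖ k ys Q
next-typed {X = X} {k} {ys} n z ty h d t =
  c̄ₖ-typed {X = X} (n k neg) z h ty (senv-⊎ ⊎ᵐ-∅ˡ ⊎ᵐ-∅ˡ d ⊎ᵐ-∅ˡ) (senv-singleᴰ (sng-single _≟_ k _)) t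

-- Induction along the arguments, with `ws : Cw` as accumulator, owned by `Aw` and `Z`. The tuples
-- in `Z` were bound at levels below `j`, so the one requested at level `j` is fresh.
appBlock-typed : ∀ {Γ : SharedEnv target} {E us₀} → Fits (names Γ) E us₀ →
                 ∀ {V m A Av Ar Aw C D Z Cw us Ds ws} j → (∀ {u} → u ∈ us → u ∈ us₀) → Args E us Ds →
                 Agrees V (arr m (Cw ++ 𝒢ᶜˢ Ds)) → Γ ⨾ ∅ ⨾ senv Av C D ∅ ⊢ᵛ V ▷ arr m (Cw ++ 𝒢ᶜˢ Ds) →
                 Γ ⨾ senv Aw ∅ ∅ Z ⊢ⁿˢ ws ▷ Cw → (∀ i k → j ≤ i → Z (i , k) ≡ nothing) →
                 A ≐ Av ⊎ᵐ Ar → Ar ≐ Aw ⊎ᵐ live nonrec E us → Γ ⨾ ∅ ⨾ senv A C D Z ⊢ appBlock E V j us ws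
appBlock-typed {Γ} {E} F {V} {m} {Cw = Cw} j mem [] a tv tw z s s′ =
  App (senv-⊎ s ⊎ᵐ-∅ʳ ⊎ᵐ-∅ʳ ⊎ᵐ-∅ˡ) (subst (λ Cs → Agrees V (arr m Cs)) (++-identityʳ Cw) a)
    (subst (λ Cs → Γ ⨾ ∅ ⨾ _ ⊢ᵛ V ▷ arr m Cs) (++-identityʳ Cw) tv)
    (names-ext (senv-≗ᴬ (⊎ᵐ-Emptyʳ s′ (λ (v , j) → live-∉ nonrec E [] {v} j (λ ())))) tw)
appBlock-typed {Γ} {E} F {V} {m} {A} {C = C} {D} {Z} {Cw} {ws = ws} j mem (⟨⟩ {u} {us} {U} {W} {Ds} e w q as) a tv tw z s s′ =
  subst (Γ ⨾ ∅ ⨾ senv A C D Z ⊢_) (sym (appBlock-plain E V j u us ws e refl))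
    (appBlock-typed F j (λ x → mem (there x)) as
      (subst (λ Cs → Agrees V (arr m Cs)) (sym (++-assoc Cw _ _)) a)
      (subst (λ Cs → Γ ⨾ ∅ ⨾ _ ⊢ᵛ V ▷ arr m Cs) (sym (++-assoc Cw _ _)) tv)
      (names-++ (senv-⊎ ⊎ᵐ-∅ʳ ⊎ᵐ-∅ʳ ⊎ᵐ-∅ʳ ⊎ᵐ-∅ʳ) tw
        (subst (λ us → Γ ⨾ senv ∅ ∅ ∅ ∅ ⊢ⁿˢ us ▷ [ ⟨ 𝒢ᵁ W ⟩ ]) (sym (block≡run u 1 1))
          (cons (λ _ → inj₁ (refl , refl))
            (Conv (Sh (trans (indexed F u 1) (cong (λ t → sharedAt t 1) e)) senv-∅ (okᵁ (𝒢ᵁ-minimal w)))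
              (⟨⟩-cong (𝒢ᵁ-cong q)) (okᵁ-≈ (≈ᵁ-sym (𝒢ᵁ-cong q)) (okᵁ (𝒢ᵁ-minimal w)))) ([] (λ _ → refl)))))
      z s (⊎ᵐ-resp (λ _ → refl) (λ _ → refl) (live-shared nonrec {E} us e) s′))
appBlock-typed {Γ} {E} F {V} {m} {A} {Aw = Aw} {C} {D} {Z} {Cw} {ws = ws} j mem
               (ses {u} {us} {S} {i} {T} {Ds} e w wT q n as) a tv tw z s s′ =
  go (recursive S) refl
  where
  a′ = subst (λ Cs → Agrees V (arr m Cs)) (sym (++-assoc Cw _ _)) a
  tv′ = subst (λ Cs → Γ ⨾ ∅ ⨾ _ ⊢ᵛ V ▷ arr m Cs) (sym (++-assoc Cw _ _)) tv
  min : All Minimal (𝒢 T)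
  min = 𝒢-minimal wT
  go : ∀ b → recursive S ≡ b → Γ ⨾ ∅ ⨾ senv A C D Z ⊢ appBlock E V j (u ∷ us) ws
  go false r with ⊎ᵐ-assocˡ s′ (live-cons nonrec {E} us e (cong not r) n)
  ... | Aw′ , s₁ , s₂ =
    subst (Γ ⨾ ∅ ⨾ senv A C D Z ⊢_) (sym (appBlock-plain E V j u us ws e (recType-nonrec r)))
      (appBlock-typed F j (λ x → mem (there x)) as a′ tv′
        (names-++ (senv-⊎ s₂ ⊎ᵐ-∅ʳ ⊎ᵐ-∅ʳ ⊎ᵐ-∅ʳ) tw
          (subst (λ us → Γ ⨾ senv (column _≟ⁿ_ u (seg i (𝒢 S))) ∅ ∅ ∅ ⊢ⁿˢ us ▷ map ses (𝒢 T))
            (sym (trans (block≡run u i _) (cong (run (u at[_]) i) (length-map CType.ses (𝒢 S)))))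
            (run-typed (lift-at u) (session-index F e) i (𝒢-cong q) min)))
        z s s₁)
  go true r =
    subst (Γ ⨾ ∅ ⨾ senv A C D Z ⊢_) (sym (appBlock-rec E V j u us ws e (recType-rec r)))
      (request-typed {S = S} (server F (mem (here refl)) e r) (variable-z F) (ℛ⋆-minimal w r) (PW.refl ≈-refl)
        (senv-⊎ ⊎ᵐ-∅ʳ ⊎ᵐ-∅ʳ ⊎ᵐ-∅ʳ zs)
        (appBlock-typed F (suc j) (λ x → mem (there x)) as a′ tv′
          (names-++ (senv-⊎ ⊎ᵐ-∅ʳ ⊎ᵐ-∅ʳ ⊎ᵐ-∅ʳ zs) tw
            (subst (λ us → Γ ⨾ senv ∅ ∅ ∅ (column _≟_ j (seg 1 (ℛ⋆ S))) ⊢ⁿˢ us ▷ map ses (𝒢 T)) (sym (zNames≡run j S))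
              (run-typed (lift-zed j) (variable-z F j) 1
                (subst (λ Ms → Pointwise _≈_ Ms (𝒢 T)) (𝒢-recursive S r) (𝒢-cong q)) min)))
          z′ s (⊎ᵐ-resp (λ _ → refl) (λ _ → refl) (live-rec {E} us e r) s′)))
    where
    Z′ : ZMap
    Z′ = Z ∪ column _≟_ j (seg 1 (ℛ⋆ S))
    zs : Z′ ≐ Z ⊎ᵐ column _≟_ j (seg 1 (ℛ⋆ S))
    zs = ∪-⊎ λ (i , k) → by-cases (i ≟ j) (λ { refl → inj₁ (z i k ≤-refl) }) (λ ne → inj₂ (if-no (i ≟ j) ne))
    z′ : ∀ i k → suc j ≤ i → Z′ (i , k) ≡ nothing
    z′ i k j<i rewrite z i k (<⇒≤ j<i) = if-no (i ≟ j) λ { refl → <-irrefl refl j<i }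

-- Variables and messages of the propagators

dedup⁺ : ∀ {xs x} → x ∈ xs → x ∈ deduplicate _≟_ xs
dedup⁺ = ∈-deduplicate⁺ _≟_

dedup⁻ : ∀ xs {x} → x ∈ deduplicate _≟_ xs → x ∈ xs
dedup⁻ = ∈-deduplicate⁻ _≟_

dedup-⊆ : ∀ xs {ys} → (∀ {x} → x ∈ xs → x ∈ ys) → ∀ {x} → x ∈ deduplicate _≟_ xs → x ∈ deduplicate _≟_ ys
dedup-⊆ xs h m = dedup⁺ (h (dedup⁻ xs m))

fv-unique : ∀ xs → Unique (deduplicate _≟_ xs)
fv-unique = UniqueDec.deduplicate-! _≟_

mutual
  occ-typed : ∀ {E X P} → WT E X P → Typed X (occ P)
  occ-typed ((_∣_ {P} t t′) ap) m = [ occ-typed t , occ-typed t′ ]′ (∈-++⁻ (occ P) m)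
  occ-typed (app a t as ap) m = occᵛ-typed t m
  occ-typed (send {V = V} _ _ _ _ t t′ _ _) m = [ occᵛ-typed t , occ-typed t′ ]′ (∈-++⁻ (occᵛ V) m)
  occ-typed (req {V = V} _ _ _ t t′ _) m = [ occᵛ-typed t , occ-typed t′ ]′ (∈-++⁻ (occᵛ V) m)
  occ-typed {X = X} (recv {x = x} {P = P} _ _ _ _ t _) m = unbind X P (occ-typed t) m
  occ-typed {X = X} (acc {x = x} {P = P} _ _ _ t) m = unbind X P (occ-typed t) m
  occ-typed (νₛ _ _ _ _ _ t) m = occ-typed t m
  occ-typed (νₐ _ t) m = occ-typed t m

  unbind : ∀ X {x Cs} P → Typed (X [ x ↦ Cs ]ˣ) (occ P) →
           ∀ {y} → y ∈ filter (λ y → ¬? (y ≟ x)) (occ P) → ∃[ Ds ] X y ≡ just Ds × All WFᶜ Ds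
  unbind X {x} P h m with ∈-filter⁻ (λ y → ¬? (y ≟ x)) {xs = occ P} m
  ... | m′ , ne with h m′
  ...   | Ds , e , w = Ds , trans (sym ([↦]ˣ-off X ne)) e , w

  occᵛ-typed : ∀ {E X V U} → WTᵛ E X V U → Typed X (occᵛ V)
  occᵛ-typed (var e w _) (here refl) = _ , e , w
  occᵛ-typed (ƛ _ _ _ _ t _) m = occ-typed t m

fv-typed : ∀ {E X P} → WT E X P → Typed X (fv P)
fv-typed {P = P} t m = occ-typed t (dedup⁻ (occ P) m)

-- The types of the messages on the propagators of a breakdown, by increasing index.
mutual
  paysᵛ : ∀ {E X V U} → WTᵛ E X V U → List (List HType)
  paysᵛ (var _ _ _)                   = []
  paysᵛ (ƛ {m = lin} _ _ _ _ t _) = pays t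
  paysᵛ (ƛ {m = shr} _ _ _ _ t _) = []

  pays : ∀ {E X P} → WT E X P → List (List HType)
  pays {X = X} 𝟎 = [ payloads X [] ]
  pays {X = X} {P} ((t ∣ t′) _) = payloads X (fv P) ∷ pays t ++ pays t′
  pays {X = X} {P} (app _ t _ _) = payloads X (fv P) ∷ paysᵛ t
  pays {X = X} {P} (send _ _ _ _ t t′ _ _) = payloads X (fv P) ∷ paysᵛ t ++ pays t′
  pays {X = X} {P} (req _ _ _ t t′ _) = payloads X (fv P) ∷ paysᵛ t ++ pays t′
  pays {X = X} {P} (recv _ _ _ _ t _) = payloads X (fv P) ∷ pays t
  pays {X = X} {P} (acc _ _ _ t) = payloads X (fv P) ∷ pays t
  pays (νₛ _ _ _ _ _ t) = pays t
  pays (νₐ _ t) = pays t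

-- Restrictions use up no propagator, so every breakdown starts by waiting on `c k` for the free
-- variables of its process.
pays-head : ∀ {E X P} (t : WT E X P) → pays t ≡ payloads X (fv P) ∷ drop 1 (pays t)
pays-head 𝟎 = refl
pays-head ((t ∣ t′) _) = refl
pays-head (app _ t _ _) = refl
pays-head (send _ _ _ _ t t′ _ _) = refl
pays-head (req _ _ _ t t′ _) = refl
pays-head (recv _ _ _ _ t _) = refl
pays-head (acc _ _ _ t) = refl
pays-head (νₛ _ _ _ _ _ t) = pays-head t
pays-head (νₐ _ t) = pays-head t

mutual
  pays-length : ∀ {E X P} (t : WT E X P) → length (pays t) ≡ ∣ P ∣ᵖ
  pays-length 𝟎 = refl
  pays-length ((t ∣ t′) _) = count (pays t) (pays-length t) (pays-length t′)
  pays-length (app _ t _ _) = trans (cong suc (paysᵛ-length t)) (+-comm 1 _)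
  pays-length (send _ _ _ _ t t′ _ _) = count (paysᵛ t) (paysᵛ-length t) (pays-length t′)
  pays-length (req _ _ _ t t′ _) = count (paysᵛ t) (paysᵛ-length t) (pays-length t′)
  pays-length (recv _ _ _ _ t _) = trans (cong suc (pays-length t)) (+-comm 1 _)
  pays-length (acc _ _ _ t) = trans (cong suc (pays-length t)) (+-comm 1 _)
  pays-length (νₛ _ _ _ _ _ t) = pays-length t
  pays-length (νₐ _ t) = pays-length t

  count : ∀ (ps : List (List HType)) {qs m n} → length ps ≡ m → length qs ≡ n → suc (length (ps ++ qs)) ≡ m + n + 1
  count ps refl refl = trans (cong suc (length-++ ps)) (+-comm 1 _)

  paysᵛ-length : ∀ {E X V U} (t : WTᵛ E X V U) → length (paysᵛ t) ≡ ∣ V ∣ᵛ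
  paysᵛ-length (var _ _ _)                   = refl
  paysᵛ-length (ƛ {m = lin} _ _ _ _ t _) = pays-length t
  paysᵛ-length (ƛ {m = shr} _ _ _ _ t _) = refl

mutual
  pays-minimal : ∀ {E X P} (t : WT E X P) → All (All Minimalᵁ) (pays t)
  pays-minimal {X = X} 𝟎 = payloads-minimal {X} [] (λ ()) ∷ []
  pays-minimal {P = P} T@((t ∣ t′) _) = payloads-minimal (fv P) (fv-typed T) ∷ AllP.++⁺ (pays-minimal t) (pays-minimal t′)
  pays-minimal {P = P} T@(app _ t _ _) = payloads-minimal (fv P) (fv-typed T) ∷ paysᵛ-minimal t
  pays-minimal {P = P} T@(send _ _ _ _ t t′ _ _) =
    payloads-minimal (fv P) (fv-typed T) ∷ AllP.++⁺ (paysᵛ-minimal t) (pays-minimal t′)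
  pays-minimal {P = P} T@(req _ _ _ t t′ _) =
    payloads-minimal (fv P) (fv-typed T) ∷ AllP.++⁺ (paysᵛ-minimal t) (pays-minimal t′)
  pays-minimal {P = P} T@(recv _ _ _ _ t _) = payloads-minimal (fv P) (fv-typed T) ∷ pays-minimal t
  pays-minimal {P = P} T@(acc _ _ _ t) = payloads-minimal (fv P) (fv-typed T) ∷ pays-minimal t
  pays-minimal (νₛ _ _ _ _ _ t) = pays-minimal t
  pays-minimal (νₐ _ t) = pays-minimal t

  paysᵛ-minimal : ∀ {E X V U} (t : WTᵛ E X V U) → All (All Minimalᵁ) (paysᵛ t)
  paysᵛ-minimal (var _ _ _)                   = []
  paysᵛ-minimal (ƛ {m = lin} _ _ _ _ t _) = pays-minimal t
  paysᵛ-minimal (ƛ {m = shr} _ _ _ _ t _) = []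

-- Parameters of decomposed abstractions

𝒢params : List (ℕ × CType) → List (TAtom × CType)
𝒢params = concatMap (λ (y , C) → params (y at_) 1 (𝒢ᶜ C))

𝒢names : List (ℕ × CType) → List (Nm target)
𝒢names []              = []
𝒢names ((y , C) ∷ yCs) = run (λ i → nv (y at i)) 1 (length (𝒢ᶜ C)) ++ 𝒢names yCs

𝒢params-names : ∀ yCs → map nv (map proj₁ (𝒢params yCs)) ≡ 𝒢names yCs
𝒢params-names []              = refl
𝒢params-names ((y , C) ∷ yCs) =
  trans (cong (map nv) (map-++ proj₁ (params (y at_) 1 (𝒢ᶜ C)) (𝒢params yCs)))
    (trans (map-++ nv (map proj₁ (params (y at_) 1 (𝒢ᶜ C))) (map proj₁ (𝒢params yCs)))
      (cong₂ _++_ (params-names (y at_) 1 (𝒢ᶜ C)) (𝒢params-names yCs)))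

𝒢params-types : ∀ yCs → map proj₂ (𝒢params yCs) ≡ 𝒢ᶜˢ (map proj₂ yCs)
𝒢params-types []              = refl
𝒢params-types ((y , C) ∷ yCs) =
  trans (map-++ proj₂ (params (y at_) 1 (𝒢ᶜ C)) (𝒢params yCs))
    (cong₂ _++_ (params-types (y at_) 1 (𝒢ᶜ C)) (𝒢params-types yCs))

∈-𝒢names : ∀ yCs {w} → w ∈ 𝒢names yCs → ∃[ y ] ∃[ i ] w ≡ nv (y at i) × nv y ∈ map nv (map proj₁ yCs)
∈-𝒢names ((y , C) ∷ yCs) m with ∈-++⁻ (run (λ i → nv (y at i)) 1 (length (𝒢ᶜ C))) m
... | inj₁ m′ with ∈-run (λ i → nv (y at i)) 1 (length (𝒢ᶜ C)) m′
...   | i , _ , e = y , i , e , here refl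
∈-𝒢names ((y , C) ∷ yCs) m | inj₂ m′ with ∈-𝒢names yCs m′
... | y′ , i , e , m″ = y′ , i , e , there m″

𝒢ᶜ-nonempty : ∀ {C} → WFᶜ C → ∃[ n ] length (𝒢ᶜ C) ≡ suc n
𝒢ᶜ-nonempty {ses S} (ses w) with 𝒢-nonempty w
... | M , Ms , e = _ , trans (length-map ses (𝒢 S)) (cong length e)
𝒢ᶜ-nonempty ⟨ w ⟩ = _ , refl

first-𝒢name : ∀ yCs {y} → All WFᶜ (map proj₂ yCs) → nv y ∈ map nv (map proj₁ yCs) → nv (y at 1) ∈ 𝒢names yCs
first-𝒢name ((y , C) ∷ yCs) (w ∷ ws) (here refl) with length (𝒢ᶜ C) | 𝒢ᶜ-nonempty w
... | _ | n , refl = here refl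
first-𝒢name ((y , C) ∷ yCs) (w ∷ ws) (there m) = ∈-++⁺ʳ (run _ 1 (length (𝒢ᶜ C))) (first-𝒢name yCs ws m)

𝒢names-unique : ∀ yCs → Unique (map nv (map proj₁ yCs)) → Unique (𝒢names yCs)
𝒢names-unique []              un           = []
𝒢names-unique ((y , C) ∷ yCs) (fresh ∷ un) =
  UniqueP.++⁺ (run-unique (λ { refl → refl }) 1 (length (𝒢ᶜ C))) (𝒢names-unique yCs un) λ (m , m′) → disjoint m m′
  where
  disjoint : ∀ {w} → w ∈ run (λ i → nv (y at i)) 1 (length (𝒢ᶜ C)) → w ∈ 𝒢names yCs → ⊥
  disjoint m m′ with ∈-run (λ i → nv (y at i)) 1 (length (𝒢ᶜ C)) m | ∈-𝒢names yCs m′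
  ... | i , _ , refl | _ , _ , refl , m″ = All.lookup fresh m″ refl

𝒢names-typed : ∀ {Γ : SharedEnv target} {E} yCs → Unique (map nv (map proj₁ yCs)) → All WFᶜ (map proj₂ yCs) →
               (∀ {y C} → (y , C) ∈ yCs → E (nv y) ≡ just (C , 1)) → (∀ u i → names Γ (u at[ i ]) ≡ sharedAt (E u) i) →
               Γ ⨾ senv (live allTypes E (map nv (map proj₁ yCs))) ∅ ∅ ∅ ⊢ⁿˢ 𝒢names yCs ▷ 𝒢ᶜˢ (map proj₂ yCs)
𝒢names-typed {E = E} [] un ws h n =
  names-ext (senv-≗ᴬ (λ (v , j) → sym (live-∉ allTypes E [] {v} j (λ ())))) ([] senv-∅)
𝒢names-typed {Γ} {E} ((y , ses S) ∷ yCs) (fresh ∷ un) (ses w ∷ ws) h n =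
  names-++ (senv-⊎ (live-cons allTypes {E} (map nv (map proj₁ yCs)) (h (here refl)) refl (λ m → All.lookup fresh m refl))
             ⊎ᵐ-∅ˡ ⊎ᵐ-∅ˡ ⊎ᵐ-∅ˡ)
    (subst (λ l → Γ ⨾ senv (column _≟ⁿ_ (nv y) (seg 1 (𝒢 S))) ∅ ∅ ∅ ⊢ⁿˢ run (λ i → nv (y at i)) 1 l ▷ map ses (𝒢 S))
      (sym (length-map CType.ses (𝒢 S)))
      (run-typed (lift-at (nv y)) (λ i → trans (n (nv y) i) (cong (λ t → sharedAt t i) (h (here refl)))) 1
        (PW.refl ≈-refl) (𝒢-minimal w)))
    (𝒢names-typed {E = E} yCs un ws (λ m → h (there m)) n)
𝒢names-typed {Γ} {E} ((y , ⟨ U ⟩) ∷ yCs) (fresh ∷ un) (⟨ w ⟩ ∷ ws) h n =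
  cons (⊎ᵐ-∅ˡ) (Sh (trans (n (nv y) 1) (cong (λ t → sharedAt t 1) (h (here refl)))) (λ _ → refl) (okᵁ (𝒢ᵁ-minimal w)))
    (names-ext (senv-≗ᴬ (λ k → sym (live-shared allTypes {E} (map nv (map proj₁ yCs)) (h (here refl)) k)))
      (𝒢names-typed {E = E} yCs un ws (λ m → h (there m)) n))

∈-recParams : ∀ yCs {r S} → (r , S) ∈ recParams yCs → ∃[ y ] r ≡ nv y × (y , ses S) ∈ yCs × recursive S ≡ true
∈-recParams ((y , ses S) ∷ yCs) m with recursive S in eq
∈-recParams ((y , ses S) ∷ yCs) (here refl) | true = y , refl , here refl , eq
∈-recParams ((y , ses S) ∷ yCs) (there m)   | true with ∈-recParams yCs m
... | y′ , e , m′ , r = y′ , e , there m′ , r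
∈-recParams ((y , ses S) ∷ yCs) m | false with ∈-recParams yCs m
... | y′ , e , m′ , r = y′ , e , there m′ , r
∈-recParams ((y , ⟨ _ ⟩) ∷ yCs) m with ∈-recParams yCs m
... | y′ , e , m′ , r = y′ , e , there m′ , r

recParams-∈ : ∀ yCs {y S} → (y , ses S) ∈ yCs → recursive S ≡ true → (nv y , S) ∈ recParams yCs
recParams-∈ ((y , ses S) ∷ yCs) (here refl) r with recursive S
recParams-∈ ((y , ses S) ∷ yCs) (here refl) refl | true = here refl
recParams-∈ ((y , ses S) ∷ yCs) (there m) r with recursive S
... | true  = there (recParams-∈ yCs m r)
... | false = recParams-∈ yCs m r
recParams-∈ ((y , ⟨ _ ⟩) ∷ yCs) (there m) r = recParams-∈ yCs m r

recParams-⊆ : ∀ yCs {r} → r ∈ map proj₁ (recParams yCs) → r ∈ map nv (map proj₁ yCs)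
recParams-⊆ yCs m with ∈-map⁻ proj₁ m
... | (_ , S) , m′ , refl with ∈-recParams yCs m′
...   | y , refl , m″ , _ = params-∈ m″

recParams-unique : ∀ yCs → Unique (map nv (map proj₁ yCs)) → Unique (map proj₁ (recParams yCs))
recParams-unique [] un = []
recParams-unique ((y , ses S) ∷ yCs) (fresh ∷ un) with recursive S
... | true  = All.tabulate (λ m e → All.lookup fresh (recParams-⊆ yCs m) e) ∷ recParams-unique yCs un
... | false = recParams-unique yCs un
recParams-unique ((y , ⟨ _ ⟩) ∷ yCs) (fresh ∷ un) = recParams-unique yCs un

live-⇔ᵖ : ∀ p {E us ws} → (∀ {u S i} → E u ≡ just (ses S , i) → p S ≡ true → u ∈ us → u ∈ ws) →
           (∀ {u S i} → E u ≡ just (ses S , i) → p S ≡ true → u ∈ ws → u ∈ us) → live p E us ≗ live p E ws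
live-⇔ᵖ p {E} {us} {ws} g h (u , j) = by-cases (ses? E u) (λ (S , i , e) → at-p e (p S) refl)
  (λ ns → trans (live-¬Ses p E us j ns) (sym (live-¬Ses p E ws j ns)))
  where
  at-p : ∀ {S i} → E u ≡ just (ses S , i) → ∀ b → p S ≡ b → live p E us (u , j) ≡ live p E ws (u , j)
  at-p e true  q = by-cases (u ∈? us)
    (λ m → trans (live-∈ p E us j m) (sym (live-∈ p E ws j (g e q m))))
    (λ m → trans (live-∉ p E us j m) (sym (live-∉ p E ws j (λ m′ → m (h e q m′)))))
  at-p e false q = trans (none us) (sym (none ws))
    where
    none : ∀ vs → live p E vs (u , j) ≡ nothing
    none vs = by-cases (u ∈? vs) (λ m → trans (live-∈ p E vs j m) (entry-miss p e q j)) (live-∉ p E vs j)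

nonrec-rec-disjoint : ∀ E us ws → Disjoint (live nonrec E us) (live recursive E ws)
nonrec-rec-disjoint E us ws (u , j) = by-cases (ses? E u) (λ (S , i , e) → at-S e (recursive S) refl)
  (λ ns → inj₁ (live-¬Ses nonrec E us j ns))
  where
  at-S : ∀ {S i} → E u ≡ just (ses S , i) → ∀ b → recursive S ≡ b →
         live nonrec E us (u , j) ≡ nothing ⊎ live recursive E ws (u , j) ≡ nothing
  at-S e true  r = inj₁ (by-cases (u ∈? us) (λ m → trans (live-∈ nonrec E us j m) (entry-miss nonrec e (cong not r) j))
                               (live-∉ nonrec E us j))
  at-S e false r = inj₂ (by-cases (u ∈? ws) (λ m → trans (live-∈ recursive E ws j m) (entry-miss recursive e r j))
                               (live-∉ recursive E ws j))

⊎ᵐ-unique : ∀ {K V : Set} {m m′ a b : PMap K V} → m ≐ a ⊎ᵐ b → m′ ≐ a ⊎ᵐ b → m ≗ m′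
⊎ᵐ-unique s t k with s k | t k
... | inj₁ (p , _) | inj₁ (q , _) = trans p (sym q)
... | inj₂ (_ , p) | inj₂ (_ , q) = trans p (sym q)
... | inj₁ (p , e) | inj₂ (f , q) = trans p (trans f (sym (trans q e)))
... | inj₂ (f , p) | inj₁ (q , e) = trans p (trans e (sym (trans q f)))

-- The environment of the body of a binder for bs, seen from outside and inside.
binder : ∀ {E E′ bs us ws} → (∀ u → u ∉ bs → E u ≡ E′ u) → (∀ {u} → u ∈ us → u ∉ bs) →
         (∀ {u} → u ∈ us → u ∈ ws) → (∀ {u} → u ∈ ws → u ∉ bs → u ∈ us) →
         ∃[ A ] A ≐ live nonrec E us ⊎ᵐ live allTypes E′ bs ×
                A ≐ live nonrec E′ (bs ++ ws) ⊎ᵐ live recursive E′ bs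
binder {E} {E′} {bs} {us} {ws} same off sub sup
  with ⊎ᵐ-assocʳ {m = N ∪ R} (∪-⊎ (nonrec-rec-disjoint E′ (bs ++ ws) bs)) (⊎ᵐ-comm N-split)
  where
  N = live nonrec E′ (bs ++ ws)
  R = live recursive E′ bs
  N-split : N ≐ live nonrec E′ bs ⊎ᵐ live nonrec E us
  N-split = ⊎ᵐ-resp
    (live-⇔ nonrec {E′} {bs ++ us} {bs ++ ws}
      (λ u _ m → [ ∈-++⁺ˡ , (λ m′ → ∈-++⁺ʳ bs (sub m′)) ]′ (∈-++⁻ bs m))
      (λ u _ m → [ ∈-++⁺ˡ , (λ m′ → by-cases (u ∈? bs) ∈-++⁺ˡ (λ n → ∈-++⁺ʳ bs (sup m′ n))) ]′ (∈-++⁻ bs m)))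
    (λ _ → refl) (live-cong nonrec {E′} {E} {us} (λ u m → sym (same u (off m))))
    (live-++-⊎ nonrec {E′} {bs} {us} (λ u _ m m′ → off m′ m))
... | Y , s , t = _ , ⊎ᵐ-resp (λ _ → refl) (λ _ → refl) (⊎ᵐ-unique t (live-all-⊎ {E′} {bs})) s ,
                  ∪-⊎ (nonrec-rec-disjoint E′ (bs ++ ws) bs)

at-injective : ∀ u v {i j} → u at[ i ] ≡ v at[ j ] → u ≡ v
at-injective (sh _)   (sh _)   refl = refl
at-injective (se _ _) (se _ _) refl = refl
at-injective (nv _)   (nv _)   refl = refl

at≢c^ : ∀ u {i r} → u at[ i ] ≢ c^ r
at≢c^ (sh _) ()

[_]!-off : ∀ {X : Set} (x : X) {i} → i ≢ 1 → [ x ] ! i ≡ nothing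
[ x ]!-off {zero}        ne = refl
[ x ]!-off {suc zero}    ne = ⊥-elim (ne refl)
[ x ]!-off {suc (suc i)} ne = refl

sharedAt-off : ∀ t {i} → i ≢ 1 → sharedAt t i ≡ nothing
sharedAt-off nothing            ne = refl
sharedAt-off (just (⟨ U ⟩ , _)) ne = [ 𝒢ᵁ U ]!-off ne
sharedAt-off (just (ses _ , _)) ne = refl

-- A recursive name in scope is served either by a name restricted here or by one from outside that
-- the new names do not shadow.
Fits-νcʳ : ∀ {N₁ N : NamesEnv} {E : Env} {us} (rs : List (Nm source × SType)) → (∀ u i → N₁ (u at[ i ]) ≡ sharedAt (E u) i) →
           (∀ k p → N₁ (se (prop k) p) ≡ nothing) → (∀ j i → N₁ (nv (zed j i)) ≡ nothing) →
           (∀ w → (∀ r → r ∈ map proj₁ rs → w ≢ c^ r) → N w ≡ N₁ w) →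
           (∀ {r S} → (r , S) ∈ rs → N (c^ r) ≡ just (arr lin (map ses (ℛ⋆ S)))) →
           (∀ {u S i} → u ∈ us → E u ≡ just (ses S , i) → recursive S ≡ true →
              (u , S) ∈ rs ⊎ (u ∉ map proj₁ rs × N₁ (c^ u) ≡ just (arr lin (map ses (ℛ⋆ S))))) →
           Fits N E us
Fits-νcʳ {N₁} {N} rs ix pr zd off at-rs h = record
  { indexed = λ u i → trans (off (u at[ i ]) (λ _ _ → at≢c^ u)) (ix u i)
  ; propagator = λ k p → trans (off _ (λ _ _ ())) (pr k p)
  ; variable-z = λ j i → trans (off _ (λ _ _ ())) (zd j i)
  ; server = λ {u} m e r → [ at-rs , (λ (n , e′) → trans (off (c^ u) (λ { q mq refl → n mq })) e′) ]′ (h m e r) }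

open DecMembership _≟ᵗ_ using () renaming (_∈?_ to _∈ᵗ?_)

live-[] : ∀ p E → live p E [] ≗ ∅
live-[] p E (v , j) = live-∉ p E [] {v} j (λ ())

agrees-𝒱 : ∀ {E k xs V U} → Agrees V U → Agrees (𝒱 E k xs V) (𝒢ᵁ U)
agrees-𝒱 {V = var _}   {arr _ _} a = tt
agrees-𝒱 {V = ƛ _ _ _} {arr _ _} a = a

sharedAt-unshared : ∀ E u → Unshared E u → ∀ i → sharedAt (E u) i ≡ nothing
sharedAt-unshared E u h i = go (E u) refl
  where
  go : ∀ t → E u ≡ t → sharedAt t i ≡ nothing
  go nothing            e = refl
  go (just (⟨ U ⟩ , _)) e = ⊥-elim (h e)
  go (just (ses _ , _)) e = refl

module _ {Γ : SharedEnv target} {E : Env} {X : VEnv} {yCs : List (ℕ × CType)} {P : Proc source} {k : ℕ}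
         {ps : List (List HType)} {B : Proc target}
         (un : Unique (map nv (map proj₁ yCs))) (ws : All WFᶜ (map proj₂ yCs))
         (dead : ∀ {x S} → (x , ses S) ∈ yCs → nv x ∈ fu P ⊎ S ≡ end)
         (F : Fits (names Γ) E (fu P ∖ⁿ map nv (map proj₁ yCs))) (h : Holds Γ X (fv P)) (ty : Typed X (fv P))
         (ps≡ : ps ≡ payloads X (fv P) ∷ drop 1 ps) where

  private
    x̃ = map nv (map proj₁ yCs)
    rs = recParams yCs
    E′ = E [ yCs ]ᴱ

    -- Abs allows a change only at the names in `𝒢names yCs`. At the remaining indices of a
    -- parameter Γ must be kept, and `N₁-indexed` checks that no shared type is expected there:
    -- shared types sit at index 1, which is always bound.
    N₁ : NamesEnv
    N₁ w = if does (w ∈ᵗ? 𝒢names yCs) then (unindex w >>= λ (u , i) → sharedAt (E′ u) i) else names Γ w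

    N₁-off : ∀ {w} → w ∉ 𝒢names yCs → N₁ w ≡ names Γ w
    N₁-off {w} n = if-no (w ∈ᵗ? 𝒢names yCs) n

    off-𝒢 : ∀ {w} → (∀ y i → w ≢ nv (y at i)) → w ∉ 𝒢names yCs
    off-𝒢 ne m with ∈-𝒢names yCs m
    ... | y , i , e , _ = ne y i e

    unindex-at : ∀ u i → unindex (u at[ i ]) ≡ just (u , i)
    unindex-at (sh _)   i = refl
    unindex-at (se _ _) i = refl
    unindex-at (nv _)   i = refl

    N₁-indexed : ∀ u i → N₁ (u at[ i ]) ≡ sharedAt (E′ u) i
    N₁-indexed u i = by-cases (u at[ i ] ∈ᵗ? 𝒢names yCs)
      (λ m → trans (if-yes (u at[ i ] ∈ᵗ? 𝒢names yCs) m) (cong (_>>= λ (u , i) → sharedAt (E′ u) i) (unindex-at u i)))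
      (λ n → trans (N₁-off n) (trans (indexed F u i) (by-cases (u ∈? x̃) (bound n)
        (λ n′ → cong (λ t → sharedAt t i) (sym ([]ᴱ-∉ yCs E n′))))))
      where
      bound : u at[ i ] ∉ 𝒢names yCs → u ∈ x̃ → sharedAt (E u) i ≡ sharedAt (E′ u) i
      bound n m = by-cases (i ≟ 1) (λ { refl → ⊥-elim (n (first m)) })
        (λ ne → trans (sharedAt-off (E u) ne) (sym (sharedAt-off (E′ u) ne)))
        where
        first : u ∈ x̃ → u at[ 1 ] ∈ 𝒢names yCs
        first m with ∈-params yCs m
        ... | y , C , refl , _ = first-𝒢name yCs ws m

    lookup′ : ∀ {y C} → (y , C) ∈ yCs → E′ (nv y) ≡ just (C , 1)
    lookup′ = []ᴱ-∈ yCs E un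

    WF-param : ∀ {y C} → (y , C) ∈ yCs → WFᶜ C
    WF-param m = All.lookup ws (∈-map⁺ proj₂ m)

    serversᴱ : ∀ {r S} → (r , S) ∈ rs → E′ r ≡ just (ses S , 1) × recursive S ≡ true × WF S
    serversᴱ m with ∈-recParams yCs m
    ... | y , refl , m′ , r with WF-param m′
    ...   | ses w = lookup′ m′ , r , w

    served : ∀ {u S i} → u ∈ fu P → E′ u ≡ just (ses S , i) → recursive S ≡ true →
             (u , S) ∈ rs ⊎ (u ∉ map proj₁ rs × N₁ (c^ u) ≡ just (arr lin (map ses (ℛ⋆ S))))
    served {u} {S} {i} m e r = by-cases (u ∈? x̃) (λ m → inj₁ (in-rs m))
      (λ n → inj₂ ((λ m′ → n (recParams-⊆ yCs m′)) ,
                   trans (N₁-off (off-𝒢 λ _ _ ())) (server F (∈-∖ⁿ⁺ m n) (trans (sym ([]ᴱ-∉ yCs E n)) e) r)))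
      where
      in-rs : u ∈ x̃ → (u , S) ∈ rs
      in-rs m with ∈-params yCs m
      ... | y , C , refl , m′ with trans (sym (lookup′ m′)) e
      ...   | refl = recParams-∈ yCs m′ r

    ended : ∀ {w S i} → w ∈ x̃ → E′ w ≡ just (ses S , i) → w ∈ fu P ⊎ S ≡ end
    ended m e with ∈-params yCs m
    ... | y , C , refl , m′ with trans (sym (lookup′ m′)) e
    ...   | refl = dead m′

    same-rec : live recursive E′ x̃ ≗ live recursive E′ (map proj₁ rs)
    same-rec = live-⇔ᵖ recursive {E′} {x̃} {map proj₁ rs} to (λ _ _ m → recParams-⊆ yCs m)
      where
      to : ∀ {u S i} → E′ u ≡ just (ses S , i) → recursive S ≡ true → u ∈ x̃ → u ∈ map proj₁ rs
      to e r m with ∈-params yCs m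
      ... | y , C , refl , m′ with trans (sym (lookup′ m′)) e
      ...   | refl = ∈-map⁺ proj₁ (recParams-∈ yCs m′ r)

  -- `W` is the identity for a linear abstraction, whose propagators stay free, and the restriction
  -- of all of them for a shared one.
  abstraction-typed : ∀ {m C D} (W : Proc target → Proc target) →
    (∀ {N A Q} → rename N Γ ⨾ ∅ ⨾ senv A (segᵍ recvT k ps) (segᵍ sendT k ps) ∅ ⊢ Q → rename N Γ ⨾ ∅ ⨾ senv A C D ∅ ⊢ W Q) →
    (∀ {N} → Fits N (E [ yCs ]ᴱ) (fu P) →
       rename N Γ ⨾ ∅ ⨾ senv (live nonrec (E [ yCs ]ᴱ) (fu P)) (segᵍ recvT k ps) (segᵍ sendT (suc k) (drop 1 ps)) ∅ ⊢ B) →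
    Γ ⨾ ∅ ⨾ senv (live nonrec E (fu P ∖ⁿ map nv (map proj₁ yCs))) C D ∅ ⊢ᵛ
      ƛ m (𝒢params yCs) (νcʳ (recParams yCs) (W (servers (recParams yCs) (c̄ₖ k (fv P) 𝟎 ∣ B)))) ▷ 𝒢ᶜˢ (map proj₂ yCs) ⊸⋄
  abstraction-typed {C = C} {D} W hW hB
    with binder {E} {E′} {x̃} {fu P ∖ⁿ x̃} {fu P} (λ u n → sym ([]ᴱ-∉ yCs E n))
           (λ m → proj₂ (∈-∖ⁿ⁻ (fu P) x̃ m)) (λ m → proj₁ (∈-∖ⁿ⁻ (fu P) x̃ m)) ∈-∖ⁿ⁺
  ... | A , outer , inner =
    abs-typed {Γ′ = rename N₁ Γ} (𝒢params-names yCs) (𝒢params-types yCs) (𝒢names-unique yCs un)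
      ((λ _ _ → refl) , λ _ → N₁-off)
      (νcʳ-typed rs (recParams-unique yCs un) (λ m → let _ , r , w = serversᴱ m in ℛ⋆-minimal w r) body)
      (𝒢names-typed {Γ = rename N₁ Γ} {E′} yCs un ws lookup′ N₁-indexed)
      (senv-⊎ outer ⊎ᵐ-∅ʳ ⊎ᵐ-∅ʳ ⊎ᵐ-∅ʳ)
    where
    body : ∀ N → (∀ w → (∀ r → r ∈ map proj₁ rs → w ≢ c^ r) → N w ≡ N₁ w) →
           (∀ {r S} → (r , S) ∈ rs → N (c^ r) ≡ just (arr lin (map ses (ℛ⋆ S)))) →
           rename N Γ ⨾ ∅ ⨾ senv A C D ∅ ⊢ W (servers rs (c̄ₖ k (fv P) 𝟎 ∣ B))
    body N off at-rs = hW (servers-typed {E = E′} rs (recParams-unique yCs un) serversᴱ at-rs (session-index FN)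
        (⊎ᵐ-resp (λ _ → refl) (λ _ → refl) same-rec inner)
        (weaken-ended (session-index FN) x̃ ended main))
      where
      FN : Fits N E′ (fu P)
      FN = Fits-νcʳ rs N₁-indexed (λ k p → trans (N₁-off (off-𝒢 λ _ _ ())) (propagator F k p))
             (λ j i → trans (N₁-off (off-𝒢 λ _ _ ())) (variable-z F j i)) off at-rs served
      main : rename N Γ ⨾ ∅ ⨾ senv (live nonrec E′ (fu P)) (segᵍ recvT k ps) (segᵍ sendT k ps) ∅ ⊢ (c̄ₖ k (fv P) 𝟎 ∣ B)
      main = Par ⊎ᵐ-∅ˡ (senv-⊎ ⊎ᵐ-∅ˡ ⊎ᵐ-∅ˡ (seg-head-⊎ sendT ps≡) ⊎ᵐ-∅ˡ)
        (next-typed {Γ = rename N Γ} {X} (propagator FN) (variable-z FN 0 0) ty h ⊎ᵐ-∅ʳ (Nil (λ _ → refl) senv-∅))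
        (hB FN)

-- Typing the breakdown

k+1≡ : ∀ k → k + 1 ≡ suc k
k+1≡ k = +-comm k 1

next-index : ∀ k l {n} → n ≡ l → k + l + 1 ≡ k + 1 + n
next-index k l refl = trans (+-assoc k l 1) (trans (cong (k +_) (+-comm l 1)) (sym (+-assoc k 1 l)))

νₛ-names : ℕ → List (Nm source)
νₛ-names s = se s pos ∷ se s neg ∷ []

module _ {Γ : SharedEnv target} {E : Env} {s : ℕ} {S : SType} {P : Proc source} {C D : CMap} {Q : Proc target}
         (w : WF S) (u⁺ : Unshared E (se s pos)) (u⁻ : Unshared E (se s neg))
         (l⁺ : se s pos ∈ fu P ⊎ S ≡ end) (l⁻ : se s neg ∈ fu P ⊎ S ≡ end)
         (F : Fits (names Γ) E (fu P ∖ⁿ νₛ-names s)) where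

  private
    bs = νₛ-names s
    E₁ = E [ se s pos ↦ ses S , 1 ]ᴱ
    E₂ = E₁ [ se s neg ↦ ses (dual S) , 1 ]ᴱ
    rs : List (Nm source × SType)
    rs = (se s pos , S) ∷ (se s neg , dual S) ∷ []

    at⁻ : E₂ (se s neg) ≡ just (ses (dual S) , 1)
    at⁻ = [↦]-at E₁ (se s neg) _
    at⁺ : E₂ (se s pos) ≡ just (ses S , 1)
    at⁺ = trans ([↦]-off E₁ (se s neg) _ {se s pos} (λ ())) ([↦]-at E (se s pos) _)
    off : ∀ u → u ∉ bs → E u ≡ E₂ u
    off u n = sym (trans ([↦]-off E₁ (se s neg) _ (λ { refl → n (there (here refl)) }))
                         ([↦]-off E (se s pos) _ (λ { refl → n (here refl) })))

    ended : ∀ {u T i} → u ∈ bs → E₂ u ≡ just (ses T , i) → u ∈ fu P ⊎ T ≡ end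
    ended (here refl) e with trans (sym at⁺) e
    ... | refl = l⁺
    ended (there (here refl)) e with trans (sym at⁻) e
    ... | refl = [ inj₁ , (λ { refl → inj₂ refl }) ]′ l⁻

    indexed₂ : ∀ u i → names Γ (u at[ i ]) ≡ sharedAt (E₂ u) i
    indexed₂ u i = trans (indexed F u i) (by-cases (u ∈? bs) bound (λ n → cong (λ t → sharedAt t i) (off u n)))
      where
      bound : u ∈ bs → sharedAt (E u) i ≡ sharedAt (E₂ u) i
      bound (here refl)         = trans (sharedAt-unshared E (se s pos) u⁺ i) (cong (λ t → sharedAt t i) (sym at⁺))
      bound (there (here refl)) = trans (sharedAt-unshared E (se s neg) u⁻ i) (cong (λ t → sharedAt t i) (sym at⁻))

    server₂ : ∀ {u T i} → u ∈ fu P → u ∉ bs → E₂ u ≡ just (ses T , i) → recursive T ≡ true →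
              names Γ (c^ u) ≡ just (arr lin (map ses (ℛ⋆ T)))
    server₂ {u} m n e r = server F (∈-∖ⁿ⁺ m n) (trans (off u n) e) r

    rs-unique : Unique (map proj₁ rs)
    rs-unique = ((λ ()) ∷ []) ∷ [] ∷ []

    body : Proc target
    body = if recursive S then νcʳ rs (servers rs Q) else Q

    columns : live allTypes E₂ bs ≐ column _≟ⁿ_ (se s pos) (seg 1 (𝒢 S)) ⊎ᵐ
                                    column _≟ⁿ_ (se s neg) (seg 1 (map dual (𝒢 S)))
    columns = ⊎ᵐ-resp (λ _ → refl) (λ _ → refl) single⁻
                (live-cons allTypes {E₂} (se s neg ∷ []) at⁺ refl (λ { (here ()) ; (there ()) }))
      where
      single⁻ : live allTypes E₂ [ se s neg ] ≗ column _≟ⁿ_ (se s neg) (seg 1 (map dual (𝒢 S)))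
      single⁻ j = sym (trans (cong (λ Ms → column _≟ⁿ_ (se s neg) (seg 1 Ms) j) (sym (𝒢-dual S)))
        (⊎ᵐ-Emptyʳ (live-cons allTypes {E₂} [] at⁻ refl (λ ())) (live-[] allTypes E₂) j))

    -- The Boolean is generalised so that the conditional in the process computes once it is matched
    -- on.
    body-typed : ∀ {A} b → recursive S ≡ b → A ≐ live nonrec E₂ (bs ++ fu P) ⊎ᵐ live recursive E₂ bs →
                 (∀ {N} → Fits N E₂ (fu P) → rename N Γ ⨾ ∅ ⨾ senv (live nonrec E₂ (fu P)) C D ∅ ⊢ Q) →
                 Γ ⨾ ∅ ⨾ senv A C D ∅ ⊢ (if b then νcʳ rs (servers rs Q) else Q)
    body-typed true r inner t =
      νcʳ-typed rs rs-unique minimal λ N same at-rs →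
        let FN = Fits-νcʳ {N₁ = names Γ} rs indexed₂ (propagator F) (variable-z F) same at-rs served
        in servers-typed {E = E₂} rs rs-unique serversᴱ at-rs (session-index FN) inner
             (weaken-ended (session-index FN) bs ended (t FN))
      where
      serversᴱ : ∀ {r S′} → (r , S′) ∈ rs → E₂ r ≡ just (ses S′ , 1) × recursive S′ ≡ true × WF S′
      serversᴱ (here refl)         = at⁺ , r , w
      serversᴱ (there (here refl)) = at⁻ , trans (recursive-dual S) r , WF-dual w
      minimal : ∀ {r S′} → (r , S′) ∈ rs → All Minimal (ℛ⋆ S′)
      minimal m = let _ , r , w = serversᴱ m in ℛ⋆-minimal w r
      served : ∀ {u T i} → u ∈ fu P → E₂ u ≡ just (ses T , i) → recursive T ≡ true →
               (u , T) ∈ rs ⊎ (u ∉ bs × names Γ (c^ u) ≡ just (arr lin (map ses (ℛ⋆ T))))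
      served {u} {T} m e r = by-cases (u ∈? bs) (λ m → inj₁ (bound m)) (λ n → inj₂ (n , server₂ m n e r))
        where
        bound : u ∈ bs → (u , T) ∈ rs
        bound (here refl) with trans (sym at⁺) e
        ... | refl = here refl
        bound (there (here refl)) with trans (sym at⁻) e
        ... | refl = there (here refl)
    body-typed false r inner t =
      session-ext (senv-≗ᴬ (⊎ᵐ-Emptyʳ inner none))
        (weaken-ended (session-index F₂) bs ended (t F₂))
      where
      none : Empty (live recursive E₂ bs)
      none (u , j) = by-cases (u ∈? bs) (λ m → trans (live-∈ recursive E₂ bs j m) (bound m)) (live-∉ recursive E₂ bs j)
        where
        bound : u ∈ bs → entry recursive (E₂ u) j ≡ nothing
        bound (here refl)         = entry-miss recursive at⁺ r j
        bound (there (here refl)) = entry-miss recursive at⁻ (trans (recursive-dual S) r) j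
      contra : ∀ {b} {A : Set} → b ≡ true → b ≡ false → A
      contra refl ()
      F₂ : Fits (names Γ) E₂ (fu P)
      F₂ = record
        { indexed = indexed₂ ; propagator = propagator F ; variable-z = variable-z F
        ; server = λ {u} m e r′ → by-cases (u ∈? bs) (λ m′ → bound m′ e r′) (λ n → server₂ m n e r′) }
        where
        bound : ∀ {u T i} → u ∈ bs → E₂ u ≡ just (ses T , i) → recursive T ≡ true →
                names Γ (c^ u) ≡ just (arr lin (map ses (ℛ⋆ T)))
        bound (here refl) e r′ with trans (sym at⁺) e
        ... | refl = contra r′ r
        bound (there (here refl)) e r′ with trans (sym at⁻) e
        ... | refl = contra r′ (trans (recursive-dual S) r)

  νₛ-typed : (∀ {N} → Fits N ((E [ se s pos ↦ ses S , 1 ]ᴱ) [ se s neg ↦ ses (dual S) , 1 ]ᴱ) (fu P) →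
                rename N Γ ⨾ ∅ ⨾ senv (live nonrec ((E [ se s pos ↦ ses S , 1 ]ᴱ)
                  [ se s neg ↦ ses (dual S) , 1 ]ᴱ) (fu P)) C D ∅ ⊢ Q) →
             Γ ⨾ ∅ ⨾ senv (live nonrec E (fu P ∖ⁿ νₛ-names s)) C D ∅ ⊢
               ν̃ s 1 (𝒢 S) (if recursive S
                 then νcʳ ((se s pos , S) ∷ (se s neg , dual S) ∷ [])
                        (servers ((se s pos , S) ∷ (se s neg , dual S) ∷ []) Q)
                 else Q)
  νₛ-typed t
    with binder {E} {E₂} {bs} {fu P ∖ⁿ bs} {fu P} off (λ m → proj₂ (∈-∖ⁿ⁻ (fu P) bs m))
           (λ m → proj₁ (∈-∖ⁿ⁻ (fu P) bs m)) ∈-∖ⁿ⁺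
  ... | A , outer , inner with ⊎ᵐ-assocˡ outer columns
  ...   | A₁ , a₁ , a₂ = ν̃-typed s 1 (𝒢-minimal w) a₂ a₁ (body-typed (recursive S) refl inner t)

module _ {Γ : SharedEnv target} {E : Env} {a : ℕ} {U : HType} {P : Proc source} {C D : CMap} {Q : Proc target}
         (w : WFᵁ U) (F : Fits (names Γ) E (fu P ∖ⁿ [ sh a ])) where

  private
    E₁ = E [ sh a ↦ ⟨ U ⟩ , 1 ]ᴱ

    N₁ : NamesEnv
    N₁ w = if does (w ≟ᵗ sh (a at 1)) then just (𝒢ᵁ U) else names Γ w

    at-a : E₁ (sh a) ≡ just (⟨ U ⟩ , 1)
    at-a = [↦]-at E (sh a) _

    N₁-off : ∀ {w} → w ≢ sh (a at 1) → N₁ w ≡ names Γ w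
    N₁-off {w} = if-no (w ≟ᵗ sh (a at 1))

    indexed₁ : ∀ u i → N₁ (u at[ i ]) ≡ sharedAt (E₁ u) i
    indexed₁ u i = by-cases (u ≟ⁿ sh a) bound
      (λ ne → trans (N₁-off (λ e → ne (at-injective u (sh a) e)))
                (trans (indexed F u i) (cong (λ t → sharedAt t i) (sym ([↦]-off E (sh a) _ ne)))))
      where
      bound : u ≡ sh a → N₁ (u at[ i ]) ≡ sharedAt (E₁ u) i
      bound refl = by-cases (i ≟ 1)
        (λ { refl → trans (if-yes (sh (a at 1) ≟ᵗ sh (a at 1)) refl) (cong (λ t → sharedAt t 1) (sym at-a)) })
        (λ ne → trans (N₁-off (λ { refl → ne refl }))
                  (trans (indexed F u i) (trans (sharedAt-off (E u) ne) (sym (sharedAt-off (E₁ u) ne)))))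

    not-session : ∀ {u} → Ses E₁ u → u ≢ sh a
    not-session ss refl = ¬Ses-shared E₁ (sh a) at-a ss

    F₁ : Fits N₁ E₁ (fu P)
    F₁ = record
      { indexed = indexed₁
      ; propagator = λ k p → trans (N₁-off (λ ())) (propagator F k p)
      ; variable-z = λ j i → trans (N₁-off (λ ())) (variable-z F j i)
      ; server = λ {u} m e r → let ne = not-session (_ , _ , e) in
          trans (N₁-off (λ ())) (server F (∈-∖ⁿ⁺ m (λ { (here e′) → ne e′ })) (trans (sym ([↦]-off E (sh a) _ ne)) e) r) }

    same-live : live nonrec E₁ (fu P) ≗ live nonrec E (fu P ∖ⁿ [ sh a ])
    same-live k = trans
      (live-⇔ nonrec {E₁} {fu P} {fu P ∖ⁿ [ sh a ]} (λ u ss m → ∈-∖ⁿ⁺ m (λ { (here e) → not-session ss e }))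
        (λ u ss m → proj₁ (∈-∖ⁿ⁻ (fu P) [ sh a ] m)) k)
      (live-cong nonrec {E₁} {E} {fu P ∖ⁿ [ sh a ]}
        (λ u m → [↦]-off E (sh a) _ (λ { refl → proj₂ (∈-∖ⁿ⁻ (fu P) [ sh a ] m) (here refl) })) k)

  νₐ-typed : (∀ {N} → Fits N (E [ sh a ↦ ⟨ U ⟩ , 1 ]ᴱ) (fu P) →
                rename N Γ ⨾ ∅ ⨾ senv (live nonrec (E [ sh a ↦ ⟨ U ⟩ , 1 ]ᴱ) (fu P)) C D ∅ ⊢ Q) →
             Γ ⨾ ∅ ⨾ senv (live nonrec E (fu P ∖ⁿ [ sh a ])) C D ∅ ⊢ νₐ (a at 1) (𝒢ᵁ U) Q
  νₐ-typed t =
    Res {Γ′ = rename N₁ Γ} ((λ _ _ → refl) , λ w n → N₁-off (λ { refl → n (here refl) }))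
      (if-yes (sh (a at 1) ≟ᵗ sh (a at 1)) refl) (okᵁ (𝒢ᵁ-minimal w))
      (session-ext (senv-≗ᴬ same-live) (t F₁))

mutual
  -- An abstraction contains the output that triggers its own body, so both ends of its propagators
  -- start at `k`.
  𝒱-typed : ∀ {Γ : SharedEnv target} {E X V U k} (t : WTᵛ E X V U) → Agrees V U → Fits (names Γ) E (fuᵛ V) →
            Holds Γ X (fvᵛ V) →
            Γ ⨾ ∅ ⨾ senv (live nonrec E (fuᵛ V)) (segᵍ recvT k (paysᵛ t)) (segᵍ sendT k (paysᵛ t)) ∅ ⊢ᵛ 𝒱 E k (fvᵛ V) V ▷ 𝒢ᵁ U
  𝒱-typed {Γ} {E} (var {x} {Cs} {m} {Ds} e w q) a F h =
    Conv (var-typed {Γ = Γ} (h (here refl) e) (okᵁ (arr (𝒢ᶜˢ-minimal w)))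
           (λ w → trans (senv-≗ᴬ (live-[] nonrec E) w) (senv-∅ w)))
      (arr-cong (𝒢ᶜˢ-cong q)) (okᵁ-≈ (arr-cong (𝒢ᶜˢ-cong (≈ᶜˢ-sym q))) (okᵁ (arr (𝒢ᶜˢ-minimal w))))
  𝒱-typed {Γ} {E} {k = k} (ƛ {m = lin} {P = P} un ws dead ns t q) refl F h =
    Conv (abstraction-typed {P = P} {k = k} un ws dead F h (fv-typed t) (pays-head t) (λ Q → Q) (λ u → u) (λ FN → ℬ-typed t FN))
      (arr-cong (𝒢ᶜˢ-cong q)) (okᵁ-≈ (arr-cong (𝒢ᶜˢ-cong (≈ᶜˢ-sym q))) (okᵁ (arr (𝒢ᶜˢ-minimal ws))))
  𝒱-typed {Γ} {E} {V = V} {k = k} (ƛ {m = shr} {P = P} un ws dead ns t q) refl F h =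
    Conv (Prom (λ _ → refl) none
        (abstraction-typed {P = P} {k = k} un ws dead F h (fv-typed t) (pays-head t) (νc k ∣ P ∣ᵖ)
          (λ u → νc-typed k (pays t) (pays-length t) (pays-minimal t) ⊎ᵐ-∅ˡ ⊎ᵐ-∅ˡ u) (λ FN → ℬ-typed t FN)))
      (arr-cong (𝒢ᶜˢ-cong q)) (okᵁ-≈ (arr-cong (𝒢ᶜˢ-cong (≈ᶜˢ-sym q))) (okᵁ (arr (𝒢ᶜˢ-minimal ws))))
    where
    -- A shared type excludes free session names, so the environment is empty and Prom applies.
    none : Empty (senv (live nonrec E (fuᵛ V)) ∅ ∅ ∅)
    none w = trans (senv-≗ᴬ dead′ w) (senv-∅ w)
      where
      dead′ : live nonrec E (fuᵛ V) ≗ ∅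
      dead′ (u , j) = by-cases (ses? E u) (λ ss → live-∉ nonrec E (fuᵛ V) j (ns refl u ss)) (live-¬Ses nonrec E (fuᵛ V) j)

  -- Sending ends start at `suc k` only: the output on `c̄ k` that triggers the breakdown belongs to
  -- its context.
  ℬ-typed : ∀ {Γ : SharedEnv target} {E X P k} (t : WT E X P) → Fits (names Γ) E (fu P) →
            Γ ⨾ ∅ ⨾ senv (live nonrec E (fu P)) (segᵍ recvT k (pays t)) (segᵍ sendT (suc k) (drop 1 (pays t))) ∅ ⊢ ℬ E k (fv P) P
  ℬ-typed {Γ} {E} {X} {k = k} 𝟎 F =
    cₖ-typed {X = X} {xs = []} (propagator F k pos) [] (λ ()) (senv-⊎ none ⊎ᵐ-∅ʳ ⊎ᵐ-∅ˡ ⊎ᵐ-∅ˡ)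
      (senv-singleᶜ (seg-single recvT k (payloads X []))) (λ _ _ → Nil (λ _ → refl) senv-∅)
    where
    none : live nonrec E [] ≐ ∅ ⊎ᵐ ∅
    none = ⊎ᵐ-resp (λ k → sym (live-[] nonrec E k)) (λ _ → refl) (λ _ → refl) ⊎ᵐ-∅ˡ
  ℬ-typed {Γ} {E} {X} {P ∣ Q} {k} T@((_∣_ t t′) ap) F
    -- `Db` consists of the two sending ends by which the prefix triggers the components; `Dr` holds
    -- those that the components use internally.
    with ⊎ᵐ-interchange (seg-++-⊎ sendT {k + 1} (pays t) {pays t′} (next-index k ∣ P ∣ᵖ (pays-length t)))
           (seg-head-⊎ sendT (pays-head t)) (seg-head-⊎ sendT (pays-head t′))
  ... | Db , Dr , d , d₁ , d₂ =
    Par ⊎ᵐ-∅ˡ (senv-⊎ ⊎ᵐ-∅ˡ (seg-cons-⊎ recvT {xs = pays t ++ pays t′} (k+1≡ k))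
                (subst (λ k′ → segᵍ sendT k′ (pays t ++ pays t′) ≐ Db ⊎ᵐ Dr) (k+1≡ k) d) ⊎ᵐ-∅ˡ)
      (cₖ-typed (propagator F k pos) (fv-unique (occ (P ∣ Q))) (fv-typed T)
        (senv-⊎ ⊎ᵐ-∅ˡ ⊎ᵐ-∅ʳ ⊎ᵐ-∅ˡ ⊎ᵐ-∅ˡ) (senv-singleᶜ (sng-single _≟_ k _)) λ vs h →
        next-typed {Γ = rebind vs Γ} {X} (propagator F) (variable-z F 0 0) (fv-typed t)
          (λ m → h (dedup-⊆ (occ P) ∈-++⁺ˡ m)) d₁
          (next-typed {Γ = rebind vs Γ} {X} (propagator F) (variable-z F 0 0) (fv-typed t′)
            (λ m → h (dedup-⊆ (occ Q) (∈-++⁺ʳ (occ P)) m)) ⊎ᵐ-∅ʳ (Nil (λ _ → refl) senv-∅)))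
      (Par ⊎ᵐ-∅ˡ (senv-⊎ (live-++-⊎ nonrec {E} {fu P} {fu Q} ap)
                   (seg-++-⊎ recvT (pays t) {pays t′} (next-index k ∣ P ∣ᵖ (pays-length t))) d₂ ⊎ᵐ-∅ˡ)
        (ℬ-typed t (Fits-⊆ ∈-++⁺ˡ F)) (ℬ-typed t′ (Fits-⊆ (∈-++⁺ʳ (fu P)) F)))
  ℬ-typed {Γ} {E} {X} {V · us} {k} T@(app {Ds = Ds} a t as ap) F =
    cₖ-typed (propagator F k pos) (fv-unique (occᵛ V)) (fv-typed T)
      (senv-⊎ ⊎ᵐ-∅ˡ (seg-cons-⊎ recvT {xs = paysᵛ t} (k+1≡ k)) ⊎ᵐ-∅ˡ ⊎ᵐ-∅ˡ) (senv-singleᶜ (sng-single _≟_ k _)) λ vs h →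
      subst (λ k′ → rebind vs Γ ⨾ ∅ ⨾ senv (live nonrec E (fuᵛ V ++ us)) (segᵍ recvT (k + 1) (paysᵛ t))
                                              (segᵍ sendT k′ (paysᵛ t)) ∅ ⊢
          appBlock E (𝒱 E (k + 1) (fvᵛ V) V) 1 us []) (k+1≡ k)
        (appBlock-typed {Γ = rebind vs Γ} F {Cw = []} 1 (∈-++⁺ʳ (fuᵛ V)) as (agrees-𝒱 {V = V} a)
          (𝒱-typed {Γ = rebind vs Γ} t a (Fits-⊆ ∈-++⁺ˡ F) h) ([] senv-∅) (λ _ _ _ → refl)
          (live-++-⊎ nonrec {E} {fuᵛ V} {us} ap) ⊎ᵐ-∅ˡ)
  ℬ-typed {Γ} {E} {X} {send u (V ∷ []) n Q} {k} T@(send {S = S} {i} {U} e w st a t t′ ap ct) F = go (recursive S) refl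
    where
    us = fuᵛ V ++ fu Q
    split : live nonrec (after u E) us ≐ live nonrec (after u E) (fuᵛ V) ⊎ᵐ live nonrec (after u E) (fu Q)
    split = live-++-⊎ nonrec {after u E} {fuᵛ V} {fu Q} ap
    -- A non-recursive subject pays for the prefix with one entry of `live`; a recursive one has no
    -- entry there and uses its server instead.
    go : ∀ b → recursive S ≡ b →
         Γ ⨾ ∅ ⨾ senv (live nonrec E (u ∷ us)) (segᵍ recvT k (pays T)) (segᵍ sendT (suc k) (drop 1 (pays T))) ∅
           ⊢ ℬ E k (fv (send u (V ∷ []) n Q)) (send u (V ∷ []) n Q)
    go false r with ⊎ᵐ-assocˡ (live-step pos {E} us e w r st ct) split
    ... | A₁ , s₁ , s₂ = send-prefix {n = n} t t′ a (fv-typed T) F s₁ λ vs d tv hK →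
      sendBlock-typed {Γ = rebind vs Γ} F (agrees-𝒱 {V = V} a) tv d hK e w r st s₂
    go true r = send-prefix {n = n} t t′ a (fv-typed T) F
      (⊎ᵐ-resp (λ j → sym (live-rec-after {E} us e r j)) (λ _ → refl) (λ _ → refl) split) λ vs d tv hK →
      sendBlock-rec-typed {Γ = rebind vs Γ} F (agrees-𝒱 {V = V} a) tv d hK (here refl) e w r st
  ℬ-typed {Γ} {E} {X} {send u (V ∷ []) n Q} {k} T@(req {U = U} e w a t t′ ap) F =
    send-prefix {n = n} t t′ a (fv-typed T) F
      (⊎ᵐ-resp (λ j → sym (live-req j)) (λ _ → refl) (λ _ → refl) (live-++-⊎ nonrec {after u E} {fuᵛ V} {fu Q} ap)) λ vs d tv hK →
      sendBlock-req-typed {Γ = rebind vs Γ} F (agrees-𝒱 {V = V} a) tv d hK e w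
    where
    live-req : live nonrec E (u ∷ fuᵛ V ++ fu Q) ≗ live nonrec (after u E) (fuᵛ V ++ fu Q)
    live-req j = trans (live-shared nonrec {E} (fuᵛ V ++ fu Q) e j)
      (cong (λ E′ → live nonrec E′ (fuᵛ V ++ fu Q) j) (sym (after-shared {E} e)))
  ℬ-typed {Γ} {E} {X} {recv u (x ∷ []) n Q} {k} T@(recv {S = S} {i} {m} {Cs} {Ds} e w st q t ct) F = go (recursive S) refl
    where
    go : ∀ b → recursive S ≡ b →
         Γ ⨾ ∅ ⨾ senv (live nonrec E (u ∷ fu Q)) (segᵍ recvT k (pays T)) (segᵍ sendT (suc k) (drop 1 (pays T))) ∅
           ⊢ ℬ E k (fv (recv u (x ∷ []) n Q)) (recv u (x ∷ []) n Q)
    go false r = recv-prefix {n = n} t (fv-typed T) F (live-step neg {E} (fu Q) e w r st ct) λ vs h sub hK →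
      recvBlock-typed {Γ = rebind vs Γ} F {m = m} q h sub hK e w r st ⊎ᵐ-∅ʳ
    go true r = recv-prefix {n = n} t (fv-typed T) F (≗⇒⊎ᵐ-∅ˡ (live-rec-after {E} (fu Q) e r)) λ vs h sub hK →
      recvBlock-rec-typed {Γ = rebind vs Γ} F {m = m} q h sub hK (here refl) e w r st
  ℬ-typed {Γ} {E} {X} {recv u (x ∷ []) n Q} {k} T@(acc {m = m} e w q t) F =
    recv-prefix {n = n} t (fv-typed T) F (≗⇒⊎ᵐ-∅ˡ live-acc) λ vs h sub hK →
      recvBlock-acc-typed {Γ = rebind vs Γ} F {m = m} q h sub hK e w
    where
    live-acc : live nonrec E (u ∷ fu Q) ≗ live nonrec (after u E) (fu Q)
    live-acc j = trans (live-shared nonrec {E} (fu Q) e j) (cong (λ E′ → live nonrec E′ (fu Q) j) (sym (after-shared {E} e)))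
  ℬ-typed {P = νₛ s S P} (νₛ w u⁺ u⁻ l⁺ l⁻ t) F = νₛ-typed {P = P} w u⁺ u⁻ l⁺ l⁻ F (ℬ-typed t)
  ℬ-typed {P = νₐ a U P} (νₐ w t) F = νₐ-typed {P = P} w F (ℬ-typed t)

  -- Outputs on non-recursive, recursive and shared names differ only in the typing of the block and
  -- in the part `A₁` of the environment that it owns.
  send-prefix : ∀ {Γ : SharedEnv target} {E X u V n Q U k A₁} (t : WTᵛ (after u E) X V U) (t′ : WT (after u E) X Q) →
    Agrees V U → Typed X (fv (send u [ V ] n Q)) → Fits (names Γ) E (u ∷ fuᵛ V ++ fu Q) →
    live nonrec E (u ∷ fuᵛ V ++ fu Q) ≐ A₁ ⊎ᵐ live nonrec (after u E) (fu Q) →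
    (∀ vs {D} → D ≐ segᵍ sendT (k + 1) (paysᵛ t) ⊎ᵐ sng _≟_ (k + ∣ V ∣ᵛ + 1) (sendT (payloads X (fv Q))) →
       rebind vs Γ ⨾ ∅ ⨾ senv (live nonrec (after u E) (fuᵛ V)) (segᵍ recvT (k + 1) (paysᵛ t)) (segᵍ sendT (k + 1) (paysᵛ t)) ∅
         ⊢ᵛ 𝒱 (after u E) (k + 1) (fvᵛ V) V ▷ 𝒢ᵁ U →
       (∀ {Z R} → rebind vs Γ ⨾ ∅ ⨾ senv ∅ ∅ ∅ Z ⊢ R →
          rebind vs Γ ⨾ ∅ ⨾ senv ∅ ∅ (sng _≟_ (k + ∣ V ∣ᵛ + 1) (sendT (payloads X (fv Q)))) Z ⊢ c̄ₖ (k + ∣ V ∣ᵛ + 1) (fv Q) R) →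
       rebind vs Γ ⨾ ∅ ⨾ senv A₁ (segᵍ recvT (k + 1) (paysᵛ t)) D ∅
         ⊢ sendBlock E u (𝒱 (after u E) (k + 1) (fvᵛ V) V) (c̄ₖ (k + ∣ V ∣ᵛ + 1) (fv Q))) →
    Γ ⨾ ∅ ⨾ senv (live nonrec E (u ∷ fuᵛ V ++ fu Q)) (segᵍ recvT k (payloads X (fv (send u [ V ] n Q)) ∷ paysᵛ t ++ pays t′))
      (segᵍ sendT (suc k) (paysᵛ t ++ pays t′)) ∅ ⊢ ℬ E k (fv (send u [ V ] n Q)) (send u [ V ] n Q)
  send-prefix {Γ} {E} {X} {u} {V} {n} {Q} {k = k} t t′ a ty F s block-typed =
    prefix-typed {Γ = Γ} {X} {k = k} {pv = paysᵛ t} (propagator F) (fv-unique (occᵛ V ++ occ Q)) ty (pays-head t′)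
      (k+1≡ k) (next-index k ∣ V ∣ᵛ (paysᵛ-length t)) s
      (λ d vs h → block-typed vs d
        (𝒱-typed {Γ = rebind vs Γ} t a (Fits-after u (λ m → there (∈-++⁺ˡ m)) F) (λ m → h (dedup-⊆ (occᵛ V) ∈-++⁺ˡ m)))
        (next-typed {Γ = rebind vs Γ} {X} (propagator F) (variable-z F 0 0) (fv-typed t′)
          (λ m → h (dedup-⊆ (occ Q) (∈-++⁺ʳ (occᵛ V)) m)) ⊎ᵐ-∅ʳ))
      (ℬ-typed t′ (Fits-after u (λ m → there (∈-++⁺ʳ (fuᵛ V) m)) F))

  recv-prefix : ∀ {Γ : SharedEnv target} {E X u x n Q Cs k A₁} (t : WT (after u E) (X [ x ↦ Cs ]ˣ) Q) →
    Typed X (fv (recv u [ x ] n Q)) → Fits (names Γ) E (u ∷ fu Q) →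
    live nonrec E (u ∷ fu Q) ≐ A₁ ⊎ᵐ live nonrec (after u E) (fu Q) →
    (∀ vs → Holds (rebind vs Γ) X (fv (recv u [ x ] n Q)) →
       (∀ {y} → y ∈ fv Q → y ≢ x → y ∈ fv (recv u [ x ] n Q)) →
       (∀ vs′ → Holds (rebind vs′ Γ) (X [ x ↦ Cs ]ˣ) (fv Q) → ∀ {Z R} → rebind vs′ Γ ⨾ ∅ ⨾ senv ∅ ∅ ∅ Z ⊢ R →
          rebind vs′ Γ ⨾ ∅ ⨾ senv ∅ ∅ (sng _≟_ (k + 1) (sendT (payloads (X [ x ↦ Cs ]ˣ) (fv Q)))) Z ⊢ c̄ₖ (k + 1) (fv Q) R) →
       rebind vs Γ ⨾ ∅ ⨾ senv A₁ ∅ (sng _≟_ (k + 1) (sendT (payloads (X [ x ↦ Cs ]ˣ) (fv Q)))) ∅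
         ⊢ recvBlock E u x (c̄ₖ (k + 1) (fv Q))) →
    Γ ⨾ ∅ ⨾ senv (live nonrec E (u ∷ fu Q)) (segᵍ recvT k (payloads X (fv (recv u [ x ] n Q)) ∷ pays t))
      (segᵍ sendT (suc k) (pays t)) ∅ ⊢ ℬ E k (fv (recv u [ x ] n Q)) (recv u [ x ] n Q)
  recv-prefix {Γ} {E} {X} {u} {x} {n} {Q} {Cs} {k} t ty F s block-typed =
    prefix-typed {Γ = Γ} {X} {k = k} {pv = []} (propagator F) (fv-unique (occ (recv u [ x ] n Q))) ty (pays-head t)
      (k+1≡ k) (sym (+-identityʳ (k + 1))) s
      (λ d vs h → session-ext (senv-≗ (λ _ → refl) (λ _ → refl) (⊎ᵐ-Emptyʳ (⊎ᵐ-comm d) (λ _ → refl)) (λ _ → refl))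
        (block-typed vs h
          (λ {y} m ne → dedup⁺ (∈-filter⁺ (λ y → ¬? (y ≟ x)) (dedup⁻ (occ Q) m) ne))
          (λ vs′ h′ → next-typed {Γ = rebind vs′ Γ} {X [ x ↦ Cs ]ˣ} (propagator F) (variable-z F 0 0) (fv-typed t) h′ ⊎ᵐ-∅ʳ)))
      (ℬ-typed t (Fits-after u there F))

-- From derivations to syntax-directed typing

open Facts

-- A type in Γ is checked only where it is looked up, hence the conditional well-formedness for
-- shared names; for session names it is known outright. The two environments agree up to `≈`.
record Rel (E : Env) (Γ : SharedEnv source) (Δ : SessionEnv source) : Set where
  field
    shared   : ∀ {u U′} → names Γ u ≡ just U′ →
               ∃[ U ] E u ≡ just (⟨ U ⟩ , 1) × U′ ≈ᵁ U × (WFᵁ U′ → WFᵁ U)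
    unshared : ∀ {u} → names Γ u ≡ nothing → Unshared E u
    session  : ∀ {u S′} → Δ u ≡ just S′ → ∃[ S ] ∃[ i ] E u ≡ just (ses S , i) × S′ ≈ S × WF S

open Rel

record XRel (X : VEnv) (Γ : SharedEnv source) (Λ : LinearEnv source) : Set where
  constructor xrel
  field
    typed : ∀ {x Cs} → vars Γ x ≡ just Cs ⊎ Λ x ≡ just Cs → X x ≡ just Cs

open XRel

Rel-⊆ : ∀ {E Γ Δ Δ′} → (∀ {u S} → Δ′ u ≡ just S → Δ u ≡ just S) → Rel E Γ Δ → Rel E Γ Δ′
Rel-⊆ sub R = record { shared = shared R ; unshared = unshared R ; session = λ d → session R (sub d) }

Rel-names : ∀ {E Γ Γ′ Δ} → (∀ u → names Γ′ u ≡ names Γ u) → Rel E Γ Δ → Rel E Γ′ Δ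
Rel-names eq R = record
  { shared = λ p → shared R (trans (sym (eq _)) p)
  ; unshared = λ p → unshared R (trans (sym (eq _)) p)
  ; session = session R }

XRel-Λ : ∀ {X Γ Λ Λ′} → (∀ {x Cs} → Λ′ x ≡ just Cs → Λ x ≡ just Cs) → XRel X Γ Λ → XRel X Γ Λ′
XRel-Λ sub h = xrel [ (λ p → typed h (inj₁ p)) , (λ p → typed h (inj₂ (sub p))) ]′

XRel-vars : ∀ {X Γ Γ′ Λ} → (∀ x → vars Γ′ x ≡ vars Γ x) → XRel X Γ Λ → XRel X Γ′ Λ
XRel-vars eq h = xrel [ (λ p → typed h (inj₁ (trans (sym (eq _)) p))) , (λ p → typed h (inj₂ p)) ]′

XRel-EProm : ∀ {X Γ Γ′ Λ Λ′ x Cs} → SameOff [ x ] [] Γ Γ′ → vars Γ′ x ≡ nothing → vars Γ x ≡ just Cs →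
             Λ′ ≐ Λ , x ↦ Cs → XRel X Γ Λ → XRel X Γ′ Λ′
XRel-EProm {X} {Γ} {Γ′} {Λ} {Λ′} (so , _) n v l h = xrel go
  where
  go : ∀ {y Cs} → vars Γ′ y ≡ just Cs ⊎ Λ′ y ≡ just Cs → X y ≡ just Cs
  go {y} (inj₁ p) = typed h (inj₁ (trans (sym (so y λ { (here refl) → just≢nothing p n })) p))
  go (inj₂ p) with ,-back _≟_ l p
  ... | inj₁ (refl , refl) = typed h (inj₁ v)
  ... | inj₂ (_ , p′)      = typed h (inj₂ p′)

XRel-recv : ∀ {X Γ Γ′ Λ Λ₁ Λ₂ ΛV ΛE Δ us x U} → SameOff [ x ] [] Γ Γ′ → Λ₁ ≐ Λ ⊎ᵐ Λ₂ → Λ₂ ≐ ΛV ⊎ᵐ ΛE →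
            (∀ y → ΛE y ≡ nothing) → Facts Γ′ Λ₁ Δ us → (v : VarInv Γ′ ΛV x U) → XRel X Γ Λ →
            XRel (X [ x ↦ VarInv.Cs v ]ˣ) Γ′ Λ₁
XRel-recv {X} {Γ} {Γ′} {Λ} {Λ₁} {x = x} (so , _) l lv e F v h = xrel go
  where
  old : ∀ {y Es} → y ≢ x → vars Γ′ y ≡ just Es ⊎ Λ₁ y ≡ just Es → vars Γ y ≡ just Es ⊎ Λ y ≡ just Es
  old {y} ne (inj₁ p) = inj₁ (trans (sym (so y λ { (here refl) → ne refl })) p)
  old ne (inj₂ p) with ⊎ᵐ-inv l p
  ... | inj₁ p′ = inj₂ p′
  ... | inj₂ p′ with ⊎ᵐ-inv lv p′
  ...   | inj₁ p″ = ⊥-elim (ne (VarInv.only v p″))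
  ...   | inj₂ p″ = just≢nothing p″ (e _)
  -- `Γ′` and `Λ₁` are disjoint, so wherever `x` is found it has the same type.
  new : ∀ {Cs Es} → vars Γ′ x ≡ just Cs ⊎ _ ≡ just Cs → vars Γ′ x ≡ just Es ⊎ Λ₁ x ≡ just Es → Cs ≡ Es
  new (inj₁ p) (inj₁ p′) = just-injective (trans (sym p) p′)
  new (inj₁ p) (inj₂ p′) = just≢nothing p (vapart F p′)
  new (inj₂ p) (inj₁ p′) = just≢nothing p′ (vapart F (⊎ᵐ-⊆ʳ l (⊎ᵐ-⊆ˡ lv p)))
  new (inj₂ p) (inj₂ p′) = just-injective (trans (sym (⊎ᵐ-⊆ʳ l (⊎ᵐ-⊆ˡ lv p))) p′)
  go : ∀ {y Es} → vars Γ′ y ≡ just Es ⊎ Λ₁ y ≡ just Es → (X [ x ↦ VarInv.Cs v ]ˣ) y ≡ just Es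
  go {y} q =
    by-cases (y ≟ x) (λ { refl → trans ([↦]ˣ-at X x _) (cong just (new (VarInv.found v) q)) })
      (λ ne → trans ([↦]ˣ-off X ne) (typed h (old ne q)))

Rel-after : ∀ {E Γ Δ Δ₀ u S S₀ T i} → E u ≡ just (ses S , i) → S₀ ≈ cont S → WF (cont S) →
            Δ ≐ Δ₀ [ u ∶ S₀ ⇒ T ] → Rel E Γ Δ → Rel (after u E) Γ Δ₀
Rel-after {E} {Γ} {Δ} {Δ₀} {u} {S} eq q w s R = record
  { shared = sh′ ; unshared = un ; session = se′ }
  where
  sh′ : ∀ {v U′} → names Γ v ≡ just U′ → ∃[ U ] after u E v ≡ just (⟨ U ⟩ , 1) × U′ ≈ᵁ U × (WFᵁ U′ → WFᵁ U)
  sh′ {v} p with shared R p | v ≟ⁿ u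
  ... | U , e , r | yes refl = ¬Ses-shared E v e (_ , _ , eq)
  ... | U , e , r | no ne    = U , trans (after-off E u eq ne) e , r
  un : ∀ {v} → names Γ v ≡ nothing → Unshared (after u E) v
  un {v} p e with v ≟ⁿ u
  ... | yes refl = ¬Ses-shared (after v E) v e (_ , _ , after-at E v eq)
  ... | no ne    = unshared R p (trans (sym (after-off E u eq ne)) e)
  se′ : ∀ {v S′} → Δ₀ v ≡ just S′ → ∃[ S ] ∃[ i ] after u E v ≡ just (ses S , i) × S′ ≈ S × WF S
  se′ {v} d with v ≟ⁿ u
  ... | yes refl with trans (sym d) (proj₁ s)
  ...   | refl = _ , _ , after-at E v eq , q , w
  se′ {v} d | no ne with session R (trans (proj₂ (proj₂ s) v ne) d)
  ...   | T , j , e , r = T , j , trans (after-off E u eq ne) e , r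

Rel-params : ∀ {E Γ Γ′ Δ Δ₁ Δ₂ xCs} → let x̃ = map nv (map proj₁ xCs) in
             Unique x̃ → SameOff [] x̃ Γ Γ′ → Γ′ ⨾ Δ₂ ⊢ⁿˢ x̃ ▷ map proj₂ xCs → Δ₁ ≐ Δ ⊎ᵐ Δ₂ →
             (∀ {u S} → Δ₁ u ≡ just S → names Γ′ u ≡ nothing) → Rel E Γ Δ → Rel (E [ xCs ]ᴱ) Γ′ Δ₁
Rel-params {E} {Γ} {Γ′} {Δ} {Δ₁} {Δ₂} {xCs} un (_ , so) ts s ap R = record
  { shared = sh′ ; unshared = un′ ; session = se′ }
  where
  x̃ = map nv (map proj₁ xCs)
  sh′ : ∀ {v U′} → names Γ′ v ≡ just U′ → ∃[ U ] (E [ xCs ]ᴱ) v ≡ just (⟨ U ⟩ , 1) × U′ ≈ᵁ U × (WFᵁ U′ → WFᵁ U)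
  sh′ {v} p with v ∈? x̃
  ... | no ne with shared R (trans (sym (so v ne)) p)
  ...   | U , e , r = U , trans ([]ᴱ-∉ xCs E ne) e , r
  sh′ {v} p | yes m with ∈-params xCs m
  ... | x , C , refl , m′ with params-inv xCs ts m′ | []ᴱ-∈ xCs E un m′
  ...   | ses n _ _ _ | _ = just≢nothing p n
  ...   | ⟨⟩ n q w    | e with trans (sym n) p
  ...     | refl = _ , e , q , λ _ → w
  un′ : ∀ {v} → names Γ′ v ≡ nothing → Unshared (E [ xCs ]ᴱ) v
  un′ {v} p e with v ∈? x̃
  ... | no ne = unshared R (trans (sym (so v ne)) p) (trans (sym ([]ᴱ-∉ xCs E ne)) e)
  ... | yes m with ∈-params xCs m
  ...   | x , C , refl , m′ with params-inv xCs ts m′ | trans (sym ([]ᴱ-∈ xCs E un m′)) e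
  ...     | ses _ _ _ _ | ()
  ...     | ⟨⟩ n _ _    | _ = just≢nothing n p
  se′ : ∀ {v S′} → Δ₁ v ≡ just S′ → ∃[ S ] ∃[ i ] (E [ xCs ]ᴱ) v ≡ just (ses S , i) × S′ ≈ S × WF S
  se′ {v} d with v ∈? x̃ | ⊎ᵐ-inv s d
  ... | no ne | inj₂ d′ = ⊥-elim (ne (names-dom ts d′))
  ... | no ne | inj₁ d′ with session R d′
  ...   | S , i , e , r = S , i , trans ([]ᴱ-∉ xCs E ne) e , r
  se′ {v} d | yes m | _ with ∈-params xCs m
  ... | x , C , refl , m′ with params-inv xCs ts m′ | []ᴱ-∈ xCs E un m′
  ...   | ⟨⟩ n _ _      | _ = just≢nothing n (ap d)
  ...   | ses _ d′ q w | e with trans (sym (⊎ᵐ-⊆ʳ s d′)) d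
  ...     | refl = _ , _ , e , q , w

-- `E` records the syntactic dual, which the derivation replaces by any `S₂` related to it by `≈`.
Rel-νₛ : ∀ {E Γ Δ Δ₁ Δ₂ s S S₂} → Δ₁ ≐ Δ , se s pos ↦ S → Δ₂ ≐ Δ₁ , se s neg ↦ S₂ → dual S ≈ S₂ → WF S →
         (∀ {u S} → Δ₂ u ≡ just S → names Γ u ≡ nothing) → Rel E Γ Δ →
         Rel ((E [ se s pos ↦ ses S , 1 ]ᴱ) [ se s neg ↦ ses (dual S) , 1 ]ᴱ) Γ Δ₂
Rel-νₛ {E} {Γ} {Δ} {Δ₁} {Δ₂} {s} {S} s₁ s₂ q w ap R = record
  { shared = λ p → let U , e , r = shared R p in U , trans (off (off₁ p) (off₂ p)) e , r
  ; unshared = un ; session = se′ }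
  where
  E₁ = E [ se s pos ↦ ses S , 1 ]ᴱ
  E₂ = E₁ [ se s neg ↦ ses (dual S) , 1 ]ᴱ
  off : ∀ {u} → u ≢ se s pos → u ≢ se s neg → E₂ u ≡ E u
  off n₁ n₂ = trans ([↦]-off E₁ _ _ n₂) ([↦]-off E _ _ n₁)
  at₂ : E₂ (se s neg) ≡ just (ses (dual S) , 1)
  at₂ = [↦]-at E₁ (se s neg) _
  at₁ : E₂ (se s pos) ≡ just (ses S , 1)
  at₁ = trans ([↦]-off E₁ (se s neg) _ {se s pos} (λ ())) ([↦]-at E (se s pos) _)
  off₁ : ∀ {u U} → names Γ u ≡ just U → u ≢ se s pos
  off₁ p refl = just≢nothing p (ap (,-fwd _≟ⁿ_ s₂ (proj₁ (proj₂ s₁))))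
  off₂ : ∀ {u U} → names Γ u ≡ just U → u ≢ se s neg
  off₂ p refl = just≢nothing p (ap (proj₁ (proj₂ s₂)))
  un : ∀ {v} → names Γ v ≡ nothing → Unshared E₂ v
  un {v} p e =
    by-cases (v ≟ⁿ se s pos) (λ { refl → ¬Ses-shared E₂ v e (_ , _ , at₁) }) λ n₁ →
    by-cases (v ≟ⁿ se s neg) (λ { refl → ¬Ses-shared E₂ v e (_ , _ , at₂) }) λ n₂ →
    unshared R p (trans (sym (off n₁ n₂)) e)
  se′ : ∀ {v S′} → Δ₂ v ≡ just S′ → ∃[ T ] ∃[ i ] E₂ v ≡ just (ses T , i) × S′ ≈ T × WF T
  se′ d with ,-back _≟ⁿ_ s₂ d
  ... | inj₁ (refl , refl) = _ , _ , at₂ , ≈-sym q , WF-dual w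
  ... | inj₂ (n₂ , d′) with ,-back _≟ⁿ_ s₁ d′
  ...   | inj₁ (refl , refl) = _ , _ , at₁ , ≈-refl , w
  ...   | inj₂ (n₁ , d″) with session R d″
  ...     | T , i , e , r = T , i , trans (off n₁ n₂) e , r

Rel-νₐ : ∀ {E Γ Γ′ Δ a U} → SameOff [] [ sh a ] Γ Γ′ → names Γ′ (sh a) ≡ just U → WFᵁ U →
         (∀ {u S} → Δ u ≡ just S → names Γ′ u ≡ nothing) → Rel E Γ Δ → Rel (E [ sh a ↦ ⟨ U ⟩ , 1 ]ᴱ) Γ′ Δ
Rel-νₐ {E} {Γ} {Γ′} {Δ} {a} {U} (_ , so) n w ap R = record { shared = sh′ ; unshared = un ; session = se′ }
  where
  E₁ = E [ sh a ↦ ⟨ U ⟩ , 1 ]ᴱ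
  same : ∀ {v} → v ≢ sh a → names Γ′ v ≡ names Γ v
  same ne = so _ λ { (here e) → ne e }
  sh′ : ∀ {v U′} → names Γ′ v ≡ just U′ → ∃[ W ] E₁ v ≡ just (⟨ W ⟩ , 1) × U′ ≈ᵁ W × (WFᵁ U′ → WFᵁ W)
  sh′ {v} {U′} p = by-cases (v ≟ⁿ sh a) bound free
    where
    bound : v ≡ sh a → _
    bound refl with trans (sym n) p
    ... | refl = U , [↦]-at E (sh a) _ , ≈ᵁ-refl U , λ _ → w
    free : v ≢ sh a → ∃[ W ] E₁ v ≡ just (⟨ W ⟩ , 1) × U′ ≈ᵁ W × (WFᵁ U′ → WFᵁ W)
    free ne with shared R (trans (sym (same ne)) p)
    ... | W , e , r = W , trans ([↦]-off E (sh a) _ ne) e , r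
  un : ∀ {v} → names Γ′ v ≡ nothing → Unshared E₁ v
  un {v} p e =
    by-cases (v ≟ⁿ sh a) (λ { refl → just≢nothing n p })
      (λ ne → unshared R (trans (sym (same ne)) p) (trans (sym ([↦]-off E (sh a) _ ne)) e))
  se′ : ∀ {v S′} → Δ v ≡ just S′ → ∃[ T ] ∃[ i ] E₁ v ≡ just (ses T , i) × S′ ≈ T × WF T
  se′ {v} d =
    by-cases (v ≟ⁿ sh a) (λ { refl → just≢nothing n (ap d) })
      (λ ne → let T , i , e , r = session R d in T , i , trans ([↦]-off E (sh a) _ ne) e , r)

not-Ses : ∀ {E Γ Δ u U} {B : Set} → Rel E Γ Δ → names Γ u ≡ just U → Ses E u → B
not-Ses {E} {u = u} R p = ¬Ses-shared E u (proj₁ (proj₂ (shared R p)))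

-- A name mentioned on both sides is shared, or else it would be typed in both halves of a disjoint
-- union.
apart-⊎ : ∀ {E Γ Λ₁ Λ₂ Δ Δ₁ Δ₂ us ws} → Rel E Γ Δ → Δ ≐ Δ₁ ⊎ᵐ Δ₂ →
          Facts Γ Λ₁ Δ₁ us → Facts Γ Λ₂ Δ₂ ws → Apart E us ws
apart-⊎ R s F G u ss m m′ with scoped F m | scoped G m′
... | inj₁ (_ , p) | _            = not-Ses {u = u} R p ss
... | inj₂ _       | inj₁ (_ , p) = not-Ses {u = u} R p ss
... | inj₂ (_ , d) | inj₂ (_ , d′) = ⊎ᵐ-disjoint s d d′

args : ∀ {E Γ Δ us Cs} → Γ ⨾ Δ ⊢ⁿˢ us ▷ Cs → Rel E Γ Δ → Args E us Cs
args ([] _) R = []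
args {E} {Γ} {us = u ∷ us} (cons {Δ₁ = Δ₁} {Δ₂} s t ts) R with name-inv t
... | ⟨⟩ n _ q w _ with shared R n
...   | U , e , q′ , w′ = ⟨⟩ e (w′ w) (≈ᵁ-trans (≈ᵁ-sym q′) q) (args ts (Rel-⊆ (⊎ᵐ-⊆ʳ s) R))
args {E} {Γ} {us = u ∷ us} (cons {Δ₁ = Δ₁} {Δ₂} s t ts) R | ses n (d , _) q _ wT with session R (⊎ᵐ-⊆ˡ s d)
... | S , i , e , q′ , w′ = ses e w′ wT (≈-trans (≈-sym q′) q) fresh (args ts (Rel-⊆ (⊎ᵐ-⊆ʳ s) R))
  where
  fresh : u ∉ us
  fresh m with names-scoped ts m
  ... | inj₁ (_ , p)  = just≢nothing p n
  ... | inj₂ (_ , d′) = ⊎ᵐ-disjoint s d d′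

-- An endpoint not mentioned any more was discarded by End, so its type is `end` itself and not
-- merely related to it.
continues : ∀ {Γ Λ Δ u S S₀ us} → Facts Γ Λ Δ us → Δ u ≡ just S₀ → S₀ ≈ cont S →
            (cont S ≡ end → u ∉ us) → Continues u S us
continues {u = u} {S} {us = us} F d q h = h , live′
  where
  live′ : cont S ≢ end → u ∈ us
  live′ ne with dead-ok F d
  ... | inj₁ m          = m
  ... | inj₂ (refl , _) = ⊥-elim (ne (end≈⇒≡ q))

-- The mode of a variable is unconstrained in `WTᵛ`; for an abstraction Prom amounts to the absence
-- of free session names.
promoted : ∀ {E X V m m′ Ds} → (∀ u → Ses E u → u ∉ fuᵛ V) → WTᵛ E X V (arr m Ds) → WTᵛ E X V (arr m′ Ds)
promoted h (var p w q)         = var p w q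
promoted h (ƛ un w d n t q) = ƛ un w d (λ _ → h) t q

mutual
  -- The structural rules leave no trace: Conv is composed into the `≈` of `Rel`, End shrinks the
  -- environment that `Rel` describes, and EProm moves a variable within `X`.
  elab : ∀ {E X Γ Λ Δ P} → Γ ⨾ Λ ⨾ Δ ⊢ P → Rel E Γ Δ → XRel X Γ Λ → NoReuse E P → WT E X P
  elab (Nil _ _) R h nr = 𝟎
  elab (EProm so n v l t) R h nr =
    elab t (Rel-names (λ u → proj₂ so u (λ ())) R) (XRel-EProm so n v l h) nr
  elab (End n s t) R h nr = elab t (Rel-⊆ (,-fwd _≟ⁿ_ s) R) h nr
  elab {E} {Γ = Γ} {Δ = Δ} (Conv {Δ′} r ok t) R h nr =
    elab t (record { shared = shared R ; unshared = unshared R ; session = se′ }) h nr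
    where
    fwd : ∀ {u S} → Δ′ u ≡ just S → ∃[ S′ ] Δ u ≡ just S′ × S ≈ S′
    fwd {u} d with Δ u | Δ′ u | r u
    fwd refl | just _ | just _ | just q = _ , refl , q
    se′ : ∀ {u S′} → Δ′ u ≡ just S′ → ∃[ S ] ∃[ i ] E u ≡ just (ses S , i) × S′ ≈ S × WF S
    se′ d with fwd d
    ... | _ , d′ , q with session R d′
    ...   | S , i , e , q′ , w = S , i , e , ≈-trans q q′ , w
  elab (App s a t ts) R h nr =
    app a (elabᵛ t (Rel-⊆ (⊎ᵐ-⊆ˡ s) R) h nr) (args ts (Rel-⊆ (⊎ᵐ-⊆ʳ s) R))
      (apart-⊎ R s (factsᵛ t) (facts-names ts))
  elab {E} {X} (Send {u = u} l s t (cons lv sv a tv ([] e e′)) st w) R h nr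
    with session R (proj₁ (proj₂ st))
  ... | S , i , eq , q , wS with ≈-act-inv pos q
  ...   | _ , eq′ , (q₁ ∷ []) , q₂ =
    send eq wS eq′ (Agrees-≈ a q₁)
      (WTᵛ-≈ (elabᵛ tv (Rel-⊆ (λ d → ⊎ᵐ-⊆ʳ s (⊎ᵐ-⊆ˡ sv d)) R′)
                (XRel-Λ (λ p → ⊎ᵐ-⊆ʳ l (⊎ᵐ-⊆ˡ lv p)) h) (proj₁ (proj₂ nr))) q₁)
      (elab t (Rel-⊆ (⊎ᵐ-⊆ˡ s) R′) (XRel-Λ (⊎ᵐ-⊆ˡ l) h) (proj₂ (proj₂ nr)))
      (apart-⊎ R′ (⊎ᵐ-comm s) FV F)
      (continues {S = S} (facts-Par (⊎ᵐ-comm l) (⊎ᵐ-comm s) FV F) (proj₁ st) q₂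
        (λ c≡ → proj₁ nr (after-ended E u eq c≡)))
    where
    R′ = Rel-after eq q₂ (proj₂ (WF-step pos wS eq′)) st R
    F  = facts t
    FV = facts-≗ (⊎ᵐ-Emptyʳ lv e) (⊎ᵐ-Emptyʳ sv e′) (factsᵛ tv)
  elab {E} {X} (Rcv {u = u} {xs = x ∷ []} un so t (cons lv sv a tv ([] e e′)) l st w) R h nr
    with session R (proj₁ (proj₂ st)) | var-inv tv in veq
  ... | S , i , eq , q , wS | v@(record { type = refl ; equiv = qv }) with ≈-act-inv neg q
  ...   | _ , eq′ , (arr-cong q₁ ∷ []) , q₂ =
    recv eq wS eq′ (≈ᶜˢ-trans qv q₁)
      (elab t (Rel-names (λ u → proj₂ so u (λ ())) (Rel-after eq q₂ (proj₂ (WF-step neg wS eq′)) st R))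
        (XRel-recv so l lv e (facts t) v h) (proj₂ nr))
      (continues {S = S} (facts t) (proj₁ st) q₂
        (λ c≡ → proj₁ nr (after-ended E u eq c≡)))
  elab {E} {Γ = Γ} {Δ = Δ} (Req {u = u} s tu t a tv) R h nr with name-inv tu
  ... | ⟨⟩ n _ q w w′ with shared R n
  ...   | U , eq , q′ , wU =
    req eq (wU w) (Agrees-≈ a q″)
      (WTᵛ-≈ (elabᵛ tv (Rel-⊆ (⊎ᵐ-⊆ʳ s) R′) (XRel-Λ (λ ()) h) (proj₁ (proj₂ nr))) q″)
      (elab t (Rel-⊆ (⊎ᵐ-⊆ˡ s) R′) h (proj₂ (proj₂ nr)))
      (apart-⊎ R′ (⊎ᵐ-comm s) (factsᵛ tv) (facts t))
    where
    q″ = ≈ᵁ-trans (≈ᵁ-sym q) q′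
    R′ : Rel (after u E) Γ Δ
    R′ = subst (λ E′ → Rel E′ Γ Δ) (sym (after-shared eq)) R
  elab {E} {Γ = Γ} {Δ = Δ} (Acc {u = u} so tu t tv l) R h nr with name-inv tu | var-inv tv
  ... | ⟨⟩ n _ q w w′ | v@(record { type = refl ; equiv = qv }) with shared R n | q
  ...   | arr m Ds , eq , q′ , wU | arr-cong _ with ≈ᵁ-trans (≈ᵁ-sym q) q′
  ...     | arr-cong q″ =
    acc eq (wU w) (≈ᶜˢ-trans qv q″)
      (elab t (Rel-names (λ u → proj₂ so u (λ ())) R′) (XRel-recv so l ⊎ᵐ-∅ʳ (λ _ → refl) (facts t) v h) (proj₂ nr))
    where
    R′ : Rel (after u E) Γ Δ
    R′ = subst (λ E′ → Rel E′ Γ Δ) (sym (after-shared eq)) R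
  elab (Par l s t t′) R h nr =
    (elab t (Rel-⊆ (⊎ᵐ-⊆ˡ s) R) (XRel-Λ (⊎ᵐ-⊆ˡ l) h) (proj₁ nr) ∣
     elab t′ (Rel-⊆ (⊎ᵐ-⊆ʳ s) R) (XRel-Λ (⊎ᵐ-⊆ʳ l) h) (proj₂ nr)) (apart-⊎ R s (facts t) (facts t′))
  elab (Res so n w t) R h nr =
    νₐ w (elab t (Rel-νₐ so n w (apart (facts t)) R) (XRel-vars (λ x → proj₁ so x (λ ())) h) nr)
  elab {Γ = Γ} {P = νₛ s S P} (ResS {Δ₂ = Δ₂} refl q w w′ s₁ s₂ t) R h nr =
    νₛ w (unshared R (apart F at₁)) (unshared R (apart F at₂)) live₁ live₂
      (elab t (Rel-νₛ s₁ s₂ q w (apart F) R) h nr)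
    where
    F = facts t
    at₁ : Δ₂ (se s pos) ≡ just S
    at₁ = ,-fwd _≟ⁿ_ s₂ (proj₁ (proj₂ s₁))
    at₂ = proj₁ (proj₂ s₂)
    live₁ : se s pos ∈ fu P ⊎ S ≡ end
    live₁ with dead-ok F at₁
    ... | inj₁ m       = inj₁ m
    ... | inj₂ (e , _) = inj₂ e
    live₂ : se s neg ∈ fu P ⊎ S ≡ end
    live₂ with dead-ok F at₂
    ... | inj₁ m          = inj₁ m
    ... | inj₂ (refl , _) =
      inj₂ (isEnd⇒≡ S (trans (sym (isEnd-dual S)) (cong isEnd (end≈⇒≡ (≈-sym q)))))

  elabᵛ : ∀ {E X Γ Λ Δ V U} → Γ ⨾ Λ ⨾ Δ ⊢ᵛ V ▷ U → Rel E Γ Δ → XRel X Γ Λ → NoReuseᵛ E V → WTᵛ E X V U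
  elabᵛ (LVar n (l , _) e (arr w)) R h nr = var (typed h (inj₂ l)) w (≈ᶜˢ-refl _)
  elabᵛ {E} {V = V} (Prom e e′ t) R h nr = promoted none (elabᵛ t R h nr)
    where
    none : ∀ u → Ses E u → u ∉ fuᵛ V
    none u ss m with scoped (factsᵛ t) m
    ... | inj₁ (_ , p) = not-Ses {u = u} R p ss
    ... | inj₂ (_ , d) = just≢nothing d (e′ u)
  elabᵛ (EProm so n v l t) R h nr =
    elabᵛ t (Rel-names (λ u → proj₂ so u (λ ())) R) (XRel-EProm so n v l h) nr
  elabᵛ (Conv t q _) R h nr = WTᵛ-≈ (elabᵛ t R h nr) q
  elabᵛ (Abs {Γ′} {xCs = xCs} {P} un so t ts s) R h nr =
    ƛ un (params-WF xCs ts) dead′ (λ ()) (elab t (Rel-params un so ts s (apart F) R) (XRel-vars (λ x → proj₁ so x (λ ())) h) nr)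
      (≈ᶜˢ-refl _)
    where
    F = facts t
    dead′ : ∀ {x S} → (x , ses S) ∈ xCs → nv x ∈ fu P ⊎ S ≡ end
    dead′ m with params-inv xCs ts m
    ... | ses _ d q _ with dead-ok F (⊎ᵐ-⊆ʳ s d)
    ...   | inj₁ m′         = inj₁ m′
    ...   | inj₂ (refl , _) = inj₂ (end≈⇒≡ q)

-- Typing the decomposition

open Facts

-- The graph of the function local to `rn`, which gives its results an induction principle.
data Recs (E : Env) : List (Nm source) → List (Nm source × SType) → Set where
  []   : Recs E [] []
  take : ∀ {u us S rs} → recOf E u ≡ just S → Recs E us rs → Recs E (u ∷ us) ((u , S) ∷ rs)
  skip : ∀ {u us rs} → recOf E u ≡ nothing → Recs E us rs → Recs E (u ∷ us) rs

mutual
  rn-recs : ∀ E P → Recs E (deduplicate _≟ⁿ_ (fu P)) (rn E P)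
  rn-recs E P with deduplicate _≟ⁿ_ (fu P)
  ... | us = recs-recs E P us

  -- The function local to rn cannot be named; the underscore is solved to it by rn-recs.
  recs-recs : ∀ E (P : Proc source) us → Recs E us _
  recs-recs E P []       = []
  recs-recs E P (u ∷ us) with recOf E u in eq
  ... | just S  = take eq (recs-recs E P us)
  ... | nothing = skip eq (recs-recs E P us)

recOf-inv : ∀ E u {S} → recOf E u ≡ just S → ∃[ i ] E u ≡ just (ses S , i) × recursive S ≡ true
recOf-inv E u e with E u
... | just (ses S , i) with recursive S in r
recOf-inv E u refl | just (ses S , i) | true = i , refl , r

recOf-rec : ∀ {E u S i} → E u ≡ just (ses S , i) → recursive S ≡ true → recOf E u ≡ just S
recOf-rec e r rewrite e | r = refl

Recs-∈ : ∀ {E us rs r S} → Recs E us rs → (r , S) ∈ rs → r ∈ us × recOf E r ≡ just S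
Recs-∈ (take e R) (here refl) = here refl , e
Recs-∈ (take e R) (there m)   = let m′ , e′ = Recs-∈ R m in there m′ , e′
Recs-∈ (skip e R) m           = let m′ , e′ = Recs-∈ R m in there m′ , e′

∈-Recs : ∀ {E us rs u S} → Recs E us rs → u ∈ us → recOf E u ≡ just S → (u , S) ∈ rs
∈-Recs (take e R) (here refl) e′ with trans (sym e) e′
... | refl = here refl
∈-Recs (take e R) (there m)   e′ = there (∈-Recs R m e′)
∈-Recs (skip e R) (here refl) e′ = just≢nothing e′ e
∈-Recs (skip e R) (there m)   e′ = ∈-Recs R m e′

Recs-keys : ∀ {E us rs r} → Recs E us rs → r ∈ map proj₁ rs → r ∈ us
Recs-keys R m with ∈-map⁻ proj₁ m
... | _ , m′ , refl = proj₁ (Recs-∈ R m′)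

Recs-unique : ∀ {E us rs} → Recs E us rs → Unique us → Unique (map proj₁ rs)
Recs-unique []         un           = []
Recs-unique (take e R) (fresh ∷ un) = All.tabulate (λ m e′ → All.lookup fresh (Recs-keys R m) e′) ∷ Recs-unique R un
Recs-unique (skip e R) (fresh ∷ un) = Recs-unique R un

module _ (Γ : SharedEnv source) (Δ : SessionEnv source) where

  env-session : ∀ {u S} → Δ u ≡ just S → env Γ Δ u ≡ just (ses S , 1)
  env-session d rewrite d = refl

  env-shared : ∀ {u U} → Δ u ≡ nothing → names Γ u ≡ just U → env Γ Δ u ≡ just (⟨ U ⟩ , 1)
  env-shared d n rewrite d | n = refl

  env-nothing : ∀ {u} → Δ u ≡ nothing → names Γ u ≡ nothing → env Γ Δ u ≡ nothing
  env-nothing d n rewrite d | n = refl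

  env-inv : ∀ {u S i} → env Γ Δ u ≡ just (ses S , i) → Δ u ≡ just S × i ≡ 1
  env-inv {u} e with Δ u | names Γ u
  env-inv refl | just S  | _      = refl , refl
  env-inv ()   | nothing | just _
  env-inv ()   | nothing | nothing

  env-¬Ses : ∀ {u} → Δ u ≡ nothing → ¬ Ses (env Γ Δ) u
  env-¬Ses d (S , i , e) = just≢nothing (proj₁ (env-inv e)) d

  env-Rel : ∀ {Λ us} → Facts Γ Λ Δ us → Rel (env Γ Δ) Γ Δ
  env-Rel F = record
    { shared = λ {u} {U} n → U , env-shared (absent n) n , ≈ᵁ-refl U , λ w → w
    ; unshared = λ {u} n e → unshared′ n e
    ; session = λ {u} {S} d → S , 1 , env-session d , ≈-refl , wf F d }
    where
    absent : ∀ {u U} → names Γ u ≡ just U → Δ u ≡ nothing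
    absent {u} n with Δ u in d
    ... | nothing = refl
    ... | just S  = just≢nothing n (apart F d)
    unshared′ : ∀ {u U i} → names Γ u ≡ nothing → env Γ Δ u ≡ just (⟨ U ⟩ , i) → ⊥
    unshared′ {u} n e with Δ u in d
    ... | just S  with e
    ...   | ()
    unshared′ {u} n e | nothing rewrite n with e
    ... | ()

  -- `env` gives Δ priority over Γ, so a name typed in both would lose its shared type; the
  -- hypothesis rules this out.
  env-indexed : (∀ {u S} → Δ u ≡ just S → names Γ u ≡ nothing) →
                ∀ u i → names (𝒢Γσ Γ) (u at[ i ]) ≡ sharedAt (env Γ Δ u) i
  env-indexed ap u i = trans (unindexed u i) (go (Δ u) refl (names Γ u) refl)
    where
    unindexed : ∀ u i → names (𝒢Γσ Γ) (u at[ i ]) ≡ (names Γ u >>= λ U → [ 𝒢ᵁ U ] ! i)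
    unindexed (sh _)   i = refl
    unindexed (se _ _) i = refl
    unindexed (nv _)   i = refl
    go : ∀ d → Δ u ≡ d → ∀ n → names Γ u ≡ n → (names Γ u >>= λ U → [ 𝒢ᵁ U ] ! i) ≡ sharedAt (env Γ Δ u) i
    go (just S) d n e rewrite env-session d | ap d = refl
    go nothing d (just U) e rewrite env-shared d e | e = refl
    go nothing d nothing e rewrite env-nothing d e | e = refl

nothing-right : ∀ {A : Set} (m : Maybe A) → (m <∣> nothing) ≡ m
nothing-right (just _) = refl
nothing-right nothing  = refl

theorem3p28 : (Γ : SharedEnv source) (Δ Δμ : SessionEnv source) (P : Proc source) (k : ℕ) →
    0 < k →
    Closed P →
    Disjoint Δ Δμ →
    (∀ u S → Δμ u ≡ just S → Tr S) →
    NoReuse (env Γ (Δ ∪ Δμ)) P →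
    Γ ⨾ ∅ ⨾ (Δ ∪ Δμ) ⊢ P →
    𝒢Γσ Γ ⨾ ∅ ⨾ (𝒢Δσ Δ ∪ 𝒢Δσ Δμ) ⊢ 𝒟 k (env Γ (Δ ∪ Δμ)) P
theorem3p28 Γ Δ Δμ P k _ closed disj _ nr t =
  session-ext (λ w → sym (environment w))
    (νc-typed {C = ∅} {D = ∅} k (pays T) (pays-length T) (pays-minimal T) ⊎ᵐ-∅ˡ ⊎ᵐ-∅ˡ
      (νcʳ-typed rs unique (λ m → let _ , r , w = serversᴱ m in ℛ⋆-minimal w r) body))
  where
  E  = env Γ (Δ ∪ Δμ)
  F  = facts t
  T : WT E (vars Γ) P
  T = elab t (env-Rel Γ (Δ ∪ Δμ) F) (xrel λ { (inj₁ p) → p ; (inj₂ ()) }) nr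
  -- A list that covers the domain of `Δ ∪ Δμ`: each name typed there is mentioned in `P` or was
  -- discarded by End.
  us = dead F ++ fu P
  rs = rn E P
  R : Recs E (deduplicate _≟ⁿ_ (fu P)) rs
  R = rn-recs E P
  unique : Unique (map proj₁ rs)
  unique = Recs-unique R (UniqueDec.deduplicate-! _≟ⁿ_ (fu P))

  serversᴱ : ∀ {r S} → (r , S) ∈ rs → E r ≡ just (ses S , 1) × recursive S ≡ true × WF S
  serversᴱ {r} m with recOf-inv E r (proj₂ (Recs-∈ R m))
  ... | i , e , q with env-inv Γ (Δ ∪ Δμ) e
  ...   | d , refl = e , q , wf F d

  in-rs : ∀ {u S i} → u ∈ fu P → E u ≡ just (ses S , i) → recursive S ≡ true → (u , S) ∈ rs
  in-rs m e r = ∈-Recs R (∈-deduplicate⁺ _≟ⁿ_ m) (recOf-rec {E} e r)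

  ended : ∀ {w S i} → E w ≡ just (ses S , i) → w ∈ fu P ⊎ S ≡ end
  ended e with dead-ok F (proj₁ (env-inv Γ (Δ ∪ Δμ) e))
  ... | inj₁ m       = inj₁ m
  ... | inj₂ (q , _) = inj₂ q

  -- Since `end` is not recursive, no recursive name was discarded by End; all of them occur in `P`
  -- and have a server.
  recursive-live : live recursive E us ≗ live recursive E (map proj₁ rs)
  recursive-live = live-⇔ᵖ recursive {E} {us} {map proj₁ rs} to
    (λ _ _ m → ∈-++⁺ʳ (dead F) (∈-deduplicate⁻ _≟ⁿ_ (fu P) (Recs-keys R m)))
    where
    to : ∀ {u S i} → E u ≡ just (ses S , i) → recursive S ≡ true → u ∈ us → u ∈ map proj₁ rs
    to e r _ with ended e
    ... | inj₁ m    = ∈-map⁺ proj₁ (in-rs m e r)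
    to e () _ | inj₂ refl

  environment : 𝒢Δσ Δ ∪ 𝒢Δσ Δμ ≗ senv (live allTypes E us) ∅ ∅ ∅
  environment = by-name
    where
    typed-at : ∀ {u S} i → (Δ ∪ Δμ) u ≡ just S → 𝒢 S ! i ≡ live allTypes E us (u , i)
    typed-at {u} {S} i d = trans (!≡seg (𝒢 S) i)
      (sym (trans (live-∈ allTypes E us i here′) (entry-hit allTypes (env-session Γ (Δ ∪ Δμ) d) refl i)))
      where
      here′ : u ∈ us
      here′ with dead-ok F d
      ... | inj₁ m       = ∈-++⁺ʳ (dead F) m
      ... | inj₂ (_ , m) = ∈-++⁺ˡ m
    at-index : ∀ u i → ((Δ u >>= λ S → 𝒢 S ! i) <∣> (Δμ u >>= λ S → 𝒢 S ! i)) ≡ live allTypes E us (u , i)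
    at-index u i = go (Δ u) (Δμ u) refl refl
      where
      go : ∀ m m′ → Δ u ≡ m → Δμ u ≡ m′ →
           ((m >>= λ S → 𝒢 S ! i) <∣> (m′ >>= λ S → 𝒢 S ! i)) ≡ live allTypes E us (u , i)
      go (just S) nothing  d dμ = trans (nothing-right (𝒢 S ! i)) (typed-at i (cong (_<∣> Δμ u) d))
      go nothing  (just S) d dμ = typed-at i (trans (cong (_<∣> Δμ u) d) dμ)
      go nothing  nothing  d dμ =
        sym (live-¬Ses allTypes E us i (env-¬Ses Γ (Δ ∪ Δμ) (trans (cong (_<∣> Δμ u) d) dμ)))
      go (just S) (just _) d dμ with disj u
      ... | inj₁ e = just≢nothing d e
      ... | inj₂ e = just≢nothing dμ e
    by-name : 𝒢Δσ Δ ∪ 𝒢Δσ Δμ ≗ senv (live allTypes E us) ∅ ∅ ∅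
    by-name (sh (a at i))       = at-index (sh a) i
    by-name (se (s at i) p)     = at-index (se s p) i
    by-name (nv (x at i))       = at-index (nv x) i
    by-name (sh (prop _))       = refl
    by-name (sh (rec _))        = refl
    by-name (sh (zed _ _))      = refl
    by-name (se (prop _) pos)   = refl
    by-name (se (prop _) neg)   = refl
    by-name (se (rec _) _)      = refl
    by-name (se (zed _ _) _)    = refl
    by-name (nv (prop _))       = refl
    by-name (nv (rec _))        = refl
    by-name (nv (zed _ _))      = refl

  body : ∀ N → (∀ w → (∀ r → r ∈ map proj₁ rs → w ≢ c^ r) → N w ≡ names (𝒢Γσ Γ) w) →
         (∀ {r S} → (r , S) ∈ rs → N (c^ r) ≡ just (arr lin (map ses (ℛ⋆ S)))) →
         rename N (𝒢Γσ Γ) ⨾ ∅ ⨾ senv (live allTypes E us) (segᵍ recvT k (pays T)) (segᵍ sendT k (pays T)) ∅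
           ⊢ servers rs (c̄ₖ k [] 𝟎 ∣ ℬ E k [] P)
  body N off at-rs =
    servers-typed {E = E} rs unique serversᴱ at-rs (session-index FN)
      (⊎ᵐ-resp (λ _ → refl) (λ _ → refl) recursive-live (live-all-⊎ {E} {us}))
      (weaken-ended (session-index FN) (dead F) (λ _ → ended)
        -- Closedness turns `fv P` into the empty context with which the decomposition starts.
        (subst (λ xs → rename N (𝒢Γσ Γ) ⨾ ∅ ⨾ senv (live nonrec E (fu P)) (segᵍ recvT k (pays T)) (segᵍ sendT k (pays T)) ∅
                         ⊢ (c̄ₖ k xs 𝟎 ∣ ℬ E k xs P)) (proj₁ closed) main))
    where
    FN : Fits N E (fu P)
    FN = Fits-νcʳ {N₁ = names (𝒢Γσ Γ)} rs (env-indexed Γ (Δ ∪ Δμ) (apart F)) (λ _ _ → refl) (λ _ _ → refl) off at-rs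
           (λ m e r → inj₁ (in-rs m e r))
    main : rename N (𝒢Γσ Γ) ⨾ ∅ ⨾ senv (live nonrec E (fu P)) (segᵍ recvT k (pays T)) (segᵍ sendT k (pays T)) ∅
             ⊢ (c̄ₖ k (fv P) 𝟎 ∣ ℬ E k (fv P) P)
    main = Par ⊎ᵐ-∅ˡ (senv-⊎ ⊎ᵐ-∅ˡ ⊎ᵐ-∅ˡ (seg-head-⊎ sendT (pays-head T)) ⊎ᵐ-∅ˡ)
      (next-typed {Γ = rename N (𝒢Γσ Γ)} {vars Γ} (propagator FN) (variable-z FN 0 0) (fv-typed T)
        (λ _ e → cong (_>>= λ Cs → just (𝒢ᶜˢ Cs)) e) ⊎ᵐ-∅ʳ (Nil (λ _ → refl) senv-∅))
      (ℬ-typed {Γ = rename N (𝒢Γσ Γ)} T FN)
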